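{- As $n\to\infty$, $g(n,K_3,P_6) = (1+o(1))\dfrac{n}{2}$.
   Context: The Constructor-Blocker game with parameters $n$, a graph $H$ and a graph $F$: Constructor and Blocker alternately claim previously unclaimed edges of $K_n$, Constructor moving first. Constructor may only claim an edge if afterwards her graph (edges she has claimed) contains no subgraph isomorphic to $F$; Blocker may claim any unclaimed edge. The game ends when Constructor cannot claim any more edges or all edges are claimed. The score is the number of copies of $H$ in Constructor's final graph; Constructor maximizes, Blocker minimizes, and $g(n,H,F)$ is the score under optimal play. $K_3$ is the triangle and $P_6$ is the path on $6$ vertices. -}

module Defs where

open import Data.Nat using (ℕ; zero; suc; _⊔_; _⊓_; _<ᵇ_)
open import Data.Fin using (Fin; toℕ) renaming (_≟_ to _≟ᶠ_)
open import Data.Bool using (Bool; true; false; _∧_; _∨_; not; if_then_else_)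
open import Data.Product using (_×_; _,_)
open import Data.List using (List; []; _∷_; map; foldr; length; concatMap; allFin; cartesianProduct)
open import Relation.Nullary.Decidable using (⌊_⌋)

bfilter : {A : Set} → (A → Bool) → List A → List A
bfilter p = foldr (λ x r → if p x then x ∷ r else r) []

-- An edge of K_n is stored as an ordered pair (i , j) with i < j.
Edge : ℕ → Set
Edge n = Fin n × Fin n

Graph : ℕ → Set
Graph n = List (Edge n)

_==_ : {n : ℕ} → Fin n → Fin n → Bool
i == j = ⌊ i ≟ᶠ j ⌋

sameE : {n : ℕ} → Edge n → Edge n → Bool
sameE (a , b) (c , d) = (a == c) ∧ (b == d)

memE : {n : ℕ} → Edge n → Graph n → Bool
memE e G = foldr (λ f r → sameE e f ∨ r) false G

adj : {n : ℕ} → Graph n → Fin n → Fin n → Bool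
adj G u v = memE (u , v) G ∨ memE (v , u) G

allEdges : (n : ℕ) → Graph n
allEdges n = bfilter (λ { (i , j) → toℕ i <ᵇ toℕ j }) (cartesianProduct (allFin n) (allFin n))

words : {n : ℕ} → ℕ → List (List (Fin n))
words {n} zero = [] ∷ []
words {n} (suc k) = concatMap (λ v → map (v ∷_) (words k)) (allFin n)

notIn : {n : ℕ} → Fin n → List (Fin n) → Bool
notIn v ws = foldr (λ w r → not (v == w) ∧ r) true ws

distinct : {n : ℕ} → List (Fin n) → Bool
distinct [] = true
distinct (v ∷ ws) = notIn v ws ∧ distinct ws

isWalk : {n : ℕ} → Graph n → List (Fin n) → Bool
isWalk G [] = true
isWalk G (v ∷ []) = true
isWalk G (v ∷ w ∷ ws) = adj G v w ∧ isWalk G (w ∷ ws)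

containsP6 : {n : ℕ} → Graph n → Bool
containsP6 G = foldr (λ w r → (distinct w ∧ isWalk G w) ∨ r) false (words 6)

triangles : {n : ℕ} → Graph n → ℕ
triangles {n} G = length (bfilter ok (words 3))
  where
  ok : List (Fin n) → Bool
  ok (a ∷ b ∷ c ∷ []) = (toℕ a <ᵇ toℕ b) ∧ (toℕ b <ᵇ toℕ c)
                        ∧ adj G a b ∧ adj G b c ∧ adj G a c
  ok _ = false

-- unclaimed edges, given Constructor's graph C and Blocker's graph B
unclaimed : {n : ℕ} → Graph n → Graph n → Graph n
unclaimed {n} C B = bfilter (λ e → not (memE e C ∨ memE e B)) (allEdges n)

legalC : {n : ℕ} → Graph n → Graph n → Graph n
legalC C B = bfilter (λ e → not (containsP6 (e ∷ C))) (unclaimed C B)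

maxL : List ℕ → ℕ
maxL = foldr _⊔_ 0

minL : ℕ → List ℕ → ℕ
minL x xs = foldr _⊓_ x xs

-- Minimax value of the game from position (C , B), with fuel bounding the
-- number of remaining moves (each move claims an unclaimed edge, so fuel =
-- number of edges of K_n suffices).  Bool argument: true = Constructor to move.
-- The game ends (score = triangles in C) when Constructor has no legal move
-- or all edges are claimed.
value : {n : ℕ} → ℕ → Bool → Graph n → Graph n → ℕ
value zero _ C B = triangles C
value (suc f) true C B with legalC C B
... | [] = triangles C
... | e ∷ es = maxL (map (λ e' → value f false (e' ∷ C) B) (e ∷ es))
value (suc f) false C B with legalC C B | unclaimed C B
... | [] | _ = triangles C
... | _ ∷ _ | [] = triangles C
... | _ ∷ _ | e ∷ es = minL (value f true C (e ∷ B)) (map (λ e' → value f true C (e' ∷ B)) es)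

g : ℕ → ℕ
g n = value {n} (length (allEdges n)) true [] []

{-# OPTIONS --safe #-}
-- Upper bound, in the form 2 g(n) ≤ n. Consider t triangles in a connected P₆-free graph on v vertices. Any two
-- triangles meet. If two of them share exactly one vertex (a butterfly) and v ≥ 6, then the triangles form a
-- windmill and 2t < v. Otherwise, unless t ≤ 1 or they span a K₄, they form a book: they share an edge, the spine,
-- and their third vertices are its pages. Blocker always answers inside the component in which Constructor has just
-- played. This alone leaves a component with v = 5 at most six edges, too few for a butterfly and a third triangle.
-- In a book Blocker closes the half-pages, the vertices joined to only one end of the spine, as fast as Constructor
-- completes them, so that at most half of the vertices become pages. When the second page appears he first has to
-- block the K₄; the tempo is paid for in advance by keeping, in components with at least three vertices, one end of
-- every edge incident to a blocked pair of the component.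
--
-- Lower bound. Among the vertices still isolated, Constructor chooses 4q + 7 that span no edge of Blocker, builds a
-- star with 2q + 3 leaves on them, picks a leaf with at most two blocked pairs to other leaves, and joins it to q
-- leaves. This turns 2q + 4 vertices into q triangles, and no P₆ arises because two vertices cover all edges of a
-- component. Blocker has only O(n) edges, so such a choice exists until o(n) isolated vertices are left.

module Submission where

open import Defs
open import Data.Nat.Properties
import Data.List.Relation.Unary.All as All
open import Relation.Binary.PropositionalEquality
import Data.Sum as Sum
import Data.List.Relation.Unary.AllPairs as AllPairs
import Data.List.Relation.Unary.AllPairs.Properties as AllPairsₚ
import Data.List.Relation.Unary.All.Properties as Allₚ
import Data.List.Relation.Unary.Unique.Propositional.Properties as Uniqueₚ
import Data.Vec as Vec
import Data.Vec.Relation.Unary.All as VecAll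
import Data.Vec.Relation.Unary.AllPairs as VecPairs
import Data.List.Relation.Unary.Any as Any
open import Data.Nat using (_*_; _+_; _<_; _<ᵇ_; _∸_; _≤?_; _≤_; suc; s≤s; zero; z≤n; ℕ)
open import Data.Nat.Tactic.RingSolver using (solve-∀)
open import Data.Fin using (Fin; toℕ) renaming (_≟_ to _≟ᶠ_)
open import Data.Bool using (Bool; T; T?; _∧_; _∨_; false; not; true)
open import Data.Bool.Properties using (T-∧; T-∨)
open import Data.Product using (_,_; _×_; proj₁; proj₂; ∃-syntax) renaming (swap to swapˣ)
open import Data.Sum using ([_,_]′; _⊎_; inj₁; inj₂)
open import Data.Empty using (⊥; ⊥-elim)
open import Data.Unit using (tt)
open import Data.List using (List; []; _++_; _∷_; allFin; cartesianProduct; foldr; length; map)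
open import Data.List.Membership.Propositional using (_∈_; find)
open import Data.List.Membership.Propositional.Properties using (∈-++⁺ʳ; ∈-++⁺ˡ; ∈-++⁻; ∈-allFin; ∈-cartesianProduct⁺; ∈-concatMap⁺; ∈-concatMap⁻; ∈-map⁺; ∈-map⁻)
open import Data.List.Relation.Unary.Any using (Any; here; there)
open import Data.List.Relation.Unary.All using (All; []; _∷_)
open import Data.List.Relation.Unary.All.Properties using (++⁺; map⁺)
open import Data.List.Relation.Unary.AllPairs using (AllPairs; []; _∷_; allPairs?)
open import Data.List.Relation.Unary.Unique.Propositional using (Unique)
open import Data.List.Relation.Unary.Unique.Propositional.Properties using (allFin⁺; cartesianProduct⁺; concat⁺)
open import Function using (Equivalence; _∘_)
open import Relation.Nullary using (Dec; _×-dec_; _⊎-dec_; no; yes; ¬?; ¬_)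
open import Relation.Nullary.Decidable using (decidable-stable; from-yes; fromWitness; toWitness; ⌊_⌋)
open import Data.Fin.Properties using (any?; toℕ-injective)
open import Data.Fin.Patterns using (0F; 1F; 2F; 3F; 4F)
open import Data.List.Properties using (length-++; length-tabulate; ∷-injective)
open import Data.List.Membership.DecPropositional using (_∈?_)
open import Data.Vec.Relation.Unary.Unique.Propositional.Properties using (lookup-injective)
open import Relation.Binary.Definitions using (tri<; tri>; tri≈)
open import Data.Nat.DivMod using (/-monoˡ-≤; _%_; _/_; m%n<n; m*n/n≡m; m≡m%n+[m/n]*n)

-- Counting

-- The quantity `2 * pages + up2 halves` stays in balance while a book grows: Constructor completes
-- one half-page, Blocker closes another, so one page is gained and two half-pages are lost. The
-- critical moment is the start of a book. Two pages with `h` half-pages require `4 + up2 h`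
-- vertices, and `up2 h` may be `h + 1`, whereas spine and pages supply only four vertices besides
-- the half-pages. A vertex blocked from an end of the spine is the fifth. A book may also start
-- with two pages at once, when Constructor draws a diagonal of a four-cycle. Hence Blocker treats
-- four-cycles before any triangle exists, so that the K₄ is blocked in advance. The six edges on
-- five vertices come from `2e ≤ 2b + v` for `e` edges of Constructor and `b` of Blocker: together
-- with `e + b ≤ v(v - 1)/2` this gives `4e ≤ v²`. Seven edges are a butterfly with a chord between
-- its blades, and such a chord is the only obstacle to a windmill; with a sixth vertex in the
-- component it already yields a path on six vertices.

private variable
  A I : Set
  n : ℕ

∧⁺ : {a b : Bool} → T a → T b → T (a ∧ b)
∧⁺ p q = Equivalence.from T-∧ (p , q)

∧⁻ : {a b : Bool} → T (a ∧ b) → T a × T b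
∧⁻ = Equivalence.to T-∧

∨⁻ : {a b : Bool} → T (a ∨ b) → T a ⊎ T b
∨⁻ = Equivalence.to T-∨

∨⁺ˡ : {a : Bool} (b : Bool) → T a → T (a ∨ b)
∨⁺ˡ b p = Equivalence.from T-∨ (inj₁ p)

∨⁺ʳ : (a : Bool) {b : Bool} → T b → T (a ∨ b)
∨⁺ʳ a p = Equivalence.from (T-∨ {a}) (inj₂ p)

not⁺ : {a : Bool} → ¬ T a → T (not a)
not⁺ {true} f = f tt
not⁺ {false} f = tt

not⁻ : {a : Bool} → T (not a) → ¬ T a
not⁻ {false} _ ()

==⁻ : {i j : Fin n} → T (i == j) → i ≡ j
==⁻ = toWitness

==⁺ : {i j : Fin n} → i ≡ j → T (i == j)
==⁺ = fromWitness

b2n : Bool → ℕ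
b2n true = 1
b2n false = 0

cnt : (A → Bool) → List A → ℕ
cnt p [] = 0
cnt p (x ∷ xs) = b2n (p x) + cnt p xs

cnt-bfilter : (p : A → Bool) (xs : List A) → length (bfilter p xs) ≡ cnt p xs
cnt-bfilter p [] = refl
cnt-bfilter p (x ∷ xs) with p x
... | true = cong suc (cnt-bfilter p xs)
... | false = cnt-bfilter p xs

private
  +-interchange : ∀ a b c d → (a + b) + (c + d) ≡ (a + c) + (b + d)
  +-interchange = solve-∀

cnt-⊎ : {p q r : A → Bool} →
        (∀ z → T (p z) → T (q z) → ⊥) → (∀ z → T (p z) → T (r z)) → (∀ z → T (q z) → T (r z)) →
        (xs : List A) → cnt p xs + cnt q xs ≤ cnt r xs
cnt-⊎ d f g [] = z≤n
cnt-⊎ {p = p} {q} {r} d f g (x ∷ xs)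
  rewrite +-interchange (b2n (p x)) (cnt p xs) (b2n (q x)) (cnt q xs)
  = +-mono-≤ (head (p x) (q x) (r x) (d x) (f x) (g x)) (cnt-⊎ d f g xs)
  where
  head : ∀ a b c → (T a → T b → ⊥) → (T a → T c) → (T b → T c) → b2n a + b2n b ≤ b2n c
  head true true _ d _ _ = ⊥-elim (d tt tt)
  head true false true _ _ _ = ≤-refl
  head true false false _ f _ = ⊥-elim (f tt)
  head false true true _ _ _ = ≤-refl
  head false true false _ _ g = ⊥-elim (g tt)
  head false false _ _ _ _ = z≤n

cnt-∪∈ : {p q r : A → Bool} (xs : List A) → (∀ {z} → z ∈ xs → T (r z) → T (p z) ⊎ T (q z)) →
         cnt r xs ≤ cnt p xs + cnt q xs
cnt-∪∈ [] f = z≤n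
cnt-∪∈ {p = p} {q} {r} (x ∷ xs) f
  rewrite +-interchange (b2n (p x)) (cnt p xs) (b2n (q x)) (cnt q xs)
  = +-mono-≤ (head (p x) (q x) (r x) (f (here refl))) (cnt-∪∈ xs (f ∘ there))
  where
  head : ∀ a b c → (T c → T a ⊎ T b) → b2n c ≤ b2n a + b2n b
  head _ _ false _ = z≤n
  head true _ true _ = s≤s z≤n
  head false true true _ = ≤-refl
  head false false true f = [ ⊥-elim , ⊥-elim ]′ (f tt)

cnt-∪ : {p q r : A → Bool} → (∀ z → T (r z) → T (p z) ⊎ T (q z)) →
        (xs : List A) → cnt r xs ≤ cnt p xs + cnt q xs
cnt-∪ f xs = cnt-∪∈ xs (λ {z} _ → f z)

cnt-false : (xs : List A) → cnt (λ _ → false) xs ≡ 0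
cnt-false [] = refl
cnt-false (x ∷ xs) = cnt-false xs

cnt-true : (xs : List A) → cnt (λ _ → true) xs ≡ length xs
cnt-true [] = refl
cnt-true (x ∷ xs) = cong suc (cnt-true xs)

cnt-mono : {p q : A → Bool} → (∀ z → T (p z) → T (q z)) → (xs : List A) → cnt p xs ≤ cnt q xs
cnt-mono {p = p} {q} f xs = ≤-trans (m≤m+n (cnt p xs) _)
  (cnt-⊎ {q = λ _ → false} (λ _ _ ()) f (λ _ ()) xs)

cnt-≗ : {p q : A → Bool} → (∀ z → p z ≡ q z) → (xs : List A) → cnt p xs ≡ cnt q xs
cnt-≗ f xs = ≤-antisym (cnt-mono (λ z → subst T (f z)) xs) (cnt-mono (λ z → subst T (sym (f z))) xs)

cnt-≥1 : {p : A → Bool} {x : A} {xs : List A} → x ∈ xs → T (p x) → 1 ≤ cnt p xs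
cnt-≥1 {p = p} {xs = x ∷ xs} (here refl) t with p x
... | true = s≤s z≤n
cnt-≥1 {p = p} {xs = x ∷ xs} (there i) t =
  ≤-trans (cnt-≥1 i t) (m≤n+m _ (b2n (p x)))

cnt-≡0 : {p : A → Bool} → (∀ z → ¬ T (p z)) → (xs : List A) → cnt p xs ≡ 0
cnt-≡0 {p = p} f xs = n≤0⇒n≡0 (subst (cnt p xs ≤_) (cnt-false xs) (cnt-mono {q = λ _ → false} f xs))

-- The common form of all double counts below: disjoint sets of size at least `k` inside `p`. It
-- serves vertices owned by triangles, listed edges, and rows of an adjacency matrix.
cnt-family : {p : A → Bool} {xs : List A} (k : ℕ) (d : I → A → Bool) {is : List I} →
  AllPairs (λ i j → ∀ z → T (d i z) → T (d j z) → ⊥) is →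
  All (λ i → k ≤ cnt (d i) xs × (∀ z → T (d i z) → T (p z))) is →
  length is * k ≤ cnt p xs
cnt-family k d [] [] = z≤n
cnt-family {p = p} {xs} k d {i ∷ is} (a ∷ as) ((c , f) ∷ hs) =
  ≤-trans (+-mono-≤ c (cnt-family {p = λ z → p z ∧ not (d i z)} {xs} k d as
            (All.zipWith (λ { (ex , (c' , f')) → c' , λ z t → ∧⁺ (f' z t) (not⁺ λ t' → ex z t' t) }) (a , hs))))
          (cnt-⊎ (λ z t t' → not⁻ (proj₂ (∧⁻ {p z} t')) t) f (λ z t → proj₁ (∧⁻ t)) xs)

V# : (Fin n → Bool) → ℕ
V# {n} p = cnt p (allFin n)

V#-point : (x : Fin n) → 1 ≤ V# (_== x)
V#-point x = cnt-≥1 (∈-allFin x) (==⁺ refl)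

cnt-≤1 : {p : A → Bool} → (∀ {x y} → T (p x) → T (p y) → x ≡ y) → {xs : List A} → Unique xs → cnt p xs ≤ 1
cnt-≤1 f [] = z≤n
cnt-≤1 {p = p} f {x ∷ xs} (a ∷ u) with p x | f {x}
... | false | _ = cnt-≤1 f u
... | true | f' = s≤s (≤-reflexive (none a))
  where
  none : ∀ {xs} → All (x ≢_) xs → cnt p xs ≡ 0
  none [] = refl
  none {z ∷ _} (ne ∷ a) with p z | f' {z} tt
  ... | false | _ = none a
  ... | true | e = ⊥-elim (ne (e tt))

V#-point≤1 : (x : Fin n) → V# (_== x) ≤ 1
V#-point≤1 {n} x = cnt-≤1 (λ s t → trans (==⁻ s) (sym (==⁻ t))) (allFin⁺ n)

V#-unique : {p : Fin n → Bool} {xs : List (Fin n)} → Unique xs → All (T ∘ p) xs → length xs ≤ V# p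
V#-unique {n} {p} {xs} u a = subst (_≤ V# p) (*-identityʳ (length xs)) (cnt-family {xs = allFin n} 1 (λ x z → z == x) (mapU u)
  (All.map (λ {x} t → V#-point x , λ z e → subst (T ∘ p) (sym (==⁻ e)) t) a))
  where
  mapU : ∀ {xs} → Unique xs → AllPairs (λ i j → ∀ z → T (z == i) → T (z == j) → ⊥) xs
  mapU [] = []
  mapU (a ∷ u) = All.map (λ ne z e f → ne (trans (sym (==⁻ e)) (==⁻ f))) a ∷ mapU u

-- Counting unordered pairs

pairs : List A → List (A × A)
pairs [] = []
pairs (x ∷ xs) = map (x ,_) xs ++ pairs xs

cnt-++ : (p : A → Bool) (xs ys : List A) → cnt p (xs ++ ys) ≡ cnt p xs + cnt p ys
cnt-++ p [] ys = refl
cnt-++ p (x ∷ xs) ys rewrite cnt-++ p xs ys =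
  sym (+-assoc (b2n (p x)) _ _)

cnt-map : (p : A → Bool) (f : I → A) (xs : List I) → cnt p (map f xs) ≡ cnt (p ∘ f) xs
cnt-map p f [] = refl
cnt-map p f (x ∷ xs) rewrite cnt-map p f xs = refl

both : (A → Bool) → A × A → Bool
both p (a , b) = p a ∧ p b

private
  square : ∀ v P → 2 * P + v ≡ v * v → 2 * (v + P) + suc v ≡ suc v * suc v
  square v P h = trans (s₁ v P) (trans (cong (λ k → k + suc (2 * v)) h) (s₂ v))
    where
    s₁ : ∀ v P → 2 * (v + P) + suc v ≡ (2 * P + v) + suc (2 * v)
    s₁ = solve-∀
    s₂ : ∀ v → v * v + suc (2 * v) ≡ suc v * suc v
    s₂ = solve-∀

-- This is `2 * (v choose 2) = v * v - v` without subtraction. It is needed as an equality, because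
-- the treatment of full classes depends on the residue modulo 4.
cnt-both : (p : A → Bool) (xs : List A) → 2 * cnt (both p) (pairs xs) + cnt p xs ≡ cnt p xs * cnt p xs
cnt-both p [] = refl
cnt-both p (x ∷ xs)
  rewrite cnt-++ (both p) (map (x ,_) xs) (pairs xs) | cnt-map (both p) (x ,_) xs with p x
... | true = square (cnt p xs) (cnt (both p) (pairs xs)) (cnt-both p xs)
... | false rewrite cnt-false xs = cnt-both p xs

∈-pairs : {x y : A} {xs : List A} → x ≢ y → x ∈ xs → y ∈ xs → ((x , y) ∈ pairs xs) ⊎ ((y , x) ∈ pairs xs)
∈-pairs ne (here refl) (here refl) = ⊥-elim (ne refl)
∈-pairs ne (here refl) (there j) = inj₁ (∈-++⁺ˡ (∈-map⁺ _ j))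
∈-pairs ne (there i) (here refl) = inj₂ (∈-++⁺ˡ (∈-map⁺ _ i))
∈-pairs {xs = z ∷ xs} ne (there i) (there j) with ∈-pairs ne i j
... | inj₁ k = inj₁ (∈-++⁺ʳ (map (z ,_) xs) k)
... | inj₂ k = inj₂ (∈-++⁺ʳ (map (z ,_) xs) k)

-- Each unordered pair of vertices is listed in one order only, which is why `isPair` accepts both
-- orders.
P# : (Fin n × Fin n → Bool) → ℕ
P# {n} p = cnt p (pairs (allFin n))

isPair : Fin n → Fin n → Fin n × Fin n → Bool
isPair x y (a , b) = ((a == x) ∧ (b == y)) ∨ ((a == y) ∧ (b == x))

isPair⁻ : {x y a b : Fin n} → T (isPair x y (a , b)) → (a ≡ x × b ≡ y) ⊎ (a ≡ y × b ≡ x)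
isPair⁻ {x = x} {y} {a} {b} t with ∨⁻ {(a == x) ∧ (b == y)} t
... | inj₁ s = let (p , q) = ∧⁻ {a == x} s in inj₁ (==⁻ p , ==⁻ q)
... | inj₂ s = let (p , q) = ∧⁻ {a == y} s in inj₂ (==⁻ p , ==⁻ q)

isPairˡ : (x y : Fin n) → T (isPair x y (x , y))
isPairˡ x y = ∨⁺ˡ _ (∧⁺ {x == x} (==⁺ refl) (==⁺ refl))

isPairʳ : (x y : Fin n) → T (isPair x y (y , x))
isPairʳ x y = ∨⁺ʳ ((y == x) ∧ (x == y)) (∧⁺ {y == y} (==⁺ refl) (==⁺ refl))

P#-point : {x y : Fin n} → x ≢ y → 1 ≤ P# (isPair x y)
P#-point {x = x} {y} ne with ∈-pairs ne (∈-allFin x) (∈-allFin y)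
... | inj₁ i = cnt-≥1 i (isPairˡ x y)
... | inj₂ i = cnt-≥1 i (isPairʳ x y)

-- Both entries of such a pair lie in a set of at most two vertices, and by `cnt-both` a set of that
-- size spans at most one pair.
P#-point≤1 : (x y : Fin n) → P# (isPair x y) ≤ 1
P#-point≤1 {n} x y = ≤-trans (cnt-mono sub (pairs (allFin n))) (bound _ _ v≤2 (cnt-both p (allFin n)))
  where
  p : Fin n → Bool
  p z = (z == x) ∨ (z == y)
  sub : ∀ ab → T (isPair x y ab) → T (both p ab)
  sub (a , b) t with isPair⁻ {x = x} {y} {a} {b} t
  ... | inj₁ (refl , refl) = ∧⁺ {p x} (∨⁺ˡ (x == y) (==⁺ {i = x} refl)) (∨⁺ʳ (y == x) (==⁺ refl))
  ... | inj₂ (refl , refl) = ∧⁺ {p y} (∨⁺ʳ (y == x) (==⁺ refl)) (∨⁺ˡ (x == y) (==⁺ {i = x} refl))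
  v≤2 : V# p ≤ 2
  v≤2 = ≤-trans (cnt-∪ (λ z → ∨⁻ {z == x}) (allFin n)) (+-mono-≤ (V#-point≤1 x) (V#-point≤1 y))
  bound : ∀ v P → v ≤ 2 → 2 * P + v ≡ v * v → P ≤ 1
  bound v zero _ _ = z≤n
  bound v (suc zero) _ _ = ≤-refl
  bound 0 (suc (suc P)) _ ()
  bound 1 (suc (suc P)) _ ()
  bound 2 (suc (suc P)) _ h = ⊥-elim (1+n≢0 {suc (2 * P)} (+-cancelʳ-≡ 4 _ 0 (trans (sym (eq P)) h)))
    where
    eq : ∀ P → 2 * (2 + P) + 2 ≡ suc (suc (2 * P)) + 4
    eq = solve-∀
  bound (suc (suc (suc v))) _ (s≤s (s≤s ())) _

V#-room : {p r : Fin n → Bool} {xs : List (Fin n)} → Unique xs → All (T ∘ r) xs → All (¬_ ∘ T ∘ p) xs →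
  (∀ z → T (p z) → T (r z)) → length xs + V# p ≤ V# r
V#-room {n} {p} {r} u a na f = ≤-trans
  (+-monoˡ-≤ (V# p) (V#-unique {p = λ z → r z ∧ not (p z)} u (All.zipWith (λ { (t , nt) → ∧⁺ t (not⁺ nt) }) (a , na))))
  (cnt-⊎ (λ z t t' → not⁻ (proj₂ (∧⁻ {r z} t)) t') (λ z t → proj₁ (∧⁻ t)) f (allFin n))

V#-two : {p : Fin n → Bool} {x y : Fin n} → (∀ z → T (p z) → z ≡ x ⊎ z ≡ y) → V# p ≤ 2
V#-two {n} {x = x} {y} f = ≤-trans
  (cnt-∪ {p = _== x} {q = _== y} (λ z t → [ (λ e → inj₁ (==⁺ e)) , (λ e → inj₂ (==⁺ e)) ]′ (f z t)) (allFin n))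
  (+-mono-≤ (V#-point≤1 x) (V#-point≤1 y))

pairs-distinct : {xs : List A} → Unique xs → All (λ ab → proj₁ ab ≢ proj₂ ab) (pairs xs)
pairs-distinct [] = []
pairs-distinct (a ∷ u) = ++⁺ (map⁺ a) (pairs-distinct u)

bfilter-all : {P : A → Set} (p : A → Bool) → (∀ z → T (p z) → P z) → (xs : List A) → All P (bfilter p xs)
bfilter-all p f [] = []
bfilter-all p f (x ∷ xs) with p x | f x
... | true | h = h tt ∷ bfilter-all p f xs
... | false | _ = bfilter-all p f xs

bfilter-⊆ : {P : A → Set} (p : A → Bool) {xs : List A} → All P xs → All P (bfilter p xs)
bfilter-⊆ p [] = []
bfilter-⊆ p {x ∷ xs} (h ∷ hs) with p x
... | true = h ∷ bfilter-⊆ p hs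
... | false = bfilter-⊆ p hs

bfilter-unique : (p : A → Bool) {xs : List A} → Unique xs → Unique (bfilter p xs)
bfilter-unique p [] = []
bfilter-unique p {x ∷ xs} (a ∷ u) with p x
... | true = bfilter-⊆ p a ∷ bfilter-unique p u
... | false = bfilter-unique p u

-- Triangles in connected P₆-free graphs

Adj : ℕ → Set
Adj n = Fin n → Fin n → Bool

record Simple {n : ℕ} (c : Adj n) : Set where
  field
    irr : ∀ {u} → ¬ T (c u u)
    sy : ∀ {u v} → T (c u v) → T (c v u)

  ~≢ : ∀ {u v} → T (c u v) → u ≢ v
  ~≢ e refl = irr e

-- Ten inequalities for the non-consecutive pairs; for consecutive vertices distinctness comes from
-- `~≢`.
P6Free : {n : ℕ} → Adj n → Set
P6Free c = ∀ {p q r s t u} → T (c p q) → T (c q r) → T (c r s) → T (c s t) → T (c t u) →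
  p ≢ r → p ≢ s → p ≢ t → p ≢ u → q ≢ s → q ≢ t → q ≢ u → r ≢ t → r ≢ u → s ≢ u → ⊥

module Shape {n : ℕ} (c : Adj n) (L : Fin n → Fin n) where

  Common : Fin n → Fin n → Fin n → Set
  Common u v p = T (c u p) × T (c v p)

  Tri : Fin n → Fin n → Fin n → Set
  Tri u v w = T (c u v) × Common u v w

  In : Fin n → Fin n → Fin n → Fin n → Set
  In z u v w = z ≡ u ⊎ z ≡ v ⊎ z ≡ w

  Spine : Fin n → Fin n → Set
  Spine u v = T (c u v) × ∃[ p ] ∃[ q ] p ≢ q × Common u v p × Common u v q

  Blades : Fin n → Fin n → Fin n → Fin n → Fin n → Set
  Blades u a b d e = Tri u a b × Tri u d e × a ≢ d × a ≢ e × b ≢ d × b ≢ e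

  HasTriangle : Fin n → Set
  HasTriangle s = ∃[ u ] L u ≡ L s × ∃[ v ] ∃[ w ] Tri u v w

  HasSpine : Fin n → Set
  HasSpine s = ∃[ u ] L u ≡ L s × ∃[ v ] Spine u v

  HasButterfly : Fin n → Set
  HasButterfly s = ∃[ u ] L u ≡ L s × ∃[ a ] ∃[ b ] ∃[ d ] ∃[ e ] Blades u a b d e

  common? : ∀ u v p → Dec (Common u v p)
  common? u v p = T? _ ×-dec T? _

  tri? : ∀ u v w → Dec (Tri u v w)
  tri? u v w = T? _ ×-dec common? u v w

  spine? : ∀ u v → Dec (Spine u v)
  spine? u v = T? _ ×-dec any? λ p → any? λ q → ¬? (p ≟ᶠ q) ×-dec common? u v p ×-dec common? u v q

  hasTriangle? : ∀ s → Dec (HasTriangle s)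
  hasTriangle? s = any? λ u → (L u ≟ᶠ L s) ×-dec any? λ v → any? λ w → tri? u v w

  hasButterfly? : ∀ s → Dec (HasButterfly s)
  hasButterfly? s = any? λ u → (L u ≟ᶠ L s) ×-dec any? λ a → any? λ b → any? λ d → any? λ e →
    tri? u a b ×-dec tri? u d e ×-dec ¬? (a ≟ᶠ d) ×-dec ¬? (a ≟ᶠ e) ×-dec ¬? (b ≟ᶠ d) ×-dec ¬? (b ≟ᶠ e)

  In? : ∀ z u v w → Dec (In z u v w)
  In? z u v w = (z ≟ᶠ u) ⊎-dec (z ≟ᶠ v) ⊎-dec (z ≟ᶠ w)

  rotᴵ : ∀ {z u v w} → In z u v w → In z v w u
  rotᴵ (inj₁ e) = inj₂ (inj₂ e)
  rotᴵ (inj₂ (inj₁ e)) = inj₁ e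
  rotᴵ (inj₂ (inj₂ e)) = inj₂ (inj₁ e)

  flipᴵ : ∀ {z u v w} → In z u v w → In z v u w
  flipᴵ (inj₁ e) = inj₂ (inj₁ e)
  flipᴵ (inj₂ (inj₁ e)) = inj₁ e
  flipᴵ (inj₂ (inj₂ e)) = inj₂ (inj₂ e)

  -- Says that the fibres of `L` are the connected components. Connectedness is stated through cuts
  -- rather than walks: a set separating two vertices of a class is left by an edge of that class.
  -- This form survives new edges and the merging of classes directly.
  record Classes : Set where
    field
      lab : ∀ {u v} → T (c u v) → L u ≡ L v
      cut : (S : Fin n → Bool) → ∀ {u w} → T (S u) → ¬ T (S w) → L u ≡ L w →
            ∃[ p ] ∃[ q ] T (c p q) × T (S p) × ¬ T (S q) × L p ≡ L u

  dec-cut : Classes → {S : Fin n → Set} (S? : ∀ z → Dec (S z)) → ∀ {u w} → S u → ¬ S w → L u ≡ L w →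
            ∃[ p ] ∃[ q ] T (c p q) × S p × ¬ S q × L p ≡ L u
  dec-cut C S? su sw e with Classes.cut C (λ z → ⌊ S? z ⌋) (fromWitness su) (sw ∘ toWitness) e
  ... | p , q , pq , sp , sq , l = p , q , pq , toWitness sp , (λ s → sq (fromWitness s)) , l

  module Static (S : Simple c) (C : Classes) (free : P6Free c) where
    open Simple S
    open Classes C

    rot : ∀ {u v w} → Tri u v w → Tri v w u
    rot (uv , uw , vw) = vw , sy uv , sy uw

    flip : ∀ {u v w} → Tri u v w → Tri v u w
    flip (uv , uw , vw) = sy uv , vw , uw

    neighbour : ∀ {x z} → x ≢ z → L x ≡ L z → ∃[ y ] T (c x y)
    neighbour {x} ne e with dec-cut C (_≟ᶠ x) refl (λ e → ne (sym e)) e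
    ... | p , q , pq , refl , _ = q , pq

    orient : ∀ {a u v w} → In a u v w → Tri u v w →
      ∃[ b ] ∃[ d ] Tri a b d × (∀ {z} → In z a b d → In z u v w)
    orient (inj₁ refl) t = _ , _ , t , λ i → i
    orient (inj₂ (inj₁ refl)) t = _ , _ , rot t , rotᴵ ∘ rotᴵ
    orient (inj₂ (inj₂ refl)) t = _ , _ , rot (rot t) , rotᴵ

    third-vertex : ∀ {a z u v w} → a ≢ z → In a u v w → In z u v w → Tri u v w →
      ∃[ d ] Tri a z d × (∀ {t} → In t u v w → In t a z d) × (∀ {t} → In t a z d → In t u v w)
    third-vertex ne (inj₁ refl) (inj₂ (inj₁ refl)) t = _ , t , (λ i → i) , (λ i → i)
    third-vertex ne (inj₁ refl) (inj₂ (inj₂ refl)) t = _ , rot (flip t) , rotᴵ ∘ flipᴵ , flipᴵ ∘ rotᴵ ∘ rotᴵ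
    third-vertex ne (inj₂ (inj₁ refl)) (inj₁ refl) t = _ , flip t , flipᴵ , flipᴵ
    third-vertex ne (inj₂ (inj₁ refl)) (inj₂ (inj₂ refl)) t = _ , rot t , rotᴵ , rotᴵ ∘ rotᴵ
    third-vertex ne (inj₂ (inj₂ refl)) (inj₁ refl) t = _ , rot (rot t) , rotᴵ ∘ rotᴵ , rotᴵ
    third-vertex ne (inj₂ (inj₂ refl)) (inj₂ (inj₁ refl)) t = _ , flip (rot t) , flipᴵ ∘ rotᴵ , rotᴵ ∘ rotᴵ ∘ flipᴵ
    third-vertex ne (inj₁ refl) (inj₁ refl) _ = ⊥-elim (ne refl)
    third-vertex ne (inj₂ (inj₁ refl)) (inj₂ (inj₁ refl)) _ = ⊥-elim (ne refl)
    third-vertex ne (inj₂ (inj₂ refl)) (inj₂ (inj₂ refl)) _ = ⊥-elim (ne refl)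

    private
      Near : Fin n → Fin n → Fin n → Fin n → Set
      Near u v w z = ∃[ a ] In a u v w × (T (c a z) ⊎ ∃[ p ] (T (c a p) × T (c p z) × ¬ In p u v w))

      near? : ∀ u v w z → Dec (Near u v w z)
      near? u v w z = any? λ a → In? a u v w ×-dec (T? _ ⊎-dec any? λ p → T? _ ×-dec T? _ ×-dec ¬? (In? p u v w))

      out : ∀ {u v w p z} → ¬ In p u v w → In z u v w → z ≢ p
      out np iz refl = np iz

    -- Otherwise a path of length three leaves the triangle, and two triangle edges prolong it.
    near-triangle : ∀ {u v w z} → Tri u v w → L z ≡ L u → ¬ In z u v w → Near u v w z
    near-triangle {u} {v} {w} {z} t lz nz = decidable-stable (near? u v w z) λ nN →
      absurd (dec-cut C (λ z → In? z u v w ⊎-dec near? u v w z) (inj₁ (inj₁ refl)) [ nz , nN ]′ (sym lz))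
      where
      N : Fin n → Set
      N = Near u v w
      absurd : ¬ (∃[ p ] ∃[ q ] T (c p q) × (In p u v w ⊎ N p) × ¬ (In q u v w ⊎ N q) × L p ≡ L u)
      absurd (p , q , pq , inj₁ ip , nq , _) = nq (inj₂ (p , ip , inj₁ pq))
      absurd (p , q , pq , inj₂ (a , ia , inj₁ ap) , nq , _) with In? p u v w
      ... | yes ip = nq (inj₂ (p , ip , inj₁ pq))
      ... | no np = nq (inj₂ (a , ia , inj₂ (p , ap , pq , np)))
      absurd (s , q , sq , inj₂ (a , ia , inj₂ (p , ap , ps , np)) , nq , _) with In? s u v w
      ... | yes is = nq (inj₂ (s , is , inj₁ sq))
      ... | no ns with p ≟ᶠ q | orient ia t
      ...   | yes refl | _ = nq (inj₂ (a , ia , inj₁ ap))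
      ...   | no p≢q | b , d , (ab , ad , bd) , i =
        free (sy bd) (sy ab) ap ps sq
          (λ { refl → irr ad }) (out np d∈) (out ns d∈) (out (nq ∘ inj₁) d∈)
          (out np b∈) (out ns b∈) (out (nq ∘ inj₁) b∈) (out ns ia) (out (nq ∘ inj₁) ia) p≢q
        where
        b∈ = i (inj₂ (inj₁ refl))
        d∈ = i (inj₂ (inj₂ refl))

    -- Traverse the first triangle up to the vertex `a` from which the second is near, cross over,
    -- and continue along the second. With a direct edge the path is `d b a x y z`, with an
    -- intermediate vertex `p` it is `d b a p x y`; if `p` is `y`, the edge from `a` is direct after
    -- all.
    no-disjoint : ∀ {u v w x y z} → Tri u v w → Tri x y z → L x ≡ L u →
      ¬ In x u v w → ¬ In y u v w → ¬ In z u v w → ⊥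
    no-disjoint {u} {v} {w} t t' l nx ny nz with near-triangle t l nx
    ... | a , ia , h with orient ia t
    ... | b , d , (ab , ad , bd) , i = go h t' nx ny nz
      where
      b∈ = i (inj₂ (inj₁ refl))
      d∈ = i (inj₂ (inj₂ refl))
      direct : ∀ {x y z} → T (c a x) → Tri x y z → ¬ In x u v w → ¬ In y u v w → ¬ In z u v w → ⊥
      direct ax (xy , xz , yz) nx ny nz = free (sy bd) (sy ab) ax xy yz
        (λ { refl → irr ad }) (out nx d∈) (out ny d∈) (out nz d∈) (out nx b∈) (out ny b∈) (out nz b∈)
        (out ny ia) (out nz ia) (~≢ xz)
      go : ∀ {x y z} → T (c a x) ⊎ ∃[ p ] (T (c a p) × T (c p x) × ¬ In p u v w) → Tri x y z →
           ¬ In x u v w → ¬ In y u v w → ¬ In z u v w → ⊥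
      go (inj₁ ax) t' nx ny nz = direct ax t' nx ny nz
      go {x} {y} {z} (inj₂ (p , ap , px , np)) t'@(xy , _) nx ny nz with p ≟ᶠ y
      ... | yes refl = direct ap (rot t') ny nz nx
      ... | no p≢y = free (sy bd) (sy ab) ap px xy
        (λ { refl → irr ad }) (out np d∈) (out nx d∈) (out ny d∈) (out np b∈) (out nx b∈) (out ny b∈)
        (out nx ia) (out ny ia) p≢y

    -- Since the triangles meet, the remaining vertex `b` would be their only common one, hence the
    -- centre of a butterfly. So without a butterfly any two triangles of a class have two common
    -- vertices.
    share : ∀ {s u a b x y z} → ¬ HasButterfly s → Tri u a b → Tri x y z → L u ≡ L s → L x ≡ L s →
      ¬ In u x y z → ¬ In a x y z → ⊥
    share {u = u} {a} {b} {x} {y} {z} nb t t' lu lx nu na with In? b x y z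
    ... | no nb' = no-disjoint t' t (trans lu (sym lx)) nu na nb'
    ... | yes ib with orient ib t'
    ... | d , e , t'' , i = nb (b , trans (sym (lab (proj₁ (proj₂ t)))) lu , u , a , d , e , rot (rot t) , t'' ,
        d≢ nu , e≢ nu , d≢ na , e≢ na)
      where
      d≢ : ∀ {v} → ¬ In v x y z → v ≢ d
      d≢ n refl = n (i (inj₂ (inj₁ refl)))
      e≢ : ∀ {v} → ¬ In v x y z → v ≢ e
      e≢ n refl = n (i (inj₂ (inj₂ refl)))

    adjacent : ∀ {p q x y z} → Tri x y z → In p x y z → In q x y z → p ≢ q → T (c p q)
    adjacent t (inj₁ refl) (inj₁ refl) ne = ⊥-elim (ne refl)
    adjacent (xy , _) (inj₁ refl) (inj₂ (inj₁ refl)) ne = xy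
    adjacent (_ , xz , _) (inj₁ refl) (inj₂ (inj₂ refl)) ne = xz
    adjacent (xy , _) (inj₂ (inj₁ refl)) (inj₁ refl) ne = sy xy
    adjacent t (inj₂ (inj₁ refl)) (inj₂ (inj₁ refl)) ne = ⊥-elim (ne refl)
    adjacent (_ , _ , yz) (inj₂ (inj₁ refl)) (inj₂ (inj₂ refl)) ne = yz
    adjacent (_ , xz , _) (inj₂ (inj₂ refl)) (inj₁ refl) ne = sy xz
    adjacent (_ , _ , yz) (inj₂ (inj₂ refl)) (inj₂ (inj₁ refl)) ne = sy yz
    adjacent t (inj₂ (inj₂ refl)) (inj₂ (inj₂ refl)) ne = ⊥-elim (ne refl)

    AllThrough : Fin n → Fin n → Fin n → Set
    AllThrough s u v = ∀ {x y z} → L x ≡ L s → Tri x y z → In u x y z × In v x y z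

    -- A triangle that misses one end of the spine has two vertices in common with both triangles on
    -- `u v`, so it contains `p` and `q`, which would then be adjacent.
    book : ∀ {s u v p q} → ¬ HasButterfly s → L u ≡ L s → T (c u v) → p ≢ q → Common u v p → Common u v q →
      ¬ T (c p q) → AllThrough s u v
    book {s} {u} {v} {p} {q} nb lu uv p≢q cp cq npq {x} {y} {z} lx t =
      hub (uv , cp) (uv , cq) lu , hub (flip (uv , cp)) (flip (uv , cq)) (trans (sym (lab uv)) lu)
      where
      hub : ∀ {u v} → Tri u v p → Tri u v q → L u ≡ L s → In u x y z
      hub {u} {v} tp tq lu = decidable-stable (In? u x y z) λ nu →
        npq (adjacent t
          (decidable-stable (In? p x y z) λ np → share nb (rot (rot tp)) t (trans (sym (lab (proj₁ (proj₂ tp)))) lu) lx np nu)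
          (decidable-stable (In? q x y z) λ nq → share nb (rot (rot tq)) t (trans (sym (lab (proj₁ (proj₂ tq)))) lu) lx nq nu)
          p≢q)

    -- Both `u` and `v` lie in the two triangles on `u' v'`, whose only common vertices are `u'` and
    -- `v'`.
    same-spine : ∀ {s u v u' v'} → u ≢ v → AllThrough s u v → L u' ≡ L s → Spine u' v' →
      (u' ≡ u × v' ≡ v) ⊎ (u' ≡ v × v' ≡ u)
    same-spine {u = u} {v} {u'} {v'} u≢v all l (uv , p , q , p≢q , cp , cq)
      with on (proj₁ (all l (uv , cp))) (proj₁ (all l (uv , cq))) | on (proj₂ (all l (uv , cp))) (proj₂ (all l (uv , cq)))
      where
      on : ∀ {w} → In w u' v' p → In w u' v' q → w ≡ u' ⊎ w ≡ v'
      on (inj₁ e) _ = inj₁ e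
      on (inj₂ (inj₁ e)) _ = inj₂ e
      on (inj₂ (inj₂ _)) (inj₁ e) = inj₁ e
      on (inj₂ (inj₂ _)) (inj₂ (inj₁ e)) = inj₂ e
      on (inj₂ (inj₂ e)) (inj₂ (inj₂ f)) = ⊥-elim (p≢q (trans (sym e) f))
    ... | inj₁ refl | inj₁ refl = ⊥-elim (u≢v refl)
    ... | inj₁ refl | inj₂ refl = inj₁ (refl , refl)
    ... | inj₂ refl | inj₁ refl = inj₂ (refl , refl)
    ... | inj₂ refl | inj₂ refl = ⊥-elim (u≢v refl)

    flipˡ : ∀ {u a b d e} → Blades u a b d e → Blades u b a d e
    flipˡ ((ua , ub , ab) , t , ad , ae , bd , be) = (ub , ua , sy ab) , t , bd , be , ad , ae

    flipʳ : ∀ {u a b d e} → Blades u a b d e → Blades u a b e d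
    flipʳ (t , (ud , ue , de) , ad , ae , bd , be) = t , (ue , ud , sy de) , ae , ad , be , bd

    swap-blades : ∀ {u a b d e} → Blades u a b d e → Blades u d e a b
    swap-blades (t , t' , ad , ae , bd , be) = t' , t , ad ∘ sym , bd ∘ sym , ae ∘ sym , be ∘ sym

    module _ {u a b d e : Fin n} (bl : Blades u a b d e) where
      Five : Fin n → Set
      Five z = z ≡ u ⊎ z ≡ a ⊎ z ≡ b ⊎ z ≡ d ⊎ z ≡ e

      five? : ∀ z → Dec (Five z)
      five? z = (z ≟ᶠ u) ⊎-dec (z ≟ᶠ a) ⊎-dec (z ≟ᶠ b) ⊎-dec (z ≟ᶠ d) ⊎-dec (z ≟ᶠ e)

      -- Once the chord `a d` is present, each of the five vertices is the start of a path through
      -- all five. Some edge leaves the five vertices, and it prolongs the path starting at its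
      -- inner end.
      no-cross : ∀ {z} → L z ≡ L u → ¬ Five z → ¬ T (c a d)
      no-cross {z} lz nz ad with dec-cut C five? (inj₁ refl) nz (sym lz)
      ... | s , q , sq , i , nq , _ = go bl i
        where
        q≢u = λ h → nq (inj₁ h)
        q≢a = λ h → nq (inj₂ (inj₁ h))
        q≢b = λ h → nq (inj₂ (inj₂ (inj₁ h)))
        q≢d = λ h → nq (inj₂ (inj₂ (inj₂ (inj₁ h))))
        q≢e = λ h → nq (inj₂ (inj₂ (inj₂ (inj₂ h))))
        go : Blades u a b d e → Five s → ⊥
        go ((ua , ub , ab) , (ud , ue , de) , a≢d , a≢e , b≢d , b≢e) (inj₁ refl) = free (sy sq) ub (sy ab) ad de q≢b q≢a q≢d q≢e (~≢ ua) (~≢ ud) (~≢ ue) b≢d b≢e a≢e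
        go ((ua , ub , ab) , (ud , ue , de) , a≢d , a≢e , b≢d , b≢e) (inj₂ (inj₁ refl)) = free (sy sq) ab (sy ub) ud de q≢b q≢u q≢d q≢e (~≢ (sy ua)) a≢d a≢e b≢d b≢e (~≢ ue)
        go ((ua , ub , ab) , (ud , ue , de) , a≢d , a≢e , b≢d , b≢e) (inj₂ (inj₂ (inj₁ refl))) = free (sy sq) (sy ab) (sy ua) ud de q≢a q≢u q≢d q≢e (~≢ (sy ub)) b≢d b≢e a≢d a≢e (~≢ ue)
        go ((ua , ub , ab) , (ud , ue , de) , a≢d , a≢e , b≢d , b≢e) (inj₂ (inj₂ (inj₂ (inj₁ refl)))) = free (sy sq) de (sy ue) ua ab q≢e q≢u q≢a q≢b (~≢ (sy ud)) (a≢d ∘ sym) (b≢d ∘ sym) (a≢e ∘ sym) (b≢e ∘ sym) (~≢ ub)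
        go ((ua , ub , ab) , (ud , ue , de) , a≢d , a≢e , b≢d , b≢e) (inj₂ (inj₂ (inj₂ (inj₂ refl)))) = free (sy sq) (sy de) (sy ud) ua ab q≢d q≢u q≢a q≢b (~≢ (sy ue)) (a≢e ∘ sym) (b≢e ∘ sym) (a≢d ∘ sym) (b≢d ∘ sym) (~≢ ub)

    module Windmill {u a b d e : Fin n} (bl : Blades u a b d e)
                    (nc : ∀ {a b d e} → Blades u a b d e → ¬ T (c a d)) where
      -- A triangle avoiding `u` would still meet both blades, and so contain a chord between them.
      centre : ∀ {x y z} → L x ≡ L u → Tri x y z → In u x y z
      centre {x} {y} {z} l t = decidable-stable (In? u x y z) λ nu → absurd nu (hit bl nu) (hit (swap-blades bl) nu)
        where
        hit : ∀ {a b d e} → Blades u a b d e → ¬ In u x y z → In a x y z ⊎ In b x y z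
        hit {a} {b} bl nu with In? a x y z | In? b x y z
        ... | yes i | _ = inj₁ i
        ... | no _ | yes i = inj₂ i
        ... | no na | no nb = ⊥-elim (no-disjoint t (proj₁ bl) (sym l) nu na nb)
        absurd : ¬ In u x y z → In a x y z ⊎ In b x y z → In d x y z ⊎ In e x y z → ⊥
        absurd nu (inj₁ i) (inj₁ j) = nc bl (adjacent t i j (proj₁ (proj₂ (proj₂ bl))))
        absurd nu (inj₁ i) (inj₂ j) = nc (flipʳ bl) (adjacent t i j (proj₁ (proj₂ (proj₂ (flipʳ bl)))))
        absurd nu (inj₂ i) (inj₁ j) = nc (flipˡ bl) (adjacent t i j (proj₁ (proj₂ (proj₂ (flipˡ bl)))))
        absurd nu (inj₂ i) (inj₂ j) = nc (flipˡ (flipʳ bl)) (adjacent t i j (proj₁ (proj₂ (proj₂ (flipˡ (flipʳ bl))))))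

      private
        apart : ∀ {x y y' a b} → Tri u a b → Tri u x y → Tri u x y' → y ≢ y' →
                x ≢ a → x ≢ b → y ≢ a → y ≢ b → ⊥
        apart {x} {y} {y'} {a} {b} t@(ua , ub , ab) t₁@(ux , uy , xy) (_ , uy' , xy') y≢y' xa xb ya yb
          with y' ≟ᶠ a | y' ≟ᶠ b
        ... | yes refl | _ = nc (t₁ , t , xa , xb , ya , yb) xy'
        ... | no _ | yes refl = nc (flipʳ (t₁ , t , xa , xb , ya , yb)) xy'
        ... | no y'a | no y'b = free (sy xy) xy' (sy uy') ua ab y≢y' (~≢ (sy uy)) ya yb (~≢ (sy ux)) xa xb y'a y'b (~≢ ub)

        cross : ∀ {a b d e x y} → Blades u a b d e → x ≡ a ⊎ x ≡ b → y ≡ d ⊎ y ≡ e → ¬ T (c x y)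
        cross bl (inj₁ refl) (inj₁ refl) = nc bl
        cross bl (inj₁ refl) (inj₂ refl) = nc (flipʳ bl)
        cross bl (inj₂ refl) (inj₁ refl) = nc (flipˡ bl)
        cross bl (inj₂ refl) (inj₂ refl) = nc (flipˡ (flipʳ bl))

        clash : ∀ {a b d e x} → Blades u a b d e → x ≡ a ⊎ x ≡ b → x ≡ d ⊎ x ≡ e → ⊥
        clash (_ , _ , ad , ae , bd , be) (inj₁ refl) (inj₁ e) = ad e
        clash (_ , _ , ad , ae , bd , be) (inj₁ refl) (inj₂ e) = ae e
        clash (_ , _ , ad , ae , bd , be) (inj₂ refl) (inj₁ e) = bd e
        clash (_ , _ , ad , ae , bd , be) (inj₂ refl) (inj₂ e) = be e

        hits? : (x y a b : Fin n) → ((x ≡ a ⊎ x ≡ b) ⊎ (y ≡ a ⊎ y ≡ b)) ⊎ (x ≢ a × x ≢ b × y ≢ a × y ≢ b)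
        hits? x y a b with (x ≟ᶠ a) ⊎-dec (x ≟ᶠ b) | (y ≟ᶠ a) ⊎-dec (y ≟ᶠ b)
        ... | yes h | _ = inj₁ (inj₁ h)
        ... | no _ | yes h = inj₁ (inj₂ h)
        ... | no f | no g = inj₂ (f ∘ inj₁ , f ∘ inj₂ , g ∘ inj₁ , g ∘ inj₂)

      -- Distinct triangles at the centre have no second common vertex. The edge `x y` cannot meet
      -- both given blades without being a chord or a common vertex. If it avoids a blade `a b`,
      -- then `y'` on that blade is joined to `x` by a chord, and otherwise `y x y' u a b` is a
      -- path.
      blade-unique : ∀ {x y y'} → Tri u x y → Tri u x y' → y ≡ y'
      blade-unique {x} {y} {y'} t t' = decidable-stable (y ≟ᶠ y') λ ne → go ne (hits? x y a b) (hits? x y d e)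
        where
        go : y ≢ y' → ((x ≡ a ⊎ x ≡ b) ⊎ (y ≡ a ⊎ y ≡ b)) ⊎ (x ≢ a × x ≢ b × y ≢ a × y ≢ b) →
             ((x ≡ d ⊎ x ≡ e) ⊎ (y ≡ d ⊎ y ≡ e)) ⊎ (x ≢ d × x ≢ e × y ≢ d × y ≢ e) → ⊥
        go ne (inj₂ (p , q , r , s)) _ = apart (proj₁ bl) t t' ne p q r s
        go ne (inj₁ _) (inj₂ (p , q , r , s)) = apart (proj₁ (proj₂ bl)) t t' ne p q r s
        go ne (inj₁ (inj₁ i)) (inj₁ (inj₁ j)) = clash bl i j
        go ne (inj₁ (inj₁ i)) (inj₁ (inj₂ j)) = cross bl i j (proj₂ (proj₂ t))
        go ne (inj₁ (inj₂ i)) (inj₁ (inj₁ j)) = cross bl i j (sy (proj₂ (proj₂ t)))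
        go ne (inj₁ (inj₂ i)) (inj₁ (inj₂ j)) = clash bl i j

-- Blocker's invariant

-- Twice the upper half of `h`. Constructor is to move, so of `h` open half-pages she completes the
-- larger half, and a page weighs two.
up2 : ℕ → ℕ
up2 0 = 0
up2 1 = 2
up2 (suc (suc h)) = suc (suc (up2 h))

up2-≤ : ∀ h → up2 h ≤ suc h
up2-≤ 0 = z≤n
up2-≤ 1 = ≤-refl
up2-≤ (suc (suc h)) = s≤s (s≤s (up2-≤ h))

up2-mono : ∀ {h k} → h ≤ k → up2 h ≤ up2 k
up2-mono z≤n = z≤n
up2-mono {1} {1} (s≤s z≤n) = ≤-refl
up2-mono {1} {suc (suc k)} (s≤s z≤n) = s≤s (s≤s z≤n)
up2-mono (s≤s (s≤s h)) = s≤s (s≤s (up2-mono h))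

record Position {n : ℕ} (c b : Adj n) : Set where
  field
    simple : Simple c
    simpleᵇ : Simple b
    disj : ∀ {u v} → T (c u v) → T (b u v) → ⊥

module Blocked {n : ℕ} (c b : Adj n) (L : Fin n → Fin n) where
  open Shape c L

  Dirty : Fin n → Set
  Dirty x = ∃[ z ] L z ≡ L x × T (b x z)

  dirty? : ∀ x → Dec (Dirty x)
  dirty? x = any? λ z → (L z ≟ᶠ L x) ×-dec T? _

  Half₁ : Fin n → Fin n → Fin n → Set
  Half₁ u v z = T (c u z) × ¬ T (c v z) × ¬ T (b v z)

  Half : Fin n → Fin n → Fin n → Set
  Half u v z = z ≢ u × z ≢ v × (Half₁ u v z ⊎ Half₁ v u z)

  half? : ∀ u v z → Dec (Half u v z)
  half? u v z = ¬? (z ≟ᶠ u) ×-dec ¬? (z ≟ᶠ v) ×-dec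
    ((T? _ ×-dec ¬? (T? _) ×-dec ¬? (T? _)) ⊎-dec (T? _ ×-dec ¬? (T? _) ×-dec ¬? (T? _)))

  pages halves : Fin n → Fin n → ℕ
  pages u v = V# λ z → ⌊ common? u v z ⌋
  halves u v = V# λ z → ⌊ half? u v z ⌋

  size : Fin n → ℕ
  size s = V# λ z → L z == L s

  -- Constructor gets at most every other open half-page, so this bounds twice the final number of pages.
  Budget : Fin n → Fin n → Set
  Budget u v = 2 * pages u v + up2 (halves u v) ≤ size u

  -- `dirty` stores the blocked pair that pays for the start of a book. `blocked` excludes K₄, as
  -- `no-K4` shows. `open-pair` prepares for an edge that creates two pages at once; if the class
  -- already has a triangle, such an edge produces a butterfly. A butterfly satisfies every clause,
  -- since from then on the windmill bound takes over.
  record Good : Set where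
    field
      dirty : ∀ {u v} → T (c u v) →
        Dirty u ⊎ Dirty v ⊎ (∀ z → L z ≡ L u → z ≡ u ⊎ z ≡ v) ⊎ HasSpine u ⊎ HasButterfly u
      budget : ∀ {u v} → Spine u v → HasButterfly u ⊎ Budget u v
      blocked : ∀ {u v p q} → T (c u v) → p ≢ q → Common u v p → Common u v q →
        HasButterfly u ⊎ T (b p q) ⊎ ∃[ r ] r ≢ p × r ≢ q × Common u v r
      open-pair : ∀ {u v p q} → u ≢ v → ¬ T (c u v) → ¬ T (b u v) → p ≢ q → Common u v p → Common u v q →
        HasTriangle u ⊎ (T (b p q) × ∀ {r} → Common u v r → r ≡ p ⊎ r ≡ q)

  module _ (P : Position c b) (C : Classes) (free : P6Free c) (G : Good) where
    open Position P
    open Simple simple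
    open Static simple C free
    open Good G

    -- If `p q` were an edge, it would not be blocked, so there is a third page `r`; then `u` is the
    -- centre of a butterfly with blades `p q` and `v r`.
    no-K4 : ∀ {s u v p q} → ¬ HasButterfly s → L u ≡ L s → T (c u v) → p ≢ q → Common u v p → Common u v q → ¬ T (c p q)
    no-K4 {s} {u} {v} {p} {q} nb l uv p≢q (up , vp) (uq , vq) pq with blocked uv p≢q (up , vp) (uq , vq)
    ... | inj₁ (w , lw , h) = nb (w , trans lw l , h)
    ... | inj₂ (inj₁ bpq) = disj pq bpq
    ... | inj₂ (inj₂ (r , r≢p , r≢q , ur , vr)) = nb (u , l , p , q , v , r , (up , uq , pq) , (uv , ur , vr) ,
          ~≢ (sy vp) , (λ e → r≢p (sym e)) , ~≢ (sy vq) , (λ e → r≢q (sym e)))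

    through-spine : ∀ {s u v} → ¬ HasButterfly s → L u ≡ L s → Spine u v → AllThrough s u v
    through-spine nb l (uv , p , q , p≢q , cp , cq) = book nb l uv p≢q cp cq (no-K4 nb l uv p≢q cp cq)

module _ {n : ℕ} {c b : Adj n} {L : Fin n → Fin n} where
  open Shape c L
  open Blocked c b L

  half-flip : ∀ {u v z} → Half u v z → Half v u z
  half-flip (zu , zv , inj₁ h) = zv , zu , inj₂ h
  half-flip (zu , zv , inj₂ h) = zv , zu , inj₁ h

  private
    pages≤ : ∀ u v → pages u v ≤ pages v u
    pages≤ u v = cnt-mono (λ z t → fromWitness (swapˣ (toWitness t))) (allFin n)

    halves≤ : ∀ u v → halves u v ≤ halves v u
    halves≤ u v = cnt-mono (λ z t → fromWitness (half-flip (toWitness t))) (allFin n)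

    size≤ : ∀ {u v} → L u ≡ L v → size u ≤ size v
    size≤ l = cnt-mono (λ z t → ==⁺ (trans (==⁻ t) l)) (allFin n)

  budget-flip : ∀ {u v} → L u ≡ L v → Budget u v → Budget v u
  budget-flip {u} {v} l bd = ≤-trans
    (+-mono-≤ (*-monoʳ-≤ 2 (pages≤ v u)) (up2-mono (halves≤ v u))) (≤-trans bd (size≤ l))

record Adds {n : ℕ} (c : Adj n) (x y : Fin n) (c' : Adj n) : Set where
  field
    old : ∀ {u v} → T (c u v) → T (c' u v)
    new : T (c' x y)
    only : ∀ {u v} → T (c' u v) → T (c u v) ⊎ (u ≡ x × v ≡ y) ⊎ (u ≡ y × v ≡ x)

adds-swap : ∀ {n} {c c' : Adj n} {x y} → Simple c' → Adds c x y c' → Adds c y x c'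
adds-swap s a = record
  { old = Adds.old a
  ; new = Simple.sy s (Adds.new a)
  ; only = λ e → [ inj₁ , [ inj₂ ∘ inj₂ , inj₂ ∘ inj₁ ]′ ]′ (Adds.only a e) }

record Extends {n : ℕ} (c' b b' : Adj n) : Set where
  field
    position : Position c' b'
    keep : ∀ {u v} → T (b u v) → T (b' u v)

-- Replies to a move inside a component

module Internal {n : ℕ} {c b c' : Adj n} {L : Fin n → Fin n}
  (P : Position c b) (C : Shape.Classes c L) (G : Blocked.Good c b L)
  (S' : Simple c') (free' : P6Free c') where

  open Position P
  module Sc = Simple simple
  module S′ = Simple S'
  module O = Shape c L
  module N = Shape c' L
  module OB = Blocked c b L
  open Shape.Classes C
  open OB.Good G
  open OB using (Half)

  record Move (x y : Fin n) : Set where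
    field
      x≢y : x ≢ y
      ¬c : ¬ T (c x y)
      ¬b : ¬ T (b x y)
      same : L x ≡ L y
      adds : Adds c x y c'

  swap-move : ∀ {x y} → Move x y → Move y x
  swap-move m = record
    { x≢y = x≢y ∘ sym ; ¬c = ¬c ∘ Sc.sy ; ¬b = ¬b ∘ Simple.sy simpleᵇ ; same = sym same
    ; adds = adds-swap S' adds }
    where open Move m

  -- The pair `f g` may already be Blocker's. Quantifying over all `b'` that contain it covers this
  -- case too, and his actual move is then free.
  Outcome : Fin n → Set
  Outcome x = (∀ {b'} → Extends c' b b' → Blocked.Good c' b' L) ⊎
    ∃[ f ] ∃[ g ] f ≢ g × L f ≡ L x × L g ≡ L x × ¬ T (c' f g) ×
      (∀ {b'} → Extends c' b b' → T (b' f g) → Blocked.Good c' b' L)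

  module Step {x y : Fin n} (m : Move x y) where
    open Move m
    open Adds adds

    C' : N.Classes
    C' = record
      { lab = λ e → [ lab , [ (λ { (refl , refl) → same }) , (λ { (refl , refl) → sym same }) ]′ ]′ (only e)
      ; cut = λ S su sw l → let (p , q , pq , h) = cut S su sw l in p , q , old pq , h }

    free : P6Free c
    free e₁ e₂ e₃ e₄ e₅ = free' (old e₁) (old e₂) (old e₃) (old e₄) (old e₅)

    module OS = O.Static simple C free
    module NS = N.Static S' C' free'

    old-off : ∀ {u v} → T (c' u v) → u ≢ x → u ≢ y → T (c u v)
    old-off e ux uy = [ (λ h → h) , [ ⊥-elim ∘ ux ∘ proj₁ , ⊥-elim ∘ uy ∘ proj₁ ]′ ]′ (only e)

    old-x : ∀ {v} → T (c' x v) → v ≢ y → T (c x v)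
    old-x e vy = [ (λ h → h) , [ ⊥-elim ∘ vy ∘ proj₂ , ⊥-elim ∘ x≢y ∘ proj₁ ]′ ]′ (only e)

    old-y : ∀ {v} → T (c' y v) → v ≢ x → T (c y v)
    old-y e vx = [ (λ h → h) , [ ⊥-elim ∘ x≢y ∘ sym ∘ proj₁ , ⊥-elim ∘ vx ∘ proj₂ ]′ ]′ (only e)

    old-class : ∀ {u v} → T (c' u v) → L u ≢ L x → T (c u v)
    old-class e l = old-off e (λ { refl → l refl }) (λ { refl → l (sym same) })

    old-common : ∀ {p} → N.Common x y p → O.Common x y p
    old-common (xp , yp) = old-x xp (S′.~≢ yp ∘ sym) , old-y yp (S′.~≢ xp ∘ sym)

    common⁺ : ∀ {u v p} → O.Common u v p → N.Common u v p
    common⁺ (p , q) = old p , old q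

    tri⁺ : ∀ {u v p} → O.Tri u v p → N.Tri u v p
    tri⁺ (p , q) = old p , common⁺ q

    spine⁺ : ∀ {u v} → O.Spine u v → N.Spine u v
    spine⁺ (uv , p , q , pq , cp , cq) = old uv , p , q , pq , common⁺ cp , common⁺ cq

    butterfly⁺ : ∀ {s} → O.HasButterfly s → N.HasButterfly s
    butterfly⁺ (u , l , a , b , d , e , t , t' , h) = u , l , a , b , d , e , tri⁺ t , tri⁺ t' , h

    triangle⁺ : ∀ {s} → O.HasTriangle s → N.HasTriangle s
    triangle⁺ (u , l , v , w , t) = u , l , v , w , tri⁺ t

    two⁺ : ∀ {s} → O.HasSpine s ⊎ O.HasButterfly s → N.HasSpine s ⊎ N.HasButterfly s
    two⁺ (inj₁ (u , l , v , h)) = inj₁ (u , l , v , spine⁺ h)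
    two⁺ (inj₂ h) = inj₂ (butterfly⁺ h)

    new-tri : ∀ {u v w} → N.Tri u v w → O.Tri u v w ⊎ (O.In x u v w × O.In y u v w × ∃[ z ] O.Common x y z)
    new-tri {u} {v} {w} (uv , uw , vw) with only uv | only uw | only vw
    ... | inj₂ (inj₁ (refl , refl)) | _ | _ = inj₂ (inj₁ refl , inj₂ (inj₁ refl) , w , old-common (uw , vw))
    ... | inj₂ (inj₂ (refl , refl)) | _ | _ = inj₂ (inj₂ (inj₁ refl) , inj₁ refl , w , old-common (vw , uw))
    ... | inj₁ _ | inj₂ (inj₁ (refl , refl)) | _ = inj₂ (inj₁ refl , inj₂ (inj₂ refl) , v , old-common (uv , S′.sy vw))
    ... | inj₁ _ | inj₂ (inj₂ (refl , refl)) | _ = inj₂ (inj₂ (inj₂ refl) , inj₁ refl , v , old-common (S′.sy vw , uv))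
    ... | inj₁ _ | inj₁ _ | inj₂ (inj₁ (refl , refl)) = inj₂ (inj₂ (inj₁ refl) , inj₂ (inj₂ refl) , u , old-common (S′.sy uv , S′.sy uw))
    ... | inj₁ _ | inj₁ _ | inj₂ (inj₂ (refl , refl)) = inj₂ (inj₂ (inj₂ refl) , inj₂ (inj₁ refl) , u , old-common (S′.sy uw , S′.sy uv))
    ... | inj₁ p | inj₁ q | inj₁ r = inj₁ (p , q , r)

    module Build {b' : Adj n} (ext : Extends c' b b') where
      open Extends ext
      module NB = Blocked c' b' L

      dirty⁺ : ∀ {u} → OB.Dirty u → NB.Dirty u
      dirty⁺ (z , l , h) = z , l , keep h

      TwoOrDirty : Set
      TwoOrDirty = NB.Dirty x ⊎ NB.Dirty y ⊎ N.HasSpine x ⊎ N.HasButterfly x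

      dirty' : TwoOrDirty → ∀ {u v} → T (c' u v) →
        NB.Dirty u ⊎ NB.Dirty v ⊎ (∀ z → L z ≡ L u → z ≡ u ⊎ z ≡ v) ⊎ N.HasSpine u ⊎ N.HasButterfly u
      dirty' d e with only e
      ... | inj₁ e = Sum.map dirty⁺ (Sum.map dirty⁺ (Sum.map₂ two⁺)) (dirty e)
      ... | inj₂ (inj₁ (refl , refl)) = [ inj₁ , [ inj₂ ∘ inj₁ , inj₂ ∘ inj₂ ∘ inj₂ ]′ ]′ d
      ... | inj₂ (inj₂ (refl , refl)) = [ inj₂ ∘ inj₁ , [ inj₁ , inj₂ ∘ inj₂ ∘ inj₂ ∘ Sum.map sp bf ]′ ]′ d
        where
        sp : N.HasSpine x → N.HasSpine y
        sp (u , l , h) = u , trans l same , h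
        bf : N.HasButterfly x → N.HasButterfly y
        bf (u , l , h) = u , trans l same , h

      -- The new edge turns its far end into a half-page of every spine at x or y.
      Closed : Fin n → Fin n → Set
      Closed u v = (u ≡ x → T (b' v y)) × (u ≡ y → T (b' v x)) × (v ≡ x → T (b' u y)) × (v ≡ y → T (b' u x))

      transfer : ∀ {u v} → T (c u v) → (∀ {r} → N.Common u v r → O.Common u v r) → Closed u v →
        N.Spine u v → N.HasButterfly u ⊎ NB.Budget u v
      transfer {u} {v} uv co (k₁ , k₂ , k₃ , k₄) (_ , p , q , p≢q , cp , cq) =
        Sum.map butterfly⁺
          (≤-trans (+-mono-≤ (*-monoʳ-≤ 2 (cnt-mono (λ z t → fromWitness (co (toWitness t))) (allFin n)))
            (up2-mono (cnt-mono (λ z t → fromWitness (half (toWitness t))) (allFin n)))))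
          (budget (uv , p , q , p≢q , co cp , co cq))
        where
        half : ∀ {z} → NB.Half u v z → Half u v z
        half (zu , zv , inj₁ (uz , ¬vz , ¬b')) with only uz
        ... | inj₁ h = zu , zv , inj₁ (h , ¬vz ∘ old , ¬b' ∘ keep)
        ... | inj₂ (inj₁ (refl , refl)) = ⊥-elim (¬b' (k₁ refl))
        ... | inj₂ (inj₂ (refl , refl)) = ⊥-elim (¬b' (k₂ refl))
        half (zu , zv , inj₂ (vz , ¬uz , ¬b')) with only vz
        ... | inj₁ h = zu , zv , inj₂ (h , ¬uz ∘ old , ¬b' ∘ keep)
        ... | inj₂ (inj₁ (refl , refl)) = ⊥-elim (¬b' (k₃ refl))
        ... | inj₂ (inj₂ (refl , refl)) = ⊥-elim (¬b' (k₄ refl))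

      transfer-blocked : ∀ {u v p q} → T (c u v) → (∀ {r} → N.Common u v r → O.Common u v r) →
        p ≢ q → N.Common u v p → N.Common u v q →
        N.HasButterfly u ⊎ T (b' p q) ⊎ ∃[ r ] r ≢ p × r ≢ q × N.Common u v r
      transfer-blocked uv co p≢q cp cq =
        Sum.map butterfly⁺ (Sum.map keep (λ { (r , rp , rq , cr) → r , rp , rq , common⁺ cr }))
          (blocked uv p≢q (co cp) (co cq))

      module _ {u : Fin n} (l : L u ≢ L x) where
        other-x : u ≢ x
        other-x refl = l refl
        other-y : u ≢ y
        other-y refl = l (sym same)
        other-common : ∀ {v r} → N.Common u v r → O.Common u v r
        other-common (ur , vr) = ur' , Sc.sy (old-class (S′.sy vr) (λ e → l (trans (lab ur') e)))
          where ur' = old-class ur l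
        other-closed : ∀ {v} → T (c u v) → Closed u v
        other-closed uv = (λ e → ⊥-elim (other-x e)) , (λ e → ⊥-elim (other-y e)) ,
          (λ { refl → ⊥-elim (l (lab uv)) }) , (λ { refl → ⊥-elim (l (trans (lab uv) (sym same))) })

      budget' : (∀ {u v} → L u ≡ L x → N.Spine u v → N.HasButterfly u ⊎ NB.Budget u v) →
        ∀ {u v} → N.Spine u v → N.HasButterfly u ⊎ NB.Budget u v
      budget' f {u} {v} s with L u ≟ᶠ L x
      ... | yes l = f l s
      ... | no l = transfer uv (other-common l) (other-closed l uv) s
        where uv = old-class (proj₁ s) l

      blocked' : (∀ {u v p q} → L u ≡ L x → T (c' u v) → p ≢ q → N.Common u v p → N.Common u v q →
          N.HasButterfly u ⊎ T (b' p q) ⊎ ∃[ r ] r ≢ p × r ≢ q × N.Common u v r) →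
        ∀ {u v p q} → T (c' u v) → p ≢ q → N.Common u v p → N.Common u v q →
          N.HasButterfly u ⊎ T (b' p q) ⊎ ∃[ r ] r ≢ p × r ≢ q × N.Common u v r
      blocked' f {u} {v} uv with L u ≟ᶠ L x
      ... | yes l = f l uv
      ... | no l = transfer-blocked (old-class uv l) (other-common l)

      Open : Set
      Open = ∀ {u v p q} → u ≢ v → ¬ T (c' u v) → ¬ T (b' u v) → p ≢ q → N.Common u v p → N.Common u v q →
        N.HasTriangle u ⊎ (T (b' p q) × ∀ {r} → N.Common u v r → r ≡ p ⊎ r ≡ q)

      transfer-open : ∀ {u v p q} → u ≢ v → ¬ T (c' u v) → ¬ T (b' u v) → p ≢ q →
        (∀ {r} → N.Common u v r → O.Common u v r) → N.Common u v p → N.Common u v q →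
        N.HasTriangle u ⊎ (T (b' p q) × ∀ {r} → N.Common u v r → r ≡ p ⊎ r ≡ q)
      transfer-open uv ¬c' ¬b' pq co cp cq = Sum.map triangle⁺ (λ { (h , ex) → keep h , ex ∘ co })
        (open-pair uv (¬c' ∘ old) (¬b' ∘ keep) pq (co cp) (co cq))

      -- Only the class of the move needs an argument, and there the triangle is one of the
      -- permitted alternatives.
      open' : N.HasTriangle x → Open
      open' (w , lw , t) {u} uv ¬c' ¬b' pq cp cq with L u ≟ᶠ L x
      ... | yes l = inj₁ (w , trans lw (sym l) , t)
      ... | no l = transfer-open uv ¬c' ¬b' pq (other-common l) cp cq

      good : TwoOrDirty → (∀ {u v} → L u ≡ L x → N.Spine u v → N.HasButterfly u ⊎ NB.Budget u v) →
        (∀ {u v p q} → L u ≡ L x → T (c' u v) → p ≢ q → N.Common u v p → N.Common u v q →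
          N.HasButterfly u ⊎ T (b' p q) ⊎ ∃[ r ] r ≢ p × r ≢ q × N.Common u v r) → Open → NB.Good
      good d f g o = record { dirty = dirty' d ; budget = budget' f ; blocked = blocked' g ; open-pair = o }

    with-butterfly : N.HasButterfly x → Outcome x
    with-butterfly h@(w , lw , a , b , _ , _ , t , _ , rest) = inj₁ λ ext → let open Build ext in
      good (inj₂ (inj₂ (inj₂ h))) (λ l _ → inj₁ (w , trans lw (sym l) , proj₂ (proj₂ h)))
        (λ l _ _ _ _ → inj₁ (w , trans lw (sym l) , proj₂ (proj₂ h))) (open' (w , lw , a , b , t))

  outcome-swap : ∀ {x y} → Move x y → Outcome y → Outcome x
  outcome-swap m = Sum.map₂ λ { (f , g , ne , lf , lg , h) →
      f , g , ne , trans lf (sym same) , trans lg (sym same) , h }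
    where open Move m

  -- Moves that complete no triangle

  NoCommon : Fin n → Fin n → Set
  NoCommon x y = ∀ {z} → ¬ O.Common x y z

  Path₃ : Fin n → Fin n → Fin n → Fin n → Set
  Path₃ x y w z = T (c x w) × T (c w z) × T (c z y)

  -- The new edge closes the four-cycles `x w z y`, so the diagonals `x z` and `y w` become pairs
  -- with two common neighbours. If all these cycles pass through `w₀`, blocking `y w₀` removes one
  -- diagonal from consideration and blocks the two common neighbours `y` and `w₀` of every other
  -- one. `nextʳ` is the mirror image.
  data Hub (b' : Adj n) (x y : Fin n) : Set where
    none : (∀ {w z} → ¬ Path₃ x y w z) → Hub b' x y
    nextˡ : ∀ w₀ → T (b' y w₀) → (∀ {w z} → Path₃ x y w z → w ≡ w₀) → Hub b' x y
    nextʳ : ∀ z₀ → T (b' x z₀) → (∀ {w z} → Path₃ x y w z → z ≡ z₀) → Hub b' x y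

  hub-swap : ∀ {b' x y} → Hub b' x y → Hub b' y x
  hub-swap (none h) = none λ { (p , q , r) → h (Sc.sy r , Sc.sy q , Sc.sy p) }
  hub-swap (nextˡ w k h) = nextʳ w k λ { (p , q , r) → h (Sc.sy r , Sc.sy q , Sc.sy p) }
  hub-swap (nextʳ z k h) = nextˡ z k λ { (p , q , r) → h (Sc.sy r , Sc.sy q , Sc.sy p) }

  Exactly : Adj n → Fin n → Fin n → Fin n → Fin n → Set
  Exactly b' u v p q = N.HasTriangle u ⊎ (T (b' p q) × ∀ {r} → N.Common u v r → r ≡ p ⊎ r ≡ q)

  module NoNewTriangle {x y : Fin n} (m : Move x y) (nb : ¬ N.HasButterfly x) (k₀ : NoCommon x y) where
    open Move m
    open Adds adds
    open Step m

    tri-old : ∀ {u v w} → N.Tri u v w → O.Tri u v w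
    tri-old t = [ (λ h → h) , (λ h → ⊥-elim (k₀ (proj₂ (proj₂ (proj₂ h))))) ]′ (new-tri t)

    ¬c'-y : ∀ {w} → T (c x w) → ¬ T (c' y w)
    ¬c'-y xw yw = k₀ (xw , old-y yw (Sc.~≢ xw ∘ sym))

    ¬c'-x : ∀ {z} → T (c y z) → ¬ T (c' x z)
    ¬c'-x yz xz = k₀ (old-x xz (Sc.~≢ yz ∘ sym) , yz)

    module _ {b' : Adj n} (ext : Extends c' b b') where
      open Extends ext
      open Build ext

      -- Without new triangles the pages stay as they are; the budget is only threatened by the
      -- half-page that the new edge adds to a spine at `x` or `y`.
      good₀ : (∀ {w} → O.Spine x w → T (b' y w)) → (∀ {w} → O.Spine y w → T (b' x w)) →
        TwoOrDirty → Open → NB.Good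
      good₀ kx ky d o = good d
        (λ {u} {v} _ s@(uv , p , q , p≢q , cp , cq) →
          let uv' , cp' = tri-old (uv , cp) ; s' = uv' , p , q , p≢q , cp' , proj₂ (tri-old (uv , cq))
              s″ = Sc.sy uv' , p , q , p≢q , swapˣ cp' , swapˣ (proj₂ (tri-old (uv , cq)))
          in transfer uv' (λ cr → proj₂ (tri-old (uv , cr)))
               ( (λ { refl → syᵇ (kx s') }) , (λ { refl → syᵇ (ky s') })
               , (λ { refl → syᵇ (kx s″) }) , (λ { refl → syᵇ (ky s″) })) s)
        (λ _ uv p≢q cp cq → transfer-blocked (proj₁ (tri-old (uv , cp))) (λ cr → proj₂ (tri-old (uv , cr))) p≢q cp cq)
        o
        where syᵇ = Simple.sy (Position.simpleᵇ position)

      open-at : Hub b' x y → ∀ {v p q} → x ≢ v → ¬ T (c' x v) → ¬ T (b' x v) → p ≢ q →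
        N.Common x v p → N.Common x v q → Exactly b' x v p q
      open-at hub {v} {p} {q} x≢v ¬c' ¬b' p≢q cp cq with T? (c v y)
      ... | no ¬vy = transfer-open x≢v ¬c' ¬b' p≢q co cp cq
        where
        co : ∀ {r} → N.Common x v r → O.Common x v r
        co (xr , vr) = old-x xr (λ { refl → ¬vy vr' }) , vr'
          where vr' = old-off vr (x≢v ∘ sym) λ { refl → ¬c' new }
      ... | yes vy = go hub
        where
        path : ∀ {r} → N.Common x v r → r ≢ y → Path₃ x y r v
        path (xr , vr) ry = old-x xr ry , Sc.sy (old-off vr (x≢v ∘ sym) λ { refl → ¬c' new }) , vy
        go : Hub b' x y → Exactly b' x v p q
        go (none h) with p ≟ᶠ y
        ... | yes refl = ⊥-elim (h (path cq (p≢q ∘ sym)))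
        ... | no ne = ⊥-elim (h (path cp ne))
        go (nextʳ z₀ k h) with p ≟ᶠ y
        ... | yes refl = ⊥-elim (¬b' (subst (T ∘ b' x) (sym (h (path cq (p≢q ∘ sym)))) k))
        ... | no ne = ⊥-elim (¬b' (subst (T ∘ b' x) (sym (h (path cp ne))) k))
        go (nextˡ w₀ k h) with p ≟ᶠ y | q ≟ᶠ y
        ... | yes refl | yes refl = ⊥-elim (p≢q refl)
        ... | no np | no nq = ⊥-elim (p≢q (trans (h (path cp np)) (sym (h (path cq nq)))))
        ... | yes refl | no nq with h (path cq nq)
        ...   | refl = inj₂ (k , ex)
          where
          ex : ∀ {r} → N.Common x v r → r ≡ y ⊎ r ≡ w₀
          ex {r} cr with r ≟ᶠ y
          ... | yes e = inj₁ e
          ... | no nr = inj₂ (h (path cr nr))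
        go (nextˡ w₀ k h) | no np | yes refl with h (path cp np)
        ...   | refl = inj₂ (Simple.sy (Position.simpleᵇ position) k , ex)
          where
          ex : ∀ {r} → N.Common x v r → r ≡ w₀ ⊎ r ≡ y
          ex {r} cr with r ≟ᶠ y
          ... | yes e = inj₂ e
          ... | no nr = inj₁ (h (path cr nr))

  no-butterfly-swap : ∀ {x y} → Move x y → ¬ N.HasButterfly x → ¬ N.HasButterfly y
  no-butterfly-swap m nb (u , l , h) = nb (u , trans l (sym (Move.same m)) , h)

  no-common-swap : ∀ {x y} → NoCommon x y → NoCommon y x
  no-common-swap k (p , q) = k (q , p)

  -- The spine of the class is unique, so closing the half-page `y` of `x w` repairs every budget.
  -- The same pair makes `y` dirty, and the class has a triangle, so four-cycles need no care.
  spine-reply : ∀ {x y w} → Move x y → ¬ N.HasButterfly x → NoCommon x y → O.Spine x w → Outcome x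
  spine-reply {x} {y} {w} m nb k₀ s@(xw , p , q , p≢q , cp , cq) = inj₂
    ( y , w , (λ { refl → ¬c xw }) , sym same , sym (lab xw) , ¬c'-y xw
    , λ ext k → let open Build ext in
        good₀ ext (λ s' → [ (λ h → subst (T ∘ _) (sym (proj₂ h)) k) , (λ h → ⊥-elim (Sc.~≢ xw (proj₁ h))) ]′ (unique s'))
          (λ s' → ⊥-elim ([ (λ h → x≢y (sym (proj₁ h))) , (λ h → ¬c (subst (T ∘ c x) (sym (proj₁ h)) xw)) ]′ (unique′ s')))
          (inj₂ (inj₁ (w , trans (sym (lab xw)) same , k)))
          (open' (triangle⁺ (x , refl , w , p , xw , cp))))
    where
    open Move m
    open Step m
    open NoNewTriangle m nb k₀
    all : OS.AllThrough x x w
    all = OB.through-spine P C free G (nb ∘ butterfly⁺) refl s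
    unique : ∀ {w'} → O.Spine x w' → (x ≡ x × w' ≡ w) ⊎ (x ≡ w × w' ≡ x)
    unique = OS.same-spine (Sc.~≢ xw) all refl
    unique′ : ∀ {w'} → O.Spine y w' → (y ≡ x × w' ≡ w) ⊎ (y ≡ w × w' ≡ x)
    unique′ = OS.same-spine (Sc.~≢ xw) all (sym same)

  module NoSpine {x y : Fin n} (m : Move x y) (nb : ¬ N.HasButterfly x) (k₀ : NoCommon x y)
      (nx : ∀ {w} → ¬ O.Spine x w) (ny : ∀ {w} → ¬ O.Spine y w) where
    open Move m
    open Adds adds
    open Step m
    open NoNewTriangle m nb k₀
    private module Y = NoNewTriangle (swap-move m) (no-butterfly-swap m nb) (no-common-swap k₀)

    good₁ : ∀ {b'} (ext : Extends c' b b') → Build.TwoOrDirty ext → Build.Open ext → Blocked.Good c' b' L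
    good₁ ext = good₀ ext (⊥-elim ∘ nx) (⊥-elim ∘ ny)

    -- If neither end is dirty, any neighbour `z` of `y` offers the pair `x z`: it is not
    -- Constructor's, because `x` and `y` have no common neighbour.
    dirty-reply : (∀ {b'} (ext : Extends c' b b') → Build.Open ext) → Outcome x
    dirty-reply o with OB.dirty? x | OB.dirty? y
    ... | yes d | _ = inj₁ λ ext → good₁ ext (inj₁ (Build.dirty⁺ ext d)) (o ext)
    ... | no _ | yes d = inj₁ λ ext → good₁ ext (inj₂ (inj₁ (Build.dirty⁺ ext d))) (o ext)
    ... | no _ | no _ with OS.neighbour (x≢y ∘ sym) (sym same)
    ...   | z , yz = inj₂ (x , z , (λ { refl → ¬c (Sc.sy yz) }) , refl , lz , ¬c'-x yz ,
            λ ext k → good₁ ext (inj₁ (z , lz , k)) (o ext))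
      where
      lz : L z ≡ L x
      lz = trans (sym (lab yz)) (sym same)

    open-hub : ∀ {b'} (ext : Extends c' b b') → Hub b' x y → Build.Open ext
    open-hub {b'} ext hub {u} {v} {p} {q} u≢v ¬c' ¬b' p≢q cp cq = go (u ≟ᶠ x) (u ≟ᶠ y) (v ≟ᶠ x) (v ≟ᶠ y)
      where
      syᵇ = Simple.sy (Position.simpleᵇ (Extends.position ext))
      lab' = N.Classes.lab C'
      turn : Exactly b' v u p q → Exactly b' u v p q
      turn (inj₁ (w , lw , h)) = inj₁ (w , trans lw (trans (lab' (proj₂ cp)) (sym (lab' (proj₁ cp)))) , h)
      turn (inj₂ (k , ex)) = inj₂ (k , ex ∘ swapˣ)
      go : Dec (u ≡ x) → Dec (u ≡ y) → Dec (v ≡ x) → Dec (v ≡ y) → Exactly b' u v p q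
      go (yes refl) _ _ _ = open-at ext hub u≢v ¬c' ¬b' p≢q cp cq
      go (no _) (yes refl) _ _ = Y.open-at ext (hub-swap hub) u≢v ¬c' ¬b' p≢q cp cq
      go (no _) (no _) (yes refl) _ = turn (open-at ext hub (u≢v ∘ sym) (¬c' ∘ S′.sy) (¬b' ∘ syᵇ) p≢q
          (swapˣ cp) (swapˣ cq))
      go (no _) (no _) (no _) (yes refl) = turn (Y.open-at ext (hub-swap hub) (u≢v ∘ sym) (¬c' ∘ S′.sy) (¬b' ∘ syᵇ) p≢q
          (swapˣ cp) (swapˣ cq))
      go (no ux) (no uy) (no vx) (no vy) = Build.transfer-open ext u≢v ¬c' ¬b' p≢q
          (λ { (ur , vr) → old-off ur ux uy , old-off vr vx vy }) cp cq

    -- Two four-cycles through xy differing in both other vertices would form a path on six vertices,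
    -- so these cycles share a vertex next to x or y; closing the diagonal there settles all of them.
    only-hub : ∀ {w z w' z'} → Path₃ x y w z → Path₃ x y w' z' → w ≢ w' → z ≢ z' → ⊥
    only-hub {w} {z} {w'} {z'} (xw , wz , zy) (xw' , w'z' , z'y) w≢w' z≢z' =
      free (Sc.sy wz) (Sc.sy xw) xw' w'z' z'y
        (λ { refl → ¬c zy }) (λ { refl → k₀ (xw' , Sc.sy zy) }) z≢z' (Sc.~≢ zy)
        w≢w' (λ { refl → k₀ (xw , Sc.sy z'y) }) (λ { refl → ¬c xw })
        (λ { refl → ¬c z'y }) x≢y (λ { refl → ¬c xw' })

    -- If two cycles leave `w` for different vertices, another first vertex would conflict with one
    -- of them by `only-hub`, so `w` is common to all. Otherwise the same argument makes `z` common
    -- to all.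
    cycle-reply : ∀ {w z} → Path₃ x y w z → Outcome x
    cycle-reply {w} {z} pa@(xw , wz , zy) with any? (λ z′ → ¬? (z ≟ᶠ z′) ×-dec T? (c w z′) ×-dec T? (c z′ y))
    ... | yes (z' , z≢z' , wz' , z'y) = inj₂ (y , w , (λ { refl → ¬c xw }) , sym same , sym (lab xw) , ¬c'-y xw ,
          λ ext k → good₁ ext (inj₂ (inj₁ (w , trans (sym (lab xw)) same , k))) (open-hub ext (nextˡ w k uniq)))
      where
      uniq : ∀ {w″ z″} → Path₃ x y w″ z″ → w″ ≡ w
      uniq {w″} {z″} pa″ with w″ ≟ᶠ w | z″ ≟ᶠ z
      ... | yes e | _ = e
      ... | no ne | yes refl = ⊥-elim (only-hub pa″ (xw , wz' , z'y) ne z≢z')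
      ... | no ne | no nz = ⊥-elim (only-hub pa″ pa ne nz)
    ... | no nz' = inj₂ (x , z , (λ { refl → ¬c zy }) , refl , lz , ¬c'-x (Sc.sy zy) ,
          λ ext k → good₁ ext (inj₁ (z , lz , k)) (open-hub ext (nextʳ z k uniq)))
      where
      lz : L z ≡ L x
      lz = trans (lab zy) (sym same)
      uniq : ∀ {w″ z″} → Path₃ x y w″ z″ → z″ ≡ z
      uniq {w″} {z″} pa″@(xw″ , wz″ , zy″) with z″ ≟ᶠ z | w″ ≟ᶠ w
      ... | yes e | _ = e
      ... | no ne | yes refl = ⊥-elim (nz' (z″ , ne ∘ sym , wz″ , zy″))
      ... | no ne | no nw = ⊥-elim (only-hub pa″ pa nw ne)

    reply₀ : Outcome x
    reply₀ with O.hasTriangle? x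
    ... | yes t = dirty-reply (λ ext → Build.open' ext (triangle⁺ t))
    ... | no _ with any? (λ w → any? (λ z → T? (c x w) ×-dec T? (c w z) ×-dec T? (c z y)))
    ...   | yes (w , z , pa) = cycle-reply pa
    ...   | no np = dirty-reply (λ ext → open-hub ext (none λ pa → np (_ , _ , pa)))

  reply-no-common : ∀ {x y} → Move x y → ¬ N.HasButterfly x → NoCommon x y → Outcome x
  reply-no-common {x} {y} m nb k₀ with any? (O.spine? x) | any? (O.spine? y)
  ... | yes (w , s) | _ = spine-reply m nb k₀ s
  ... | no _ | yes (w , s) = outcome-swap m (spine-reply (swap-move m) (no-butterfly-swap m nb) (no-common-swap k₀) s)
  ... | no nx | no ny = NoSpine.reply₀ m nb k₀ (λ s → nx (_ , s)) (λ s → ny (_ , s))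

  -- Moves that complete a triangle

  third : {u v w : Fin n} → u ≢ v → u ≢ w → v ≢ w → ∀ p q → ∃[ r ] (r ≡ u ⊎ r ≡ v ⊎ r ≡ w) × r ≢ p × r ≢ q
  third {u} {v} {w} uv uw vw p q with u ≟ᶠ p | u ≟ᶠ q | v ≟ᶠ p | v ≟ᶠ q
  ... | no a | no b | _ | _ = u , inj₁ refl , a , b
  ... | _ | _ | no a | no b = v , inj₂ (inj₁ refl) , a , b
  ... | yes refl | _ | yes e | _ = ⊥-elim (uv (sym e))
  ... | yes refl | _ | _ | yes refl = w , inj₂ (inj₂ refl) , uw ∘ sym , vw ∘ sym
  ... | _ | yes refl | yes refl | _ = w , inj₂ (inj₂ refl) , vw ∘ sym , uw ∘ sym
  ... | _ | yes refl | _ | yes e = ⊥-elim (uv (sym e))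

  module NewTriangle {x y : Fin n} (m : Move x y) (nb : ¬ N.HasButterfly x) where
    open Move m
    open Adds adds
    open Step m
    private module NC = Blocked c' b L

    no-both : ∀ {u v w} → O.Tri u v w → O.In x u v w → O.In y u v w → ⊥
    no-both t ix iy = ¬c (OS.adjacent t ix iy x≢y)

    -- The old triangle has two vertices in common with the new triangle `x y p`. They are not `x`
    -- and `y`, which were not adjacent before the move.
    meets : ∀ {p u v w} → O.Common x y p → O.Tri u v w → L u ≡ L x →
      (O.In x u v w ⊎ O.In y u v w) × O.In p u v w
    meets {p} {u} {v} {w} (xp , yp) t l with O.In? x u v w | O.In? y u v w
    ... | yes ix | yes iy = ⊥-elim (no-both t ix iy)
    ... | no nx | no ny = ⊥-elim (NS.share nb (new , old xp , old yp) (tri⁺ t) refl l nx ny)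
    ... | yes ix | no ny = inj₁ ix , decidable-stable (O.In? p u v w) λ np →
          NS.share nb (old yp , S′.sy new , S′.sy (old xp)) (tri⁺ t) (sym same) l ny np
    ... | no nx | yes iy = inj₂ iy , decidable-stable (O.In? p u v w) λ np →
          NS.share nb (old xp , new , S′.sy (old yp)) (tri⁺ t) refl l nx np

    through-new : ¬ O.HasTriangle x → NS.AllThrough x x y
    through-new nt {u} l t with new-tri t
    ... | inj₁ t' = ⊥-elim (nt (u , l , _ , _ , t'))
    ... | inj₂ (ix , iy , _) = ix , iy

    -- An old triangle would contain `p` and `q`, so `p q` would be an edge with common neighbours
    -- `x` and `y`. As `x y` was not blocked, `blocked` gives a butterfly or a third common
    -- neighbour `r`; in the latter case the move creates a butterfly at `p` with blades `x y` and
    -- `q r`.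
    no-triangle : ∀ {p q} → p ≢ q → O.Common x y p → O.Common x y q → ¬ O.HasTriangle x
    no-triangle {p} {q} p≢q cp@(xp , yp) cq@(xq , yq) (u , l , v , w , t)
      with OS.adjacent t (proj₂ (meets cp t l)) (proj₂ (meets cq t l)) p≢q
    ... | pq with blocked pq x≢y (Sc.sy xp , Sc.sy xq) (Sc.sy yp , Sc.sy yq)
    ...   | inj₁ (s , ls , h) = nb (butterfly⁺ (s , trans ls (sym (lab xp)) , h))
    ...   | inj₂ (inj₁ bxy) = ¬b bxy
    ...   | inj₂ (inj₂ (r , r≢x , r≢y , pr , qr)) = nb (p , sym (lab xp) , x , y , q , r ,
            (S′.sy (old xp) , S′.sy (old yp) , new) , (old pq , old pr , old qr) ,
            Sc.~≢ xq , r≢x ∘ sym , Sc.~≢ yq , r≢y ∘ sym)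

    module Pair {p q : Fin n} (p≢q : p ≢ q) (cp : O.Common x y p) (cq : O.Common x y q) where
      private
        xp = proj₁ cp
        yp = proj₂ cp
        xq = proj₁ cq
        yq = proj₂ cq
        all = through-new (no-triangle p≢q cp cq)

      -- Here `open-pair` pays off: the pair of pages was blocked beforehand, so the reply is free
      -- to close a half-page.
      exact : T (b p q) × (∀ {r} → O.Common x y r → r ≡ p ⊎ r ≡ q)
      exact with open-pair x≢y ¬c ¬b p≢q cp cq
      ... | inj₁ t = ⊥-elim (no-triangle p≢q cp cq t)
      ... | inj₂ h = h

      four : Unique (x ∷ y ∷ p ∷ q ∷ [])
      four = (x≢y ∷ Sc.~≢ xp ∷ Sc.~≢ xq ∷ []) ∷ (Sc.~≢ yp ∷ Sc.~≢ yq ∷ []) ∷ (p≢q ∷ []) ∷ [] ∷ []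

      module _ {b' : Adj n} (ext : Extends c' b b') where
        open Extends ext
        open Build ext

        private
          in-class : ∀ {z} → NB.Half x y z → L z ≡ L x
          in-class (_ , _ , inj₁ (xz , _)) = sym (N.Classes.lab C' xz)
          in-class (_ , _ , inj₂ (yz , _)) = trans (sym (N.Classes.lab C' yz)) (sym same)

          not-half : ∀ {z} → N.Common x y z → ¬ NB.Half x y z
          not-half (xz , yz) (_ , _ , inj₁ (_ , ¬yz , _)) = ¬yz yz
          not-half (xz , yz) (_ , _ , inj₂ (_ , ¬xz , _)) = ¬xz xz

          pages≤2 : NB.pages x y ≤ 2
          pages≤2 = V#-two λ z t → proj₂ exact (old-common (toWitness t))

        -- Two pages cost 4 and rounding up costs at most 1. The five vertices that are not open
        -- half-pages are `x`, `y`, `p`, `q` and the one just closed.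
        one-less : ∀ {r} → L r ≡ L x → r ≢ x → r ≢ y → r ≢ p → r ≢ q → ¬ NB.Half x y r → NB.Budget x y
        one-less {r} lr rx ry rp rq nr = ≤-trans
          (+-mono-≤ (*-monoʳ-≤ 2 pages≤2) (up2-≤ (NB.halves x y)))
          (≤-trans (≤-reflexive (+-suc 4 (NB.halves x y))) (V#-room {xs = r ∷ x ∷ y ∷ p ∷ q ∷ []}
            ((rx ∷ ry ∷ rp ∷ rq ∷ []) ∷ four)
            (==⁺ lr ∷ ==⁺ refl ∷ ==⁺ (sym same) ∷ ==⁺ (sym (lab xp)) ∷ ==⁺ (sym (lab xq)) ∷ [])
            (nr ∘ toWitness ∷ (λ t → proj₁ (toWitness t) refl) ∷ (λ t → proj₁ (proj₂ (toWitness t)) refl)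
              ∷ not-half (common⁺ cp) ∘ toWitness ∷ not-half (common⁺ cq) ∘ toWitness ∷ [])
            (λ z t → ==⁺ (in-class (toWitness t)))))

        -- With no half-page there is nothing to round up, and four vertices are enough.
        none-left : ¬ (∃[ z ] NC.Half x y z) → NB.Budget x y
        none-left nh = ≤-trans
          (+-mono-≤ (*-monoʳ-≤ 2 pages≤2) (≤-reflexive (cong up2 (cnt-≡0 (λ z t → no-half z (toWitness t)) (allFin n)))))
          (V#-unique four (==⁺ refl ∷ ==⁺ (sym same) ∷ ==⁺ (sym (lab xp)) ∷ ==⁺ (sym (lab xq)) ∷ []))
          where
          no-half : ∀ z → ¬ NB.Half x y z
          no-half z (zx , zy , inj₁ (h , ¬h , ¬b')) = nh (z , zx , zy , inj₁ (h , ¬h , ¬b' ∘ keep))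
          no-half z (zx , zy , inj₂ (h , ¬h , ¬b')) = nh (z , zx , zy , inj₂ (h , ¬h , ¬b' ∘ keep))

        good₂ : NB.Budget x y → NB.Good
        good₂ bd = good (inj₂ (inj₂ (inj₁ (x , refl , y , new , p , q , p≢q , common⁺ cp , common⁺ cq))))
          (λ l s → inj₂ ([ (λ { (refl , refl) → bd }) , (λ { (refl , refl) → budget-flip same bd }) ]′ (NS.same-spine x≢y all l s)))
          (λ {u} {v} {p'} {q'} l uv p'≢q' cp' cq' → inj₂ (inj₁
            ([ (λ { (refl , refl) → pair p'≢q' (proj₂ exact (old-common cp')) (proj₂ exact (old-common cq')) })
             , (λ { (refl , refl) → pair p'≢q' (proj₂ exact (old-common (swapˣ cp'))) (proj₂ exact (old-common (swapˣ cq'))) }) ]′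
             (NS.same-spine x≢y all l (uv , p' , q' , p'≢q' , cp' , cq')))))
          (open' (x , refl , y , p , new , common⁺ cp))
          where
          bpq = keep (proj₁ exact)
          pair : ∀ {p' q'} → p' ≢ q' → p' ≡ p ⊎ p' ≡ q → q' ≡ p ⊎ q' ≡ q → T (b' p' q')
          pair ne (inj₁ refl) (inj₁ refl) = ⊥-elim (ne refl)
          pair ne (inj₁ refl) (inj₂ refl) = bpq
          pair ne (inj₂ refl) (inj₁ refl) = Simple.sy (Position.simpleᵇ position) bpq
          pair ne (inj₂ refl) (inj₂ refl) = ⊥-elim (ne refl)

      reply₂ : Outcome x
      reply₂ with any? (NC.half? x y)
      ... | no nh = inj₁ λ ext → good₂ ext (none-left ext nh)
      ... | yes (r , r≢x , r≢y , inj₁ (xr , ¬yr , _)) = inj₂ (y , r , r≢y ∘ sym , sym same , lr , ¬yr ,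
            λ ext k → good₂ ext (one-less ext lr r≢x r≢y (λ { refl → ¬yr (old yp) }) (λ { refl → ¬yr (old yq) })
              λ { (_ , _ , inj₁ (_ , _ , ¬b')) → ¬b' k ; (_ , _ , inj₂ (yr , _)) → ¬yr yr }))
        where lr = sym (N.Classes.lab C' xr)
      ... | yes (r , r≢x , r≢y , inj₂ (yr , ¬xr , _)) = inj₂ (x , r , r≢x ∘ sym , refl , lr , ¬xr ,
            λ ext k → good₂ ext (one-less ext lr r≢x r≢y (λ { refl → ¬xr (old xp) }) (λ { refl → ¬xr (old xq) })
              λ { (_ , _ , inj₂ (_ , _ , ¬b')) → ¬b' k ; (_ , _ , inj₁ (xr , _)) → ¬xr xr }))
        where lr = trans (sym (N.Classes.lab C' yr)) (sym same)

    module Single {z : Fin n} (cz : O.Common x y z) (only-z : ∀ {r} → O.Common x y r → r ≡ z) where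
      private
        xz = proj₁ cz
        yz = proj₂ cz

      new-triangle : N.HasTriangle x
      new-triangle = x , refl , y , z , new , common⁺ cz

      -- One triangle has no spine, so the only debt is a dirty end of `x y`; the old edge `x z`
      -- helps to settle it. If only `z` is dirty, its blocked partner `r` is a fourth vertex. It
      -- cannot be joined to both `x` and `y`, and the missing edge is the reply.
      first-triangle : ¬ O.HasTriangle x → Outcome x
      first-triangle nt = go (dirty xz)
        where
        no-spine : ∀ {u v p q} → L u ≡ L x → T (c' u v) → p ≢ q → N.Common u v p → N.Common u v q → ⊥
        no-spine l uv p≢q cp cq with NS.same-spine x≢y (through-new nt) l (uv , _ , _ , p≢q , cp , cq)
        ... | inj₁ (refl , refl) = p≢q (trans (only-z (old-common cp)) (sym (only-z (old-common cq))))
        ... | inj₂ (refl , refl) = p≢q (trans (only-z (old-common (swapˣ cp))) (sym (only-z (old-common (swapˣ cq)))))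
        good₁ : ∀ {b'} (ext : Extends c' b b') → Build.TwoOrDirty ext → Blocked.Good c' b' L
        good₁ ext d = let open Build ext in
          good d (λ { l (uv , p , q , p≢q , cp , cq) → ⊥-elim (no-spine l uv p≢q cp cq) })
            (λ l uv p≢q cp cq → ⊥-elim (no-spine l uv p≢q cp cq)) (open' new-triangle)
        go : OB.Dirty x ⊎ OB.Dirty z ⊎ (∀ r → L r ≡ L x → r ≡ x ⊎ r ≡ z) ⊎ O.HasSpine x ⊎ O.HasButterfly x → Outcome x
        go (inj₁ d) = inj₁ λ ext → good₁ ext (inj₁ (Build.dirty⁺ ext d))
        go (inj₂ (inj₁ (r , l , zr))) with T? (c x r)
        ... | yes xr = inj₂ (y , r , y≢r , sym same , lr , (λ yr → bad (xr , old-y yr r≢x)) ,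
                λ ext k → good₁ ext (inj₂ (inj₁ (r , trans lr same , k))))
          where
          lr = trans l (sym (lab xz))
          y≢r : y ≢ r
          y≢r refl = disj (Sc.sy yz) zr
          r≢x : r ≢ x
          r≢x refl = disj (Sc.sy xz) zr
          bad : ¬ O.Common x y r
          bad cr with only-z cr
          ... | refl = Simple.irr simpleᵇ zr
        ... | no ¬xr = inj₂ (x , r , r≢x ∘ sym , refl , lr , (λ xr → ¬xr (old-x xr r≢y)) ,
                λ ext k → good₁ ext (inj₁ (r , lr , k)))
          where
          lr = trans l (sym (lab xz))
          r≢y : r ≢ y
          r≢y refl = disj (Sc.sy yz) zr
          r≢x : r ≢ x
          r≢x refl = disj (Sc.sy xz) zr
        go (inj₂ (inj₂ (inj₁ f))) with f y (sym same)
        ... | inj₁ e = ⊥-elim (x≢y (sym e))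
        ... | inj₂ refl = ⊥-elim (Sc.irr yz)
        go (inj₂ (inj₂ (inj₂ (inj₁ (u , l , v , uv , p , _ , _ , cp , _))))) = ⊥-elim (nt (u , l , v , p , uv , cp))
        go (inj₂ (inj₂ (inj₂ (inj₂ (u , l , a , d , _ , _ , t , _))))) = ⊥-elim (nt (u , l , a , d , t))

      module Second {w : Fin n} (xw : T (c x w)) (zw : T (c z w)) where
        private
          w≢y : w ≢ y
          w≢y refl = ¬c xw
          z≢x = Sc.~≢ xz ∘ sym
          z≢y = Sc.~≢ yz ∘ sym
          ¬wy : ¬ T (c w y)
          ¬wy wy with only-z (xw , Sc.sy wy)
          ... | refl = Sc.irr zw
          ¬wy' : ¬ T (c' w y)
          ¬wy' e = ¬wy (old-off e (Sc.~≢ xw ∘ sym) w≢y)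
          cw : N.Common x z w
          cw = old xw , old zw
          cy : N.Common x z y
          cy = new , S′.sy (old yz)
          all : NS.AllThrough x x z
          all = NS.book nb refl (old xz) w≢y cw cy ¬wy'
          spine : N.HasSpine x
          spine = x , refl , z , old xz , w , y , w≢y , cw , cy
          ¬old-butterfly : ¬ O.HasButterfly x
          ¬old-butterfly = nb ∘ butterfly⁺

          page-old : ∀ {r} → N.Common x z r → r ≡ y ⊎ O.Common x z r
          page-old {r} (xr , zr) with r ≟ᶠ y
          ... | yes e = inj₁ e
          ... | no ne = inj₂ (old-x xr ne , old-off zr z≢x z≢y)

        module _ {b' : Adj n} (ext : Extends c' b b') where
          open Extends ext
          open Build ext

          half-old : ∀ {r} → NB.Half x z r → OB.Half x z r
          half-old (rx , rz , inj₁ (xr , ¬zr , ¬b')) =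
            rx , rz , inj₁ (old-x xr (λ { refl → ¬zr (S′.sy (old yz)) }) , ¬zr ∘ old , ¬b' ∘ keep)
          half-old (rx , rz , inj₂ (zr , ¬xr , ¬b')) = rx , rz , inj₂ (old-off zr z≢x z≢y , ¬xr ∘ old , ¬b' ∘ keep)

          not-half : ∀ {r} → N.Common x z r → ¬ NB.Half x z r
          not-half (xr , zr) (_ , _ , inj₁ (_ , ¬zr , _)) = ¬zr zr
          not-half (xr , zr) (_ , _ , inj₂ (_ , ¬xr , _)) = ¬xr xr

          good₃ : NB.Budget x z →
            (∀ {p q} → p ≢ q → N.Common x z p → N.Common x z q → T (b' p q) ⊎ ∃[ r ] r ≢ p × r ≢ q × N.Common x z r) → NB.Good
          good₃ bd bl = good (inj₂ (inj₂ (inj₁ spine)))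
            (λ l s → inj₂ ([ (λ { (refl , refl) → bd }) , (λ { (refl , refl) → budget-flip (lab xz) bd }) ]′ (NS.same-spine (Sc.~≢ xz) all l s)))
            (λ l uv p≢q cp cq → inj₂ ([ (λ { (refl , refl) → bl p≢q cp cq })
               , (λ { (refl , refl) → Sum.map₂ (λ { (r , rp , rq , cr) → r , rp , rq , swapˣ cr })
                   (bl p≢q (swapˣ cp) (swapˣ cq)) }) ]′
               (NS.same-spine (Sc.~≢ xz) all l (uv , _ , _ , p≢q , cp , cq))))
            (open' new-triangle)

        -- The reply must block the K₄ and therefore closes no half-page. The vertex lacking in the
        -- budget is taken from `dirty` for the edge `x z`, as it held before the move.
        two-pages : (∀ {r} → O.Common x z r → r ≡ w) → Outcome x
        two-pages only-w = inj₂ (w , y , w≢y , sym (lab xw) , sym same , ¬wy' , λ ext k →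
            good₃ ext (five ext k (outer (dirty xz))) (λ p≢q cp cq → inj₁ (pair ext k p≢q (page cp) (page cq))))
          where
          page : ∀ {r} → N.Common x z r → r ≡ w ⊎ r ≡ y
          page cr = [ inj₂ , inj₁ ∘ only-w ]′ (page-old cr)
          pair : ∀ {b'} (ext : Extends c' b b') → T (b' w y) → ∀ {p q} → p ≢ q → p ≡ w ⊎ p ≡ y → q ≡ w ⊎ q ≡ y → T (b' p q)
          pair ext k ne (inj₁ refl) (inj₁ refl) = ⊥-elim (ne refl)
          pair ext k ne (inj₁ refl) (inj₂ refl) = k
          pair ext k ne (inj₂ refl) (inj₁ refl) = Simple.sy (Position.simpleᵇ (Extends.position ext)) k
          pair ext k ne (inj₂ refl) (inj₂ refl) = ⊥-elim (ne refl)

          Outer : Fin n → Set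
          Outer r = L r ≡ L x × (T (b x r) ⊎ T (b z r))

          outer : OB.Dirty x ⊎ OB.Dirty z ⊎ (∀ r → L r ≡ L x → r ≡ x ⊎ r ≡ z) ⊎ O.HasSpine x ⊎ O.HasButterfly x → ∃[ r ] Outer r
          outer (inj₁ (r , l , h)) = r , l , inj₁ h
          outer (inj₂ (inj₁ (r , l , h))) = r , trans l (sym (lab xz)) , inj₂ h
          outer (inj₂ (inj₂ (inj₁ f))) = ⊥-elim ([ Sc.~≢ xw ∘ sym , Sc.~≢ zw ∘ sym ]′ (f w (sym (lab xw))))
          outer (inj₂ (inj₂ (inj₂ (inj₁ (u , l , v , uv , p , q , p≢q , cp , cq))))) =
            ⊥-elim (absurd (NS.same-spine (Sc.~≢ xz) all l (spine⁺ (uv , p , q , p≢q , cp , cq))))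
            where
            absurd : ¬ ((u ≡ x × v ≡ z) ⊎ (u ≡ z × v ≡ x))
            absurd (inj₁ (refl , refl)) = p≢q (trans (only-w cp) (sym (only-w cq)))
            absurd (inj₂ (refl , refl)) = p≢q (trans (only-w (swapˣ cp)) (sym (only-w (swapˣ cq))))
          outer (inj₂ (inj₂ (inj₂ (inj₂ h)))) = ⊥-elim (¬old-butterfly h)

          -- The vertex `r` is blocked from an end of the spine, so it is neither on the spine, nor
          -- a page, nor an open half-page. It pays for the rounding in `up2`.
          five : ∀ {b'} (ext : Extends c' b b') → T (b' w y) → ∃[ r ] Outer r → Blocked.Budget c' b' L x z
          five {b'} ext k (r , lr , h) = ≤-trans
            (+-mono-≤ (*-monoʳ-≤ 2 (V#-two λ s t → page (toWitness t))) (up2-≤ (NB.halves x z)))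
            (≤-trans (≤-reflexive (+-suc 4 (NB.halves x z))) (V#-room {xs = r ∷ x ∷ z ∷ w ∷ y ∷ []}
              ((r≢x ∷ r≢z ∷ r≢w ∷ r≢y ∷ [])
                ∷ (Sc.~≢ xz ∷ Sc.~≢ xw ∷ x≢y ∷ []) ∷ (Sc.~≢ zw ∷ z≢y ∷ []) ∷ (w≢y ∷ []) ∷ [] ∷ [])
              (==⁺ lr ∷ ==⁺ refl ∷ ==⁺ (sym (lab xz)) ∷ ==⁺ (sym (lab xw)) ∷ ==⁺ (sym same) ∷ [])
              (nr ∘ toWitness ∷ (λ t → proj₁ (toWitness t) refl) ∷ (λ t → proj₁ (proj₂ (toWitness t)) refl)
                ∷ not-half ext cw ∘ toWitness ∷ not-half ext cy ∘ toWitness ∷ [])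
              (λ s t → ==⁺ (in-class (toWitness t)))))
            where
            open Extends ext
            module NB = Blocked c' b' L
            simpleᵇ-irr : ∀ {u} → ¬ T (b u u)
            simpleᵇ-irr = Simple.irr simpleᵇ
            r≢x : r ≢ x
            r≢x refl = [ simpleᵇ-irr , disj (Sc.sy xz) ]′ h
            r≢z : r ≢ z
            r≢z refl = [ disj xz , simpleᵇ-irr ]′ h
            r≢w : r ≢ w
            r≢w refl = [ disj xw , disj zw ]′ h
            r≢y : r ≢ y
            r≢y refl = [ ¬b , disj (Sc.sy yz) ]′ h
            nr : ¬ NB.Half x z r
            nr = apart h ∘ half-old ext
              where
              apart : T (b x r) ⊎ T (b z r) → ¬ OB.Half x z r
              apart (inj₁ bx) (_ , _ , inj₁ (xr , _)) = disj xr bx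
              apart (inj₂ bz) (_ , _ , inj₁ (_ , _ , ¬bz)) = ¬bz bz
              apart (inj₁ bx) (_ , _ , inj₂ (_ , _ , ¬bx)) = ¬bx bx
              apart (inj₂ bz) (_ , _ , inj₂ (zr , _)) = disj zr bz
            in-class : ∀ {s} → NB.Half x z s → L s ≡ L x
            in-class (_ , _ , inj₁ (xs , _)) = sym (N.Classes.lab C' xs)
            in-class (_ , _ , inj₂ (zs , _)) = trans (sym (N.Classes.lab C' zs)) (sym (lab xz))

        -- The vertex `y` turns from a half-page into a page. Closing one more half-page leaves the
        -- balance as it was. The clause `blocked` is met by a third page, so no reply is spent on a
        -- K₄.
        more-pages : ∀ {w₂} → w₂ ≢ w → O.Common x z w₂ → Outcome x
        more-pages {w₂} w₂≢w cw₂@(xw₂ , zw₂) with budget (xz , w₂ , w , w₂≢w , cw₂ , xw , zw)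
        ... | inj₁ h = ⊥-elim (¬old-butterfly h)
        ... | inj₂ bd = reply (any? (NC.half? x z))
          where
          w₂≢y : w₂ ≢ y
          w₂≢y refl = ¬c xw₂
          another : ∀ p q → ∃[ r ] r ≢ p × r ≢ q × N.Common x z r
          another p q with third w₂≢w w₂≢y w≢y p q
          ... | r , inj₁ refl , rp , rq = r , rp , rq , common⁺ cw₂
          ... | r , inj₂ (inj₁ refl) , rp , rq = r , rp , rq , cw
          ... | r , inj₂ (inj₂ refl) , rp , rq = r , rp , rq , cy

          y-half : OB.Half x z y
          y-half = x≢y ∘ sym , z≢y ∘ sym , inj₂ (Sc.sy yz , ¬c , ¬b)

          step : ∀ {b'} (ext : Extends c' b b') → up2 (Blocked.halves c' b' L x z) + 2 ≤ up2 (OB.halves x z) → Blocked.Good c' b' L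
          step {b'} ext le = good₃ ext
            (≤-trans (≤-trans (+-monoˡ-≤ (up2 (NB.halves x z)) (*-monoʳ-≤ 2 pages≤)) (≤-reflexive arith))
              (≤-trans (+-monoʳ-≤ (2 * OB.pages x z) le) bd))
            (λ {p} {q} _ _ _ → inj₂ (another p q))
            where
            module NB = Blocked c' b' L
            pages≤ : NB.pages x z ≤ suc (OB.pages x z)
            pages≤ = ≤-trans (cnt-∪ {p = _== y} (λ s t → Sum.map ==⁺ fromWitness (page-old (toWitness t))) (allFin n))
              (+-monoˡ-≤ (OB.pages x z) (V#-point≤1 y))
            arith : 2 * suc (OB.pages x z) + up2 (NB.halves x z) ≡ 2 * OB.pages x z + (up2 (NB.halves x z) + 2)
            arith = solve (OB.pages x z) (up2 (NB.halves x z))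
              where
              solve : ∀ a b → 2 * suc a + b ≡ 2 * a + (b + 2)
              solve = solve-∀

          two-less : ∀ {r} → r ≢ y → NC.Half x z r → ∀ {b'} (ext : Extends c' b b') → ¬ Blocked.Half c' b' L x z r →
            up2 (Blocked.halves c' b' L x z) + 2 ≤ up2 (OB.halves x z)
          two-less {r} ry hr {b'} ext nr = subst (_≤ up2 (OB.halves x z)) (+-comm 2 (up2 (NB.halves x z)))
            (up2-mono (V#-room {p = λ s → ⌊ NB.half? x z s ⌋} {r = λ s → ⌊ OB.half? x z s ⌋} {xs = r ∷ y ∷ []} ((ry ∷ []) ∷ [] ∷ [])
              (fromWitness (half-old (record { position = C'-position ; keep = λ h → h }) hr) ∷ fromWitness y-half ∷ [])
              (nr ∘ toWitness ∷ not-half ext cy ∘ toWitness ∷ []) (λ s t → fromWitness (half-old ext (toWitness t)))))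
            where
            module NB = Blocked c' b' L
            C'-position : Position c' b
            C'-position = record { simple = S' ; simpleᵇ = simpleᵇ
              ; disj = λ e e' → Position.disj (Extends.position ext) e (Extends.keep ext e') }

          reply : Dec (∃[ r ] NC.Half x z r) → Outcome x
          reply (yes (r , hr@(r≢x , r≢z , inj₁ (xr , ¬zr , _)))) =
            inj₂ (z , r , r≢z ∘ sym , sym (lab xz) , sym (N.Classes.lab C' xr) , ¬zr , λ ext k →
              step ext (two-less (λ { refl → ¬zr (S′.sy (old yz)) }) hr ext
                λ { (_ , _ , inj₁ (_ , _ , ¬b')) → ¬b' k ; (_ , _ , inj₂ (zr , _)) → ¬zr zr }))
          reply (yes (r , hr@(r≢x , r≢z , inj₂ (zr , ¬xr , _)))) =
            inj₂ (x , r , r≢x ∘ sym , refl , trans (sym (N.Classes.lab C' zr)) (sym (lab xz)) , ¬xr , λ ext k →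
              step ext (two-less (λ { refl → ¬xr new }) hr ext
                λ { (_ , _ , inj₂ (_ , _ , ¬b')) → ¬b' k ; (_ , _ , inj₁ (xr , _)) → ¬xr xr }))
          -- No half-page is left to close, but `y` itself was one, so the old term `up2` was at
          -- least 2, the price of the new page.
          reply (no nh) = inj₁ λ {b'} ext → step ext (subst (λ h → up2 h + 2 ≤ up2 (OB.halves x z))
            (sym (cnt-≡0 (λ s t → closed b' ext s (toWitness t)) (allFin n)))
            (up2-mono {1} (V#-unique {p = λ s → ⌊ OB.half? x z s ⌋} {xs = y ∷ []} ([] ∷ []) (fromWitness y-half ∷ []))))
            where
            closed : ∀ b' → Extends c' b b' → ∀ s → ¬ Blocked.Half c' b' L x z s
            closed b' ext s (sx , sz , inj₁ (h , ¬h , ¬b')) = nh (s , sx , sz , inj₁ (h , ¬h , ¬b' ∘ Extends.keep ext))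
            closed b' ext s (sx , sz , inj₂ (h , ¬h , ¬b')) = nh (s , sx , sz , inj₂ (h , ¬h , ¬b' ∘ Extends.keep ext))

        next-triangle : Outcome x
        next-triangle with any? (λ r → ¬? (r ≟ᶠ w) ×-dec O.common? x z r)
        ... | yes (w₂ , w₂≢w , cw₂) = more-pages w₂≢w cw₂
        ... | no no₂ = two-pages λ {r} cr → decidable-stable (r ≟ᶠ w) λ ne → no₂ (r , ne , cr)

  reply : ∀ {x y} → Move x y → Outcome x
  reply {x} {y} m with N.hasButterfly? x
  ... | yes h = Step.with-butterfly m h
  ... | no nb with any? (O.common? x y)
  ...   | no nk = reply-no-common m nb (λ h → nk (_ , h))
  ...   | yes (z , cz) with any? (λ r → ¬? (r ≟ᶠ z) ×-dec O.common? x y r)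
  ...     | yes (r , r≢z , cr) = NewTriangle.Pair.reply₂ m nb (r≢z ∘ sym) cz cr
  ...     | no nr with O.hasTriangle? x
  ...       | no nt = NewTriangle.Single.first-triangle m nb cz
                        (λ {r} cr → decidable-stable (r ≟ᶠ z) λ ne → nr (r , ne , cr)) nt
  ...       | yes (u , l , v , w , t) = go (NewTriangle.meets m nb cz t l)
    where
    open Move m
    open Step m using (module OS)
    only-z : ∀ {r} → O.Common x y r → r ≡ z
    only-z {r} cr = decidable-stable (r ≟ᶠ z) λ ne → nr (r , ne , cr)
    go : (O.In x u v w ⊎ O.In y u v w) × O.In z u v w → Outcome x
    go (inj₁ ix , iz) with OS.third-vertex (Sc.~≢ (proj₁ cz)) ix iz t
    ... | d , (_ , xd , zd) , _ = NewTriangle.Single.Second.next-triangle m nb cz only-z xd zd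
    go (inj₂ iy , iz) with OS.third-vertex (Sc.~≢ (proj₂ cz)) iy iz t
    ... | d , (_ , yd , zd) , _ = outcome-swap m (NewTriangle.Single.Second.next-triangle (swap-move m)
            (no-butterfly-swap m nb) (swapˣ cz) (only-z ∘ swapˣ) yd zd)

-- Replies to a move joining two components

module Join {n : ℕ} {c b c' : Adj n} {L : Fin n → Fin n}
  (P : Position c b) (C : Shape.Classes c L) (G : Blocked.Good c b L)
  (S' : Simple c') (free' : P6Free c') {x y : Fin n} (adds : Adds c x y c') (lx≢ly : L x ≢ L y) where

  open Position P
  open Adds adds
  private
    module Sc = Simple simple
    module S′ = Simple S'
    module O = Shape c L
    module OB = Blocked c b L
  open Shape.Classes C
  open OB.Good G

  L' : Fin n → Fin n
  L' z with L z ≟ᶠ L y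
  ... | yes _ = L x
  ... | no _ = L z

  private module N = Shape c' L'

  L'-cong : ∀ {u v} → L u ≡ L v → L' u ≡ L' v
  L'-cong {u} {v} e with L u ≟ᶠ L y | L v ≟ᶠ L y
  ... | yes _ | yes _ = refl
  ... | yes p | no q = ⊥-elim (q (trans (sym e) p))
  ... | no p | yes q = ⊥-elim (p (trans e q))
  ... | no _ | no _ = e

  L'-joined : L' y ≡ L' x
  L'-joined with L y ≟ᶠ L y | L x ≟ᶠ L y
  ... | no p | _ = ⊥-elim (p refl)
  ... | yes _ | yes q = ⊥-elim (lx≢ly q)
  ... | yes _ | no _ = refl

  L'⁻ : ∀ {u v} → L' u ≡ L' v → L u ≡ L v ⊎ (L u ≡ L x × L v ≡ L y) ⊎ (L u ≡ L y × L v ≡ L x)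
  L'⁻ {u} {v} e with L u ≟ᶠ L y | L v ≟ᶠ L y
  ... | yes p | yes q = inj₁ (trans p (sym q))
  ... | yes p | no q = inj₂ (inj₂ (p , sym e))
  ... | no p | yes q = inj₂ (inj₁ (e , q))
  ... | no _ | no _ = inj₁ e

  in-joined : ∀ {u} → L' u ≡ L' x → L u ≡ L x ⊎ L u ≡ L y
  in-joined e = [ inj₁ , [ inj₁ ∘ proj₁ , inj₂ ∘ proj₁ ]′ ]′ (L'⁻ e)

  joinˣ : ∀ {u} → L u ≡ L x → L' u ≡ L' x
  joinˣ = L'-cong

  joinʸ : ∀ {u} → L u ≡ L y → L' u ≡ L' x
  joinʸ e = trans (L'-cong e) L'-joined

  C' : N.Classes
  C' = record { lab = lab' ; cut = cut' }
    where
    lab' : ∀ {u v} → T (c' u v) → L' u ≡ L' v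
    lab' e = [ L'-cong ∘ lab , [ (λ { (refl , refl) → sym L'-joined }) , (λ { (refl , refl) → L'-joined }) ]′ ]′ (only e)
    relabel : ∀ {S : Fin n → Bool} {u v} → L' u ≡ L' v → ∃[ p ] ∃[ q ] T (c p q) × T (S p) × ¬ T (S q) × L p ≡ L u →
      ∃[ p ] ∃[ q ] T (c' p q) × T (S p) × ¬ T (S q) × L' p ≡ L' v
    relabel e (p , q , pq , sp , sq , l) = p , q , old pq , sp , sq , trans (L'-cong l) e
    cut' : (S : Fin n → Bool) → ∀ {u w} → T (S u) → ¬ T (S w) → L' u ≡ L' w →
      ∃[ p ] ∃[ q ] T (c' p q) × T (S p) × ¬ T (S q) × L' p ≡ L' u
    cut' S {u} {w} su sw e with L'⁻ e
    ... | inj₁ l = relabel {S} refl (cut S su sw l)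
    ... | inj₂ (inj₁ (lu , lw)) with T? (S x) | T? (S y)
    ...   | no nx | _ = relabel {S} refl (cut S su nx lu)
    ...   | yes _ | yes sy' = relabel {S} (trans (joinʸ refl) (sym (joinˣ lu))) (cut S sy' sw (sym lw))
    ...   | yes sx | no ny = x , y , new , sx , ny , sym (joinˣ lu)
    cut' S {u} {w} su sw e | inj₂ (inj₂ (lu , lw)) with T? (S y) | T? (S x)
    ...   | no ny | _ = relabel {S} refl (cut S su ny lu)
    ...   | yes _ | yes sx = relabel {S} (sym (joinʸ lu)) (cut S sx sw (sym lw))
    ...   | yes sy' | no nx = y , x , S′.sy new , sy' , nx , trans L'-joined (sym (joinʸ lu))

  free : P6Free c
  free e₁ e₂ e₃ e₄ e₅ = free' (old e₁) (old e₂) (old e₃) (old e₄) (old e₅)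

  private
    module OS = O.Static simple C free
    module NS = N.Static S' C' free'

  x≢y : x ≢ y
  x≢y refl = lx≢ly refl

  old-x : ∀ {v} → T (c' x v) → v ≢ y → T (c x v)
  old-x e vy = [ (λ h → h) , [ ⊥-elim ∘ vy ∘ proj₂ , ⊥-elim ∘ x≢y ∘ proj₁ ]′ ]′ (only e)

  old-y : ∀ {v} → T (c' y v) → v ≢ x → T (c y v)
  old-y e vx = [ (λ h → h) , [ ⊥-elim ∘ x≢y ∘ sym ∘ proj₁ , ⊥-elim ∘ vx ∘ proj₂ ]′ ]′ (only e)

  no-common : ∀ {w} → T (c' x w) → T (c' y w) → ⊥
  no-common xw yw = lx≢ly (trans (lab (old-x xw (S′.~≢ yw ∘ sym))) (sym (lab (old-y yw (S′.~≢ xw ∘ sym)))))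

  tri-old : ∀ {u v w} → N.Tri u v w → O.Tri u v w
  tri-old {u} {v} {w} (uv , uw , vw) = edge uv uw vw , edge uw uv (S′.sy vw) , edge vw (S′.sy uv) (S′.sy uw)
    where
    edge : ∀ {u v w} → T (c' u v) → T (c' u w) → T (c' v w) → T (c u v)
    edge uv uw vw with only uv
    ... | inj₁ h = h
    ... | inj₂ (inj₁ (refl , refl)) = ⊥-elim (no-common uw vw)
    ... | inj₂ (inj₂ (refl , refl)) = ⊥-elim (no-common vw uw)

  -- The new edge is a bridge, so it lies on no four-cycle.
  cycle-old : ∀ {u v p r} → u ≢ v → p ≢ r → N.Common u v p → N.Common u v r → O.Common u v p
  cycle-old u≢v p≢r (up , vp) (ur , vr) = edge u≢v up vp ur vr , edge (u≢v ∘ sym) vp up vr ur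
    where
    edge : ∀ {u v} → u ≢ v → T (c' u _) → T (c' v _) → T (c' u _) → T (c' v _) → T (c u _)
    edge {u} {v} u≢v up vp ur vr with only up
    ... | inj₁ h = h
    ... | inj₂ (inj₁ (refl , refl)) = ⊥-elim (lx≢ly (trans (lab (old-x ur (p≢r ∘ sym)))
            (trans (sym (lab vr')) (lab vp'))))
      where
      vp' = Sc.sy (old-y (S′.sy vp) (u≢v ∘ sym))
      vr' = [ (λ h → h) , [ (λ h → ⊥-elim (u≢v (sym (proj₁ h)))) , (λ { (refl , refl) → ⊥-elim (S′.irr vp) }) ]′ ]′ (only vr)
    ... | inj₂ (inj₂ (refl , refl)) = ⊥-elim (lx≢ly (trans (sym (lab vp'))
            (trans (lab vr') (sym (lab (old-y ur (p≢r ∘ sym)))))))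
      where
      vp' = Sc.sy (old-x (S′.sy vp) (u≢v ∘ sym))
      vr' = [ (λ h → h) , [ (λ { (refl , refl) → ⊥-elim (S′.irr vp) }) , (λ h → ⊥-elim (u≢v (sym (proj₁ h)))) ]′ ]′ (only vr)

  common⁺ : ∀ {u v p} → O.Common u v p → N.Common u v p
  common⁺ (p , q) = old p , old q

  tri⁺ : ∀ {u v p} → O.Tri u v p → N.Tri u v p
  tri⁺ (p , q) = old p , common⁺ q

  butterfly⁺ : ∀ {s} → O.HasButterfly s → N.HasButterfly s
  butterfly⁺ (u , l , a , b , d , e , t , t' , h) = u , L'-cong l , a , b , d , e , tri⁺ t , tri⁺ t' , h

  butterfly-at : ∀ {s r} → L' s ≡ L' r → N.HasButterfly s → N.HasButterfly r
  butterfly-at e (u , l , h) = u , trans l e , h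

  triangle⁺ : ∀ {s} → O.HasTriangle s → N.HasTriangle s
  triangle⁺ (u , l , v , w , t) = u , L'-cong l , v , w , tri⁺ t

  Isolated : Fin n → Set
  Isolated x = ∀ {z} → ¬ T (c x z)

  alone : ∀ {x z} → Isolated x → L z ≡ L x → z ≡ x
  alone {x} {z} iso l = decidable-stable (z ≟ᶠ x) λ ne → iso (proj₂ (OS.neighbour (ne ∘ sym) (sym l)))

  Partner : Fin n → Fin n → Set
  Partner x x' = T (c x x') × ∀ z → L z ≡ L x → z ≡ x ⊎ z ≡ x'

  module _ {b' : Adj n} (ext : Extends c' b b') where
    open Extends ext
    private module NB = Blocked c' b' L'

    -- The bridge `x y` creates neither triangles nor four-cycles. Three duties remain: closing
    -- half-pages at a spine, supplying a dirty end to a two-vertex class that loses its exemption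
    -- by growing, and doing the same for the bridge.
    record Settled : Set where
      field
        hubˣ : ¬ N.HasButterfly x → ∀ {w} → O.Spine x w → T (b' y w)
        hubʸ : ¬ N.HasButterfly x → ∀ {w} → O.Spine y w → T (b' x w)
        partnerˣ : ∀ {x'} → Partner x x' → NB.Dirty x ⊎ NB.Dirty x'
        partnerʸ : ∀ {y'} → Partner y y' → NB.Dirty y ⊎ NB.Dirty y'
        edge : NB.Dirty x ⊎ NB.Dirty y ⊎ (∀ z → L' z ≡ L' x → z ≡ x ⊎ z ≡ y)

    private
      syᵇ = λ {u v : Fin n} → Simple.sy (Position.simpleᵇ position) {u} {v}

      dirty⁺ : ∀ {u} → OB.Dirty u → NB.Dirty u
      dirty⁺ (z , l , h) = z , L'-cong l , keep h

      two⁺ : ∀ {u} → O.HasSpine u ⊎ O.HasButterfly u → N.HasSpine u ⊎ N.HasButterfly u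
      two⁺ (inj₁ (u , l , v , uv , p , q , pq , cp , cq)) =
        inj₁ (u , L'-cong l , v , old uv , p , q , pq , common⁺ cp , common⁺ cq)
      two⁺ (inj₂ h) = inj₂ (butterfly⁺ h)

    settled-good : Settled → NB.Good
    settled-good st = record { dirty = dirty' ; budget = budget' ; blocked = blocked' ; open-pair = open' }
      where
      open Settled st
      OrSmall : Fin n → Fin n → Set
      OrSmall u v = NB.Dirty u ⊎ NB.Dirty v ⊎ (∀ z → L' z ≡ L' u → z ≡ u ⊎ z ≡ v) ⊎ N.HasSpine u ⊎ N.HasButterfly u

      small : ∀ {u v} → T (c u v) → (∀ z → L z ≡ L u → z ≡ u ⊎ z ≡ v) → OrSmall u v
      small {u} {v} uv f = go (L u ≟ᶠ L x) (L u ≟ᶠ L y)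
        where
        go : Dec (L u ≡ L x) → Dec (L u ≡ L y) → OrSmall u v
        go (yes l) _ with f x (sym l)
        ... | inj₁ refl = Sum.map₂ inj₁ (partnerˣ (uv , f))
        ... | inj₂ refl = [ inj₂ ∘ inj₁ , inj₁ ]′ (partnerˣ (Sc.sy uv , λ z lz → Sum.swap (f z (trans lz (sym l)))))
        go (no _) (yes l) with f y (sym l)
        ... | inj₁ refl = Sum.map₂ inj₁ (partnerʸ (uv , f))
        ... | inj₂ refl = [ inj₂ ∘ inj₁ , inj₁ ]′ (partnerʸ (Sc.sy uv , λ z lz → Sum.swap (f z (trans lz (sym l)))))
        go (no nx) (no ny) = inj₂ (inj₂ (inj₁ λ z lz →
          [ f z , [ (λ h → ⊥-elim (ny (proj₂ h))) , (λ h → ⊥-elim (nx (proj₂ h))) ]′ ]′ (L'⁻ lz)))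

      dirty' : ∀ {u v} → T (c' u v) → OrSmall u v
      dirty' e with only e
      ... | inj₂ (inj₁ (refl , refl)) = Sum.map₂ (Sum.map₂ inj₁) edge
      ... | inj₂ (inj₂ (refl , refl)) = [ inj₂ ∘ inj₁ , [ inj₁ , (λ f → inj₂ (inj₂ (inj₁ λ z l → Sum.swap (f z (trans l L'-joined))))) ]′ ]′ edge
      ... | inj₁ uv with dirty uv
      ...   | inj₁ d = inj₁ (dirty⁺ d)
      ...   | inj₂ (inj₁ d) = inj₂ (inj₁ (dirty⁺ d))
      ...   | inj₂ (inj₂ (inj₁ f)) = small uv f
      ...   | inj₂ (inj₂ (inj₂ h)) = inj₂ (inj₂ (inj₂ (two⁺ h)))

      spine-old : ∀ {u v} → N.Spine u v → O.Spine u v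
      spine-old (uv , p , q , pq , cp , cq) = let uv' , cp' = tri-old (uv , cp) in
        uv' , p , q , pq , cp' , proj₂ (tri-old (uv , cq))

      spine-flip : ∀ {u v} → O.Spine u v → O.Spine v u
      spine-flip (uv , p , q , pq , cp , cq) = Sc.sy uv , p , q , pq , swapˣ cp , swapˣ cq

      budget' : ∀ {u v} → N.Spine u v → N.HasButterfly u ⊎ NB.Budget u v
      budget' {u} {v} s with N.hasButterfly? u
      ... | yes h = inj₁ h
      ... | no nb with budget (spine-old s)
      ...   | inj₁ h = inj₁ (butterfly⁺ h)
      ...   | inj₂ bd = inj₂ (≤-trans (+-mono-≤
                (*-monoʳ-≤ 2 (cnt-mono (λ z t → fromWitness (proj₂ (tri-old (proj₁ s , toWitness t)))) (allFin n)))
                (up2-mono (cnt-mono (λ z t → fromWitness (half (toWitness t))) (allFin n))))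
              (≤-trans bd (cnt-mono (λ z t → ==⁺ (L'-cong (==⁻ t))) (allFin n))))
        where
        s' = spine-old s
        uv = proj₁ s'
        ¬bx : ∀ {w} → L' w ≡ L' u → L' w ≡ L' x → ¬ N.HasButterfly x
        ¬bx e e' h = nb (butterfly-at (trans (sym e') e) h)
        half : ∀ {z} → NB.Half u v z → OB.Half u v z
        half (zu , zv , inj₁ (uz , ¬vz , ¬b')) with only uz
        ... | inj₁ h = zu , zv , inj₁ (h , ¬vz ∘ old , ¬b' ∘ keep)
        ... | inj₂ (inj₁ (refl , refl)) = ⊥-elim (¬b' (syᵇ (hubˣ (¬bx refl refl) s')))
        ... | inj₂ (inj₂ (refl , refl)) = ⊥-elim (¬b' (syᵇ (hubʸ (¬bx refl L'-joined) s')))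
        half (zu , zv , inj₂ (vz , ¬uz , ¬b')) with only vz
        ... | inj₁ h = zu , zv , inj₂ (h , ¬uz ∘ old , ¬b' ∘ keep)
        ... | inj₂ (inj₁ (refl , refl)) = ⊥-elim (¬b' (syᵇ (hubˣ (¬bx (L'-cong (sym (lab uv))) refl) (spine-flip s'))))
        ... | inj₂ (inj₂ (refl , refl)) = ⊥-elim (¬b' (syᵇ (hubʸ (¬bx (L'-cong (sym (lab uv))) L'-joined) (spine-flip s'))))

      blocked' : ∀ {u v p q} → T (c' u v) → p ≢ q → N.Common u v p → N.Common u v q →
        N.HasButterfly u ⊎ T (b' p q) ⊎ ∃[ r ] r ≢ p × r ≢ q × N.Common u v r
      blocked' uv p≢q cp cq = let uv' , cp' = tri-old (uv , cp) in
        Sum.map butterfly⁺ (Sum.map keep (λ { (r , rp , rq , cr) → r , rp , rq , common⁺ cr }))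
          (blocked uv' p≢q cp' (proj₂ (tri-old (uv , cq))))

      open' : ∀ {u v p q} → u ≢ v → ¬ T (c' u v) → ¬ T (b' u v) → p ≢ q → N.Common u v p → N.Common u v q →
        N.HasTriangle u ⊎ (T (b' p q) × ∀ {r} → N.Common u v r → r ≡ p ⊎ r ≡ q)
      open' {u} {v} {p} {q} u≢v ¬c' ¬b' p≢q cp cq =
        Sum.map triangle⁺ (λ { (h , ex) → keep h , λ {r} cr → ex (co cr) })
          (open-pair u≢v (¬c' ∘ old) (¬b' ∘ keep) p≢q (cycle-old u≢v p≢q cp cq) (cycle-old u≢v (p≢q ∘ sym) cq cp))
        where
        co : ∀ {r} → N.Common u v r → O.Common u v r
        co {r} cr with r ≟ᶠ p
        ... | yes refl = cycle-old u≢v p≢q cr cq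
        ... | no ne = cycle-old u≢v ne cr cp

    -- A single pair fulfils all duties. Blocking a neighbour `x'` of `x` from `y` makes both `x'`
    -- and `y` dirty; with `x'` the other end of a spine at `x`, it also closes the half-page `y`.
    settled-x : ∀ {x'} → T (c x x') → T (b' x' y) →
      (¬ N.HasButterfly x → ∀ {w} → O.Spine x w → T (b' y w)) →
      (¬ N.HasButterfly x → ∀ {w} → O.Spine y w → T (b' x w)) → Settled
    settled-x {x'} xx' k hx hy = record
      { hubˣ = hx ; hubʸ = hy
      ; partnerˣ = λ { (xx″ , f) → inj₂ (y , trans L'-joined (L'-cong (lab xx″)) , subst (λ z → T (b' z y)) (only-x f) k) }
      ; partnerʸ = λ _ → inj₁ dy
      ; edge = inj₂ (inj₁ dy) }
      where
      dy : NB.Dirty y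
      dy = x' , trans (L'-cong (sym (lab xx'))) (sym L'-joined) , syᵇ k
      only-x : ∀ {x″} → (∀ z → L z ≡ L x → z ≡ x ⊎ z ≡ x″) → x' ≡ x″
      only-x f = [ (λ e → ⊥-elim (Sc.~≢ xx' (sym e))) , (λ e → e) ]′ (f x' (sym (lab xx')))

    settled-y : ∀ {y'} → T (c y y') → T (b' y' x) →
      (¬ N.HasButterfly x → ∀ {w} → O.Spine x w → T (b' y w)) →
      (¬ N.HasButterfly x → ∀ {w} → O.Spine y w → T (b' x w)) → Settled
    settled-y {y'} yy' k hx hy = record
      { hubˣ = hx ; hubʸ = hy
      ; partnerˣ = λ _ → inj₁ dx
      ; partnerʸ = λ { (yy″ , f) → inj₂ (x , trans (sym L'-joined) (L'-cong (lab yy″)) , subst (λ z → T (b' z x)) (only-y f) k) }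
      ; edge = inj₁ dx }
      where
      dx : NB.Dirty x
      dx = y' , trans (L'-cong (sym (lab yy'))) L'-joined , syᵇ k
      only-y : ∀ {y″} → (∀ z → L z ≡ L y → z ≡ y ⊎ z ≡ y″) → y' ≡ y″
      only-y f = [ (λ e → ⊥-elim (Sc.~≢ yy' (sym e))) , (λ e → e) ]′ (f y' (sym (lab yy')))

    settled-isolated : Isolated x → Isolated y → Settled
    settled-isolated ix iy = record
      { hubˣ = λ _ s → ⊥-elim (ix (proj₁ s)) ; hubʸ = λ _ s → ⊥-elim (iy (proj₁ s))
      ; partnerˣ = λ p → ⊥-elim (ix (proj₁ p)) ; partnerʸ = λ p → ⊥-elim (iy (proj₁ p))
      ; edge = inj₂ (inj₂ λ z l → Sum.map (alone ix) (alone iy) (in-joined l)) }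

  -- Two isolated vertices form an exempt class and require no answer. Otherwise the pair crosses
  -- between the old classes, so it is a new blocked pair for the edge count of the union.
  Outcome : Set
  Outcome = (Isolated x × Isolated y × ∀ {b'} → Extends c' b b' → Blocked.Good c' b' L') ⊎
    ∃[ f ] ∃[ g ] f ≢ g × ((L f ≡ L x × L g ≡ L y) ⊎ (L f ≡ L y × L g ≡ L x)) × ¬ T (c' f g) ×
      (∀ {b'} → Extends c' b b' → T (b' f g) → Blocked.Good c' b' L')

  private
    not-joined : ∀ {x'} → T (c x x') → ¬ T (c' x' y)
    not-joined xx' e = no-common (old xx') (S′.sy e)

    not-joined′ : ∀ {y'} → T (c y y') → ¬ T (c' y' x)
    not-joined′ yy' e = no-common (S′.sy e) (old yy')

    apart : ∀ {u v} → L u ≡ L x → L v ≡ L y → u ≢ v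
    apart lu lv refl = lx≢ly (trans (sym lu) lv)

    -- Triangles of different old classes are disjoint, which is impossible in the joined class.
    -- Hence at most one end of the bridge lies on a spine.
    apart-tri : ∀ {u v w p q r} → L u ≡ L x → L p ≡ L y → O.Tri u v w → O.Tri p q r → ⊥
    apart-tri {u} {v} {w} {p} {q} {r} lu lp t@(uv , uw , _) t'@(pq , pr , _) = NS.no-disjoint (tri⁺ t) (tri⁺ t')
        (trans (joinʸ lp) (sym (joinˣ lu))) (off lp) (off (trans (sym (lab pq)) lp)) (off (trans (sym (lab pr)) lp))
      where
      off : ∀ {z} → L z ≡ L y → ¬ N.In z u v w
      off lz (inj₁ refl) = apart lu lz refl
      off lz (inj₂ (inj₁ refl)) = apart (trans (sym (lab uv)) lu) lz refl
      off lz (inj₂ (inj₂ refl)) = apart (trans (sym (lab uw)) lu) lz refl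

    spine-apart : ∀ {w w'} → O.Spine x w → O.Spine y w' → ⊥
    spine-apart (xw , p , _ , _ , cp , _) (yw , q , _ , _ , cq , _) = apart-tri refl refl (xw , cp) (yw , cq)

    unique : ∀ {x w w'} → ¬ O.HasButterfly x → O.Spine x w → O.Spine x w' → w' ≡ w
    unique nb s s' = [ proj₂ , (λ h → ⊥-elim (Sc.~≢ (proj₁ s) (proj₁ h))) ]′
      (OS.same-spine (Sc.~≢ (proj₁ s)) (OB.through-spine P C free G nb refl s) refl s')

  reply : Outcome
  reply with any? (O.spine? x) | any? (O.spine? y)
  ... | yes (w , s) | _ = inj₂ (w , y , apart (sym (lab (proj₁ s))) refl , inj₁ (sym (lab (proj₁ s)) , refl) , not-joined (proj₁ s) ,
        λ {b'} ext k → settled-good ext (settled-x ext (proj₁ s) k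
          (λ nb s' → subst (λ z → T (b' y z)) (sym (unique (nb ∘ butterfly⁺) s s')) (Simple.sy (Position.simpleᵇ (Extends.position ext)) k))
          (λ _ s' → ⊥-elim (spine-apart s s'))))
  ... | no nx | yes (w , s) = inj₂ (w , x , apart refl (sym (lab (proj₁ s))) ∘ sym , inj₂ (sym (lab (proj₁ s)) , refl) , not-joined′ (proj₁ s) ,
        λ {b'} ext k → settled-good ext (settled-y ext (proj₁ s) k (λ _ s' → ⊥-elim (nx (_ , s')))
          (λ nb s' → subst (λ z → T (b' x z)) (sym (unique (λ h → nb (butterfly-at L'-joined (butterfly⁺ h))) s s'))
            (Simple.sy (Position.simpleᵇ (Extends.position ext)) k))))
  ... | no nx | no ny with any? (λ z → T? (c x z)) | any? (λ z → T? (c y z))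
  ...   | yes (x' , xx') | _ = inj₂ (x' , y , apart (sym (lab xx')) refl , inj₁ (sym (lab xx') , refl) , not-joined xx' ,
        λ ext k → settled-good ext (settled-x ext xx' k (λ _ s → ⊥-elim (nx (_ , s))) (λ _ s → ⊥-elim (ny (_ , s)))))
  ...   | no _ | yes (y' , yy') = inj₂ (y' , x , apart refl (sym (lab yy')) ∘ sym , inj₂ (sym (lab yy') , refl) , not-joined′ yy' ,
        λ ext k → settled-good ext (settled-y ext yy' k (λ _ s → ⊥-elim (nx (_ , s))) (λ _ s → ⊥-elim (ny (_ , s)))))
  ...   | no ix | no iy = inj₁ ((λ h → ix (_ , h)) , (λ h → iy (_ , h)) ,
        λ ext → settled-good ext (settled-isolated ext (λ h → ix (_ , h)) (λ h → iy (_ , h))))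

-- Small components

module Edges {n : ℕ} (L : Fin n → Fin n) where
  inClass : Fin n → Fin n → Bool
  inClass s z = L z == L s

  inside : Adj n → Fin n → Fin n × Fin n → Bool
  inside f s (a , b) = f a b ∧ both (inClass s) (a , b)

  edges : Adj n → Fin n → ℕ
  edges f s = P# (inside f s)

  order : Fin n → ℕ
  order s = V# (inClass s)

  inside⁺ : ∀ {f s a b} → T (f a b) → L a ≡ L s → L b ≡ L s → T (inside f s (a , b))
  inside⁺ {f} {s} {a} e la lb = ∧⁺ e (∧⁺ {L a == L s} (==⁺ la) (==⁺ lb))

  inside⁻ : ∀ {f s a b} → T (inside f s (a , b)) → T (f a b) × L a ≡ L s × L b ≡ L s
  inside⁻ {f} {s} {a} {b} t = let p , q = ∧⁻ {f a b} t ; q₁ , q₂ = ∧⁻ {L a == L s} q in p , ==⁻ q₁ , ==⁻ q₂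

  order-cong : ∀ {s t} → L s ≡ L t → order s ≡ order t
  order-cong e = cnt-≗ (λ z → cong (L z ==_) e) (allFin n)

  edges-cong : ∀ {s t} f → L s ≡ L t → edges f s ≡ edges f t
  edges-cong f e = cnt-≗ (λ { (a , b) → cong (λ l → f a b ∧ ((L a == l) ∧ (L b == l))) e }) (pairs (allFin n))

  edges-mono : ∀ {f f'} s → (∀ {u v} → T (f u v) → L u ≡ L s → T (f' u v)) → edges f s ≤ edges f' s
  edges-mono {f} {f'} s h = cnt-mono (λ { (a , b) t → let e , la , lb = inside⁻ {f} {s} {a} t in
    inside⁺ {f'} {s} {a} (h e la) la lb }) (pairs (allFin n))

  edges-add≤ : ∀ {f f' x y} s → Adds f x y f' → edges f' s ≤ suc (edges f s)
  edges-add≤ {f} {f'} {x} {y} s ad = ≤-trans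
    (cnt-∪ {p = isPair x y} (λ { (a , b) t → split a b (inside⁻ {f'} {s} {a} t) }) (pairs (allFin n)))
    (+-monoˡ-≤ (edges f s) (P#-point≤1 x y))
    where
    split : ∀ a b → T (f' a b) × L a ≡ L s × L b ≡ L s → T (isPair x y (a , b)) ⊎ T (inside f s (a , b))
    split a b (e , la , lb) with Adds.only ad e
    ... | inj₁ h = inj₂ (inside⁺ {f} {s} {a} h la lb)
    ... | inj₂ (inj₁ (refl , refl)) = inj₁ (isPairˡ x y)
    ... | inj₂ (inj₂ (refl , refl)) = inj₁ (isPairʳ x y)

  edges-add≥ : ∀ {f f' x y} s → Simple f → Simple f' → Adds f x y f' → x ≢ y → ¬ T (f x y) → L x ≡ L s → L y ≡ L s →
    suc (edges f s) ≤ edges f' s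
  edges-add≥ {f} {f'} {x} {y} s sf sf' ad ne nf lx ly = ≤-trans (+-monoˡ-≤ (edges f s) (P#-point ne))
    (cnt-⊎ {p = isPair x y} {r = inside f' s} disjoint new'
      (λ { (a , b) t → let e , la , lb = inside⁻ {f} {s} {a} t in inside⁺ {f'} {s} {a} (Adds.old ad e) la lb }) (pairs (allFin n)))
    where
    disjoint : ∀ ab → T (isPair x y ab) → T (inside f s ab) → ⊥
    disjoint (a , b) t t' with isPair⁻ {x = x} {y} {a} {b} t
    ... | inj₁ (refl , refl) = nf (proj₁ (inside⁻ {f} {s} {a} t'))
    ... | inj₂ (refl , refl) = nf (Simple.sy sf (proj₁ (inside⁻ {f} {s} {a} t')))
    new' : ∀ ab → T (isPair x y ab) → T (inside f' s ab)
    new' (a , b) t with isPair⁻ {x = x} {y} {a} {b} t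
    ... | inj₁ (refl , refl) = inside⁺ {f'} {s} {a} (Adds.new ad) lx ly
    ... | inj₂ (refl , refl) = inside⁺ {f'} {s} {a} (Simple.sy sf' (Adds.new ad)) ly lx

  slots : Fin n → ℕ
  slots s = P# (both (inClass s))

  edges-disjoint : ∀ {c b} s → (∀ {u v} → T (c u v) → T (b u v) → ⊥) → edges c s + edges b s ≤ slots s
  edges-disjoint {c} {b} s d = cnt-⊎ {p = inside c s} {q = inside b s}
    (λ { (u , v) t t' → d (proj₁ (∧⁻ {c u v} t)) (proj₁ (∧⁻ {b u v} t')) })
    (λ { (u , v) t → proj₂ (∧⁻ {c u v} t) }) (λ { (u , v) t → proj₂ (∧⁻ {b u v} t) }) (pairs (allFin n))

  edges-full : ∀ {c b} s → (∀ {u v} → u ≢ v → L u ≡ L s → L v ≡ L s → T (c u v) ⊎ T (b u v)) →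
    slots s ≤ edges c s + edges b s
  edges-full {c} {b} s f = cnt-∪∈ {p = inside c s} {q = inside b s} (pairs (allFin n)) λ { {u , v} i t →
      let lu , lv = ∧⁻ {L u == L s} t in
      Sum.map (λ e → inside⁺ {c} {s} {u} e (==⁻ lu) (==⁻ lv)) (λ e → inside⁺ {b} {s} {u} e (==⁻ lu) (==⁻ lv))
        (f (All.lookup (pairs-distinct (allFin⁺ n)) i) (==⁻ lu) (==⁻ lv)) }

-- Every reply inside a class keeps this, and it caps the final number of edges on five vertices at six.
Sparse : {n : ℕ} → Adj n → Adj n → (Fin n → Fin n) → Set
Sparse c b L = ∀ s → order s ≤ 5 → 2 * edges c s ≤ 2 * edges b s + order s
  where open Edges L

private
  cancel : ∀ e b P k → e + b ≡ P → 2 * P ≤ 4 * b + k → 2 * e ≤ 2 * b + k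
  cancel e b P k refl h = +-cancelʳ-≤ (2 * b) (2 * e) (2 * b + k)
    (≤-trans (≤-reflexive (l e b)) (≤-trans h (≤-reflexive (r b k))))
    where
    l : ∀ e b → 2 * e + 2 * b ≡ 2 * (e + b)
    l = solve-∀
    r : ∀ b k → 4 * b + k ≡ 2 * b + k + 2 * b
    r = solve-∀

  uncancel : ∀ e b P k → e + b ≡ P → 2 * e ≤ 2 * b + k → 2 * P ≤ 4 * b + k
  uncancel e b P k refl h = ≤-trans (≤-reflexive (l e b)) (≤-trans (+-monoˡ-≤ (2 * b) h) (≤-reflexive (r b k)))
    where
    l : ∀ e b → 2 * (e + b) ≡ 2 * e + 2 * b
    l = solve-∀
    r : ∀ b k → 2 * b + k + 2 * b ≡ 4 * b + k
    r = solve-∀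

  -- The slack of 2 disappears modulo 4: 4b + v + 1 and 4b + v + 2 are never v² - v for v ≤ 5.
  drop-slack : ∀ v b P → v ≤ 5 → 2 * P + v ≡ v * v → 2 * P ≤ 4 * b + (v + 2) → 2 * P ≤ 4 * b + v
  drop-slack 0 b P _ h _ = ≤-trans (≤-reflexive (+-cancelʳ-≡ 0 (2 * P) 0 h)) z≤n
  drop-slack 1 b P _ h _ = ≤-trans (≤-reflexive (+-cancelʳ-≡ 1 (2 * P) 0 h)) z≤n
  drop-slack 2 b P _ h _ = ≤-trans (≤-reflexive (+-cancelʳ-≡ 2 (2 * P) 2 h)) (m≤n+m 2 (4 * b))
  drop-slack 3 b P _ h le with +-cancelʳ-≡ 3 (2 * P) 6 h
  drop-slack 3 zero P _ h le | e = ⊥-elim (<⇒≱ {5} {6} ≤-refl (subst (_≤ 5) e le))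
  drop-slack 3 (suc b) P _ h le | e = ≤-trans (≤-reflexive e) (≤-trans (m≤m+n 6 1) (+-monoˡ-≤ 3 (*-monoʳ-≤ 4 {1} {suc b} (s≤s z≤n))))
  drop-slack 4 b P _ h le with +-cancelʳ-≡ 4 (2 * P) 12 h
  drop-slack 4 zero P _ h le | e = ⊥-elim (<⇒≱ {6} {12} (m≤m+n 7 5) (subst (_≤ 6) e le))
  drop-slack 4 (suc zero) P _ h le | e = ⊥-elim (<⇒≱ {10} {12} (m≤m+n 11 1) (subst (_≤ 10) e le))
  drop-slack 4 (suc (suc b)) P _ h le | e = ≤-trans (≤-reflexive e) (+-monoˡ-≤ 4 (*-monoʳ-≤ 4 {2} {suc (suc b)} (s≤s (s≤s z≤n))))
  drop-slack 5 b P _ h le with +-cancelʳ-≡ 5 (2 * P) 20 h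
  drop-slack 5 0 P _ h le | e = ⊥-elim (<⇒≱ {7} {20} (m≤m+n 8 12) (subst (_≤ 7) e le))
  drop-slack 5 1 P _ h le | e = ⊥-elim (<⇒≱ {11} {20} (m≤m+n 12 8) (subst (_≤ 11) e le))
  drop-slack 5 2 P _ h le | e = ⊥-elim (<⇒≱ {15} {20} (m≤m+n 16 4) (subst (_≤ 15) e le))
  drop-slack 5 3 P _ h le | e = ⊥-elim (<⇒≱ {19} {20} ≤-refl (subst (_≤ 19) e le))
  drop-slack 5 (suc (suc (suc (suc b)))) P _ h le | e = ≤-trans (≤-reflexive e) (≤-trans (m≤m+n 20 1)
    (+-monoˡ-≤ 5 (*-monoʳ-≤ 4 {4} {suc (suc (suc (suc b)))} (s≤s (s≤s (s≤s (s≤s z≤n)))))))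
  drop-slack (suc (suc (suc (suc (suc (suc v)))))) b P (s≤s (s≤s (s≤s (s≤s (s≤s ()))))) _ _

  one-more : ∀ {e e' b v} → e' ≤ suc e → 2 * e ≤ 2 * b + v → 2 * e' ≤ 2 * b + (v + 2)
  one-more {e} {e'} {b} {v} h k = ≤-trans (*-monoʳ-≤ 2 h) (≤-trans (≤-reflexive (l e))
    (≤-trans (+-monoˡ-≤ 2 k) (≤-reflexive (+-assoc (2 * b) v 2))))
    where
    l : ∀ e → 2 * suc e ≡ 2 * e + 2
    l = solve-∀

  both-more : ∀ {e e' b b' v} → e' ≤ suc e → suc b ≤ b' → 2 * e ≤ 2 * b + v → 2 * e' ≤ 2 * b' + v
  both-more {e} {e'} {b} {b'} {v} h k i = ≤-trans (*-monoʳ-≤ 2 h) (≤-trans (≤-reflexive (l e))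
    (≤-trans (+-monoʳ-≤ 2 i) (≤-trans (≤-reflexive (r b v)) (+-monoˡ-≤ v (*-monoʳ-≤ 2 k)))))
    where
    l : ∀ e → 2 * suc e ≡ 2 + 2 * e
    l = solve-∀
    r : ∀ b v → 2 + (2 * b + v) ≡ 2 * suc b + v
    r = solve-∀

  merged : ∀ {e₁ e₂ e' b₁ b₂ b' v₁ v₂ v'} → e' ≤ suc (e₁ + e₂) → suc (b₁ + b₂) ≤ b' → v₁ + v₂ ≤ v' →
    2 * e₁ ≤ 2 * b₁ + v₁ → 2 * e₂ ≤ 2 * b₂ + v₂ → 2 * e' ≤ 2 * b' + v'
  merged {e₁} {e₂} {e'} {b₁} {b₂} {b'} {v₁} {v₂} {v'} h k j i₁ i₂ = both-more {e₁ + e₂} {e'} {b₁ + b₂} {b'} h k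
    (≤-trans (≤-reflexive (*-distribˡ-+ 2 e₁ e₂)) (≤-trans (+-mono-≤ i₁ i₂)
      (≤-trans (≤-reflexive (r b₁ b₂ v₁ v₂)) (+-monoʳ-≤ (2 * (b₁ + b₂)) j))))
    where
    r : ∀ b₁ b₂ v₁ v₂ → (2 * b₁ + v₁) + (2 * b₂ + v₂) ≡ 2 * (b₁ + b₂) + (v₁ + v₂)
    r = solve-∀

record Invariant {n : ℕ} (c b : Adj n) : Set where
  field
    L : Fin n → Fin n
    classes : Shape.Classes c L
    good : Blocked.Good c b L
    sparse : Sparse c b L

Answer : {n : ℕ} → Adj n → Adj n → Set
Answer c' b = Invariant c' b ⊎ ∃[ f ] ∃[ g ] f ≢ g × ¬ T (c' f g) × ¬ T (b f g) ×
  (∀ {b'} → Adds b f g b' → Position c' b' → Invariant c' b')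

module Respond {n : ℕ} {c b c' : Adj n} (P : Position c b) (I : Invariant c b)
  {x y : Fin n} (x≢y : x ≢ y) (¬c : ¬ T (c x y)) (¬b : ¬ T (b x y)) (adds : Adds c x y c')
  (P' : Position c' b) (free' : P6Free c') where

  open Invariant I
  open Adds adds
  private S' = Position.simple P'

  grow : ∀ {f g b'} → Adds b f g b' → Position c' b' → Extends c' b b'
  grow a p = record { position = p ; keep = Adds.old a }

  stay : Extends c' b b
  stay = record { position = P' ; keep = λ h → h }

  module Within (same : L x ≡ L y) where
    open Edges L
    module I = Internal P classes good S' free'

    move : I.Move x y
    move = record { x≢y = x≢y ; ¬c = ¬c ; ¬b = ¬b ; same = same ; adds = adds }

    C' : Shape.Classes c' L
    C' = I.Step.C' move

    elsewhere : ∀ {b'} → (∀ {u v} → T (b u v) → T (b' u v)) → ∀ s → L s ≢ L x → order s ≤ 5 →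
      2 * edges c' s ≤ 2 * edges b' s + order s
    elsewhere {b'} keep s ne h = ≤-trans
      (*-monoʳ-≤ 2 (edges-mono {c'} {c} s λ e l → I.Step.old-class move e λ l' → ne (trans (sym l) l')))
      (≤-trans (sparse s h) (+-monoˡ-≤ (order s) (*-monoʳ-≤ 2 (edges-mono {b} {b'} s λ e _ → keep e))))

    replied : ∀ {f g b'} → f ≢ g → L f ≡ L x → L g ≡ L x → ¬ T (b f g) → Adds b f g b' → Position c' b' → Sparse c' b' L
    replied {b' = b'} f≢g lf lg nb a p s h with L s ≟ᶠ L x
    ... | no ne = elsewhere (Adds.old a) s ne h
    ... | yes l = both-more {b' = edges b' s} (edges-add≤ s adds)
            (edges-add≥ s (Position.simpleᵇ P) (Position.simpleᵇ p) a f≢g nb (trans lf (sym l)) (trans lg (sym l))) (sparse s h)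

    -- The case in which Blocker cannot answer inside the class. Constructor's extra edge costs a
    -- slack of 2, but now `e + b` is the number of all pairs, and the congruence in `drop-slack`
    -- removes that slack.
    full : (∀ {u v} → u ≢ v → L u ≡ L x → L v ≡ L x → T (c' u v) ⊎ T (b u v)) → Sparse c' b L
    full f s h with L s ≟ᶠ L x
    ... | no ne = elsewhere (λ e → e) s ne h
    ... | yes l = cancel (edges c' s) (edges b s) (slots s) (order s) eq (drop-slack (order s) (edges b s) (slots s) h (cnt-both (inClass s) (allFin n))
            (uncancel (edges c' s) (edges b s) _ (order s + 2) eq (one-more {b = edges b s} (edges-add≤ s adds) (sparse s h))))
      where
      eq : edges c' s + edges b s ≡ slots s
      eq = ≤-antisym (edges-disjoint {c'} {b} s (Position.disj P'))
        (edges-full s λ ne lu lv → f ne (trans lu l) (trans lv l))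

    -- Even if `Good` demands no particular pair, the reply is spent inside the class, since
    -- `Sparse` charges every edge of Constructor to one of Blocker.
    wherever : (∀ {b'} → Extends c' b b' → Blocked.Good c' b' L) → Answer c' b
    wherever gd with any? (λ f → any? (λ g → ¬? (f ≟ᶠ g) ×-dec (L f ≟ᶠ L x) ×-dec (L g ≟ᶠ L x) ×-dec ¬? (T? (c' f g)) ×-dec ¬? (T? (b f g))))
    ... | yes (f , g , f≢g , lf , lg , ¬cf , ¬bf) = inj₂ (f , g , f≢g , ¬cf , ¬bf , λ a p →
            record { L = L ; classes = C' ; good = gd (grow a p) ; sparse = replied f≢g lf lg ¬bf a p })
    ... | no none = inj₁ (record { L = L ; classes = C' ; good = gd stay ; sparse = full λ {u} {v} ne lu lv → taken ne lu lv (T? (c' u v)) (T? (b u v)) })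
      where
      taken : ∀ {u v} → u ≢ v → L u ≡ L x → L v ≡ L x → Dec (T (c' u v)) → Dec (T (b u v)) → T (c' u v) ⊎ T (b u v)
      taken _ _ _ (yes h) _ = inj₁ h
      taken _ _ _ (no _) (yes h) = inj₂ h
      taken ne lu lv (no h) (no k) = ⊥-elim (none (_ , _ , ne , lu , lv , h , k))

    answer : Answer c' b
    answer with I.reply move
    ... | inj₁ gd = wherever gd
    ... | inj₂ (f , g , f≢g , lf , lg , ¬cf , gd) with T? (b f g)
    ...   | yes h = wherever λ ext → gd ext (Extends.keep ext h)
    ...   | no ¬bf = inj₂ (f , g , f≢g , ¬cf , ¬bf , λ a p →
            record { L = L ; classes = C' ; good = gd (grow a p) (Adds.new a) ; sparse = replied f≢g lf lg ¬bf a p })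

  module Across (lx≢ly : L x ≢ L y) where
    module J = Join P classes good S' free' adds lx≢ly
    open J using (L'; L'-cong; L'-joined; L'⁻; in-joined; joinˣ; joinʸ)
    private
      module E = Edges L
      module E' = Edges L'

    order-joined : E.order x + E.order y ≤ E'.order x
    order-joined = cnt-⊎ (λ z t t' → lx≢ly (trans (sym (==⁻ t)) (==⁻ t')))
      (λ z t → ==⁺ (joinˣ (==⁻ t))) (λ z t → ==⁺ (joinʸ (==⁻ t))) (allFin n)

    edges-joined : E'.edges c' x ≤ suc (E.edges c x + E.edges c y)
    edges-joined = ≤-trans
      (cnt-∪ {p = isPair x y} {q = λ ab → E.inside c x ab ∨ E.inside c y ab} split (pairs (allFin n)))
      (+-mono-≤ (P#-point≤1 x y) (cnt-∪ (λ { (a , b) t → ∨⁻ {E.inside c x (a , b)} t }) (pairs (allFin n))))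
      where
      split : ∀ ab → T (E'.inside c' x ab) → T (isPair x y ab) ⊎ T (E.inside c x ab ∨ E.inside c y ab)
      split (a , b) t with E'.inside⁻ {c'} {x} {a} t
      ... | e , la , lb with only e
      ... | inj₂ (inj₁ (refl , refl)) = inj₁ (isPairˡ x y)
      ... | inj₂ (inj₂ (refl , refl)) = inj₁ (isPairʳ x y)
      ... | inj₁ h with in-joined la
      ...   | inj₁ l = inj₂ (∨⁺ˡ (E.inside c y (a , b)) (E.inside⁺ {c} {x} {a} h l (trans (sym (lab h)) l)))
        where open Shape.Classes classes
      ...   | inj₂ l = inj₂ (∨⁺ʳ (E.inside c x (a , b)) (E.inside⁺ {c} {y} {a} h l (trans (sym (lab h)) l)))
        where open Shape.Classes classes

    blocked-joined : ∀ {f g b'} → (L f ≡ L x × L g ≡ L y) ⊎ (L f ≡ L y × L g ≡ L x) → f ≢ g →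
      (∀ {u v} → T (b u v) → T (b' u v)) → T (b' f g) → Simple b' → suc (E.edges b x + E.edges b y) ≤ E'.edges b' x
    blocked-joined {f} {g} {b'} side f≢g keep k sb = ≤-trans
      (+-mono-≤ (P#-point f≢g) (cnt-⊎ {p = E.inside b x} {q = E.inside b y} {r = old'}
        (λ { (u , v) t t' → lx≢ly (trans (sym (proj₁ (proj₂ (E.inside⁻ {b} {x} {u} t)))) (proj₁ (proj₂ (E.inside⁻ {b} {y} {u} t')))) })
        (λ { (u , v) t → ∨⁺ˡ (E.inside b y (u , v)) t }) (λ { (u , v) t → ∨⁺ʳ (E.inside b x (u , v)) t }) (pairs (allFin n))))
      (cnt-⊎ {p = isPair f g} {q = old'} {r = E'.inside b' x} disjoint new' kept (pairs (allFin n)))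
      where
      old' : Fin n × Fin n → Bool
      old' ab = E.inside b x ab ∨ E.inside b y ab
      f∈ : L' f ≡ L' x
      f∈ = [ joinˣ ∘ proj₁ , joinʸ ∘ proj₁ ]′ side
      g∈ : L' g ≡ L' x
      g∈ = [ joinʸ ∘ proj₂ , joinˣ ∘ proj₂ ]′ side
      kept : ∀ ab → T (old' ab) → T (E'.inside b' x ab)
      kept (u , v) t with ∨⁻ {E.inside b x (u , v)} t
      ... | inj₁ h = let e , lu , lv = E.inside⁻ {b} {x} {u} h in E'.inside⁺ {b'} {x} {u} (keep e) (joinˣ lu) (joinˣ lv)
      ... | inj₂ h = let e , lu , lv = E.inside⁻ {b} {y} {u} h in E'.inside⁺ {b'} {x} {u} (keep e) (joinʸ lu) (joinʸ lv)
      new' : ∀ ab → T (isPair f g ab) → T (E'.inside b' x ab)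
      new' (u , v) t with isPair⁻ {x = f} {g} {u} {v} t
      ... | inj₁ (refl , refl) = E'.inside⁺ {b'} {x} {u} k f∈ g∈
      ... | inj₂ (refl , refl) = E'.inside⁺ {b'} {x} {u} (Simple.sy sb k) g∈ f∈
      lf≢lg : L f ≢ L g
      lf≢lg e = [ (λ { (p , q) → lx≢ly (trans (sym p) (trans e q)) }) , (λ { (p , q) → lx≢ly (trans (sym q) (trans (sym e) p)) }) ]′ side
      one-class : ∀ {u v} → T (old' (u , v)) → L u ≡ L v
      one-class {u} {v} t with ∨⁻ {E.inside b x (u , v)} t
      ... | inj₁ h = let _ , lu , lv = E.inside⁻ {b} {x} {u} h in trans lu (sym lv)
      ... | inj₂ h = let _ , lu , lv = E.inside⁻ {b} {y} {u} h in trans lu (sym lv)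
      disjoint : ∀ ab → T (isPair f g ab) → T (old' ab) → ⊥
      disjoint (u , v) t t' with isPair⁻ {x = f} {g} {u} {v} t
      ... | inj₁ (refl , refl) = lf≢lg (one-class t')
      ... | inj₂ (refl , refl) = lf≢lg (sym (one-class t'))

    elsewhere : ∀ {b'} → (∀ {u v} → T (b u v) → T (b' u v)) → ∀ s → L' s ≢ L' x → E'.order s ≤ 5 →
      2 * E'.edges c' s ≤ 2 * E'.edges b' s + E'.order s
    elsewhere {b'} keep s ne h = ≤-trans (*-monoʳ-≤ 2 c-less)
      (≤-trans (sparse s (≤-trans order≤ h)) (+-mono-≤ (*-monoʳ-≤ 2 b-more) order≤))
      where
      back : ∀ {u} → L' u ≡ L' s → L u ≡ L s
      back e = [ (λ l → l) , [ (λ p → ⊥-elim (ne (joinʸ (proj₂ p)))) , (λ p → ⊥-elim (ne (joinˣ (proj₂ p)))) ]′ ]′ (L'⁻ e)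
      order≤ : E.order s ≤ E'.order s
      order≤ = cnt-mono (λ z t → ==⁺ (L'-cong (==⁻ t))) (allFin n)
      c-less : E'.edges c' s ≤ E.edges c s
      c-less = cnt-mono (λ { (u , v) t → let e , lu , lv = E'.inside⁻ {c'} {s} {u} t in E.inside⁺ {c} {s} {u} (was lu e) (back lu) (back lv) }) (pairs (allFin n))
        where
        was : ∀ {u v} → L' u ≡ L' s → T (c' u v) → T (c u v)
        was lu e = [ (λ h → h) , [ (λ { (refl , refl) → ⊥-elim (ne (sym lu)) }) , (λ { (refl , refl) → ⊥-elim (ne (trans (sym lu) L'-joined)) }) ]′ ]′ (only e)
      b-more : E.edges b s ≤ E'.edges b' s
      b-more = cnt-mono (λ { (u , v) t → let e , lu , lv = E.inside⁻ {b} {s} {u} t in E'.inside⁺ {b'} {s} {u} (keep e) (L'-cong lu) (L'-cong lv) }) (pairs (allFin n))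

    everywhere : ∀ {b'} → (∀ {u v} → T (b u v) → T (b' u v)) →
      (E'.order x ≤ 5 → 2 * E'.edges c' x ≤ 2 * E'.edges b' x + E'.order x) → Sparse c' b' L'
    everywhere {b'} keep at-x s h with L' s ≟ᶠ L' x
    ... | no ne = elsewhere keep s ne h
    ... | yes l rewrite E'.order-cong l | E'.edges-cong c' l | E'.edges-cong b' l = at-x h

    joined : ∀ {f g b'} → (L f ≡ L x × L g ≡ L y) ⊎ (L f ≡ L y × L g ≡ L x) → f ≢ g → Extends c' b b' → T (b' f g) → Sparse c' b' L'
    joined {b' = b'} side f≢g ext k = everywhere (Extends.keep ext) λ h →
      merged {E.edges c x} {E.edges c y} {E'.edges c' x} {E.edges b x} {E.edges b y} {E'.edges b' x} {E.order x} {E.order y}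
        edges-joined (blocked-joined side f≢g (Extends.keep ext) k (Position.simpleᵇ (Extends.position ext))) order-joined
        (sparse x (≤-trans (m≤m+n _ _) (≤-trans order-joined h))) (sparse y (≤-trans (m≤n+m _ _) (≤-trans order-joined h)))

    -- One edge on two vertices: the term `order` in `Sparse` pays for this unanswered edge.
    isolated-joined : J.Isolated x → J.Isolated y → Sparse c' b L'
    isolated-joined ix iy = everywhere (λ h → h) λ _ → ≤-trans (*-monoʳ-≤ 2 one) (≤-trans two (m≤n+m _ _))
      where
      none : ∀ s → J.Isolated s → E.edges c s ≡ 0
      none s iso = cnt-≡0 (λ { (u , v) t → let e , lu , lv = E.inside⁻ {c} {s} {u} t in
        iso (subst (λ w → T (c w v)) (J.alone iso lu) e) }) (pairs (allFin n))
      one : E'.edges c' x ≤ 1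
      one = ≤-trans edges-joined (≤-reflexive (cong suc (cong₂ _+_ (none x ix) (none y iy))))
      two : 2 ≤ E'.order x
      two = ≤-trans (+-mono-≤ (V#-unique {p = E.inClass x} {xs = x ∷ []} ([] ∷ []) (==⁺ refl ∷ []))
        (V#-unique {p = E.inClass y} {xs = y ∷ []} ([] ∷ []) (==⁺ refl ∷ []))) order-joined

    answer : Answer c' b
    answer with J.reply
    ... | inj₁ (ix , iy , gd) = inj₁ (record { L = L' ; classes = J.C' ; good = gd stay ; sparse = isolated-joined ix iy })
    ... | inj₂ (f , g , f≢g , side , ¬cf , gd) with T? (b f g)
    ...   | yes h = inj₁ (record { L = L' ; classes = J.C' ; good = gd stay h ; sparse = joined side f≢g stay h })
    ...   | no ¬bf = inj₂ (f , g , f≢g , ¬cf , ¬bf , λ a p →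
            record { L = L' ; classes = J.C' ; good = gd (grow a p) (Adds.new a) ; sparse = joined side f≢g (grow a p) (Adds.new a) })

  respond : Answer c' b
  respond with L x ≟ᶠ L y
  ... | yes same = Within.answer same
  ... | no ne = Across.answer ne

module _ {n : ℕ} {c b b' : Adj n} (ext : Extends c b b') where
  open Extends ext

  -- Blocker is not allowed to pass. Additional edges of his never harm him, so any move is safe
  -- where no reply is prescribed.
  good-mono : ∀ {L} → Blocked.Good c b L → Blocked.Good c b' L
  good-mono {L} G = record
    { dirty = λ e → Sum.map more (Sum.map₁ more) (dirty e)
    ; budget = λ s → Sum.map₂ (≤-trans (+-monoʳ-≤ _ (up2-mono
        (cnt-mono (λ z t → fromWitness (half (toWitness t))) (allFin n))))) (budget s)
    ; blocked = λ uv pq cp cq → Sum.map₂ (Sum.map₁ keep) (blocked uv pq cp cq)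
    ; open-pair = λ uv nc nb pq cp cq → Sum.map₂ (λ { (k , ex) → keep k , ex }) (open-pair uv nc (nb ∘ keep) pq cp cq) }
    where
    open Blocked.Good G
    more : ∀ {x} → Blocked.Dirty c b L x → Blocked.Dirty c b' L x
    more (z , l , h) = z , l , keep h
    half : ∀ {u v z} → Blocked.Half c b' L u v z → Blocked.Half c b L u v z
    half (zu , zv , inj₁ (p , q , r)) = zu , zv , inj₁ (p , q , r ∘ keep)
    half (zu , zv , inj₂ (p , q , r)) = zu , zv , inj₂ (p , q , r ∘ keep)

  invariant-mono : Invariant c b → Invariant c b'
  invariant-mono I = record
    { L = L ; classes = classes ; good = good-mono good
    ; sparse = λ s h → ≤-trans (sparse s h) (+-monoˡ-≤ (order s) (*-monoʳ-≤ 2 (edges-mono {b} {b'} s λ e _ → keep e))) }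
    where
    open Invariant I
    open Edges L

-- The number of triangles

-- Mirrors the test local to `triangles`, with the adjacency as a parameter.
tri-word : {n : ℕ} → Adj n → List (Fin n) → Bool
tri-word c (x ∷ y ∷ z ∷ []) = (toℕ x <ᵇ toℕ y) ∧ ((toℕ y <ᵇ toℕ z) ∧ (c x y ∧ (c y z ∧ c x z)))
tri-word c _ = false

module Bound {n : ℕ} {c b : Adj n} (P : Position c b) (free : P6Free c) (I : Invariant c b) where
  open Position P
  open Simple simple
  open Invariant I
  open Shape c L
  open Static simple classes free
  open Shape.Classes classes
  open Edges L

  -- The edges are listed over the indices `Fin 5`, where their distinctness is decided by
  -- computation, and carried over by the injective `ρ`.
  seven-edges : ∀ {u a b d e} → Blades u a b d e → T (c a d) → 7 ≤ edges c u
  seven-edges {u} {a} {b} {d} {e} ((ua , ub , ab) , (ud , ue , de) , a≢d , a≢e , b≢d , b≢e) ad =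
    cnt-family {p = inside c u} {xs = pairs (allFin n)} 1 (λ ij → isPair (ρ (proj₁ ij)) (ρ (proj₂ ij)))
      (AllPairs.map disjoint (from-yes (allPairs? different? fan)))
      (edge 0F 1F (λ ()) refl la ua ∷ edge 0F 2F (λ ()) refl lb ub ∷ edge 0F 3F (λ ()) refl ld ud ∷ edge 0F 4F (λ ()) refl le ue
        ∷ edge 1F 2F (λ ()) la lb ab ∷ edge 3F 4F (λ ()) ld le de ∷ edge 1F 3F (λ ()) la ld ad ∷ [])
    where
    la = sym (lab ua)
    lb = sym (lab ub)
    ld = sym (lab ud)
    le = sym (lab ue)
    ρ : Fin 5 → Fin n
    ρ = Vec.lookup (u Vec.∷ a Vec.∷ b Vec.∷ d Vec.∷ e Vec.∷ Vec.[])
    ρ-inj : ∀ i j → ρ i ≡ ρ j → i ≡ j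
    ρ-inj = lookup-injective
      ((~≢ ua VecAll.∷ ~≢ ub VecAll.∷ ~≢ ud VecAll.∷ ~≢ ue VecAll.∷ VecAll.[]) VecPairs.∷
       (~≢ ab VecAll.∷ a≢d VecAll.∷ a≢e VecAll.∷ VecAll.[]) VecPairs.∷
       (b≢d VecAll.∷ b≢e VecAll.∷ VecAll.[]) VecPairs.∷ (~≢ de VecAll.∷ VecAll.[]) VecPairs.∷ VecAll.[] VecPairs.∷ VecPairs.[])
    fan : List (Fin 5 × Fin 5)
    fan = (0F , 1F) ∷ (0F , 2F) ∷ (0F , 3F) ∷ (0F , 4F) ∷ (1F , 2F) ∷ (3F , 4F) ∷ (1F , 3F) ∷ []
    Different : Fin 5 × Fin 5 → Fin 5 × Fin 5 → Set
    Different (i , j) (k , l) = ¬ ((i ≡ k × j ≡ l) ⊎ (i ≡ l × j ≡ k))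
    different? : ∀ p q → Dec (Different p q)
    different? (i , j) (k , l) = ¬? (((i ≟ᶠ k) ×-dec (j ≟ᶠ l)) ⊎-dec ((i ≟ᶠ l) ×-dec (j ≟ᶠ k)))
    disjoint : ∀ {p q} → Different p q → ∀ z → T (isPair (ρ (proj₁ p)) (ρ (proj₂ p)) z) → T (isPair (ρ (proj₁ q)) (ρ (proj₂ q)) z) → ⊥
    disjoint {i , j} {k , l} df (s , t) h h' = df (match (isPair⁻ {x = ρ i} {ρ j} {s} {t} h) (isPair⁻ {x = ρ k} {ρ l} {s} {t} h'))
      where
      eq : ∀ {z i j} → z ≡ ρ i → z ≡ ρ j → i ≡ j
      eq p q = ρ-inj _ _ (trans (sym p) q)
      match : (s ≡ ρ i × t ≡ ρ j) ⊎ (s ≡ ρ j × t ≡ ρ i) → (s ≡ ρ k × t ≡ ρ l) ⊎ (s ≡ ρ l × t ≡ ρ k) → (i ≡ k × j ≡ l) ⊎ (i ≡ l × j ≡ k)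
      match (inj₁ (p , q)) (inj₁ (r , s)) = inj₁ (eq p r , eq q s)
      match (inj₁ (p , q)) (inj₂ (r , s)) = inj₂ (eq p r , eq q s)
      match (inj₂ (p , q)) (inj₁ (r , s)) = inj₂ (eq q s , eq p r)
      match (inj₂ (p , q)) (inj₂ (r , s)) = inj₁ (eq q s , eq p r)
    edge : ∀ i j → i ≢ j → L (ρ i) ≡ L u → L (ρ j) ≡ L u → T (c (ρ i) (ρ j)) →
      1 ≤ P# (isPair (ρ i) (ρ j)) × (∀ z → T (isPair (ρ i) (ρ j) z) → T (inside c u z))
    edge i j i≢j li lj ij = P#-point (i≢j ∘ ρ-inj i j) , λ { (s , t) h →
      [ (λ { (p , q) → inside⁺ {c} {u} {s} (subst₂ (λ s t → T (c s t)) (sym p) (sym q) ij) (trans (cong L p) li) (trans (cong L q) lj) })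
      , (λ { (p , q) → inside⁺ {c} {u} {s} (subst₂ (λ s t → T (c s t)) (sym p) (sym q) (sy ij)) (trans (cong L p) lj) (trans (cong L q) li) }) ]′
      (isPair⁻ {x = ρ i} {ρ j} {s} {t} h) }

  -- Adding `2e` to the inequality of `Sparse` gives `4e ≤ 2(e + b) + v ≤ v² ≤ 25`, which excludes
  -- seven edges.
  few-edges : ∀ s → order s ≤ 5 → edges c s ≤ 6
  few-edges s h = ≮⇒≥ λ lt → <⇒≱ {25} {28} (m≤m+n 26 2) (≤-trans (*-monoʳ-≤ 4 lt) quad≤25)
    where
    quad≤25 : 4 * edges c s ≤ 25
    quad≤25 = ≤-trans (≤-reflexive (l (edges c s)))
      (≤-trans (+-monoʳ-≤ (2 * edges c s) (sparse s h))
      (≤-trans (≤-reflexive (r (edges c s) (edges b s) (order s)))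
      (≤-trans (+-monoˡ-≤ (order s) (*-monoʳ-≤ 2 (edges-disjoint {c} {b} s disj)))
      (≤-trans (≤-reflexive (cnt-both (inClass s) (allFin n))) (*-mono-≤ h h)))))
      where
      l : ∀ e → 4 * e ≡ 2 * e + 2 * e
      l = solve-∀
      r : ∀ e b v → 2 * e + (2 * b + v) ≡ 2 * (e + b) + v
      r = solve-∀

  -- A sixth vertex in the class leads to a forbidden path; on five vertices the chord would be a
  -- seventh edge.
  cross-free : ∀ {u a b d e} → Blades u a b d e → ¬ T (c a d)
  cross-free {u} {a} {b} {d} {e} bl ad with any? (λ z → (L z ≟ᶠ L u) ×-dec ¬? (five? bl z))
  ... | yes (z , lz , nz) = no-cross bl lz nz ad
  ... | no none = <⇒≱ (seven-edges bl ad) (few-edges u (≤-trans (cnt-mono only-five (allFin n)) five≤))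
    where
    F : Fin n → Bool
    F z = (z == u) ∨ ((z == a) ∨ ((z == b) ∨ ((z == d) ∨ (z == e))))
    only-five : ∀ z → T (inClass u z) → T (F z)
    only-five z t with decidable-stable (five? bl z) (λ nz → none (z , ==⁻ t , nz))
    ... | inj₁ p = ∨⁺ˡ _ (==⁺ p)
    ... | inj₂ (inj₁ p) = ∨⁺ʳ (z == u) (∨⁺ˡ _ (==⁺ p))
    ... | inj₂ (inj₂ (inj₁ p)) = ∨⁺ʳ (z == u) (∨⁺ʳ (z == a) (∨⁺ˡ _ (==⁺ p)))
    ... | inj₂ (inj₂ (inj₂ (inj₁ p))) = ∨⁺ʳ (z == u) (∨⁺ʳ (z == a) (∨⁺ʳ (z == b) (∨⁺ˡ _ (==⁺ p))))
    ... | inj₂ (inj₂ (inj₂ (inj₂ p))) = ∨⁺ʳ (z == u) (∨⁺ʳ (z == a) (∨⁺ʳ (z == b) (∨⁺ʳ (z == d) (==⁺ p))))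
    plus : ∀ (x : Fin n) {q k} → V# q ≤ k → V# (λ z → (z == x) ∨ q z) ≤ suc k
    plus x {q} h = ≤-trans (cnt-∪ (λ z → ∨⁻ {z == x}) (allFin n)) (+-mono-≤ (V#-point≤1 x) h)
    five≤ : V# F ≤ 5
    five≤ = plus u (plus a (plus b (plus d (V#-point≤1 e))))

  IsTriangle : Fin n → List (Fin n) → Set
  IsTriangle s t = ∃[ x ] ∃[ y ] ∃[ z ] t ≡ x ∷ y ∷ z ∷ [] × toℕ x < toℕ y × toℕ y < toℕ z × Tri x y z × L x ≡ L s

  private
    rank : ∀ {w x y z} → In w x y z → ℕ
    rank (inj₁ _) = 0
    rank (inj₂ (inj₁ _)) = 1
    rank (inj₂ (inj₂ _)) = 2

    rank-mono : ∀ {v w x y z} → toℕ x < toℕ y → toℕ y < toℕ z → toℕ v < toℕ w →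
      (i : In v x y z) (j : In w x y z) → rank i < rank j
    rank-mono xy yz vw (inj₁ refl) (inj₁ refl) = ⊥-elim (<-irrefl refl vw)
    rank-mono xy yz vw (inj₁ _) (inj₂ (inj₁ _)) = s≤s z≤n
    rank-mono xy yz vw (inj₁ _) (inj₂ (inj₂ _)) = s≤s z≤n
    rank-mono xy yz vw (inj₂ (inj₁ refl)) (inj₁ refl) = ⊥-elim (<-asym vw xy)
    rank-mono xy yz vw (inj₂ (inj₁ refl)) (inj₂ (inj₁ refl)) = ⊥-elim (<-irrefl refl vw)
    rank-mono xy yz vw (inj₂ (inj₁ _)) (inj₂ (inj₂ _)) = s≤s (s≤s z≤n)
    rank-mono xy yz vw (inj₂ (inj₂ refl)) (inj₁ refl) = ⊥-elim (<-asym vw (<-trans xy yz))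
    rank-mono xy yz vw (inj₂ (inj₂ refl)) (inj₂ (inj₁ refl)) = ⊥-elim (<-asym vw yz)
    rank-mono xy yz vw (inj₂ (inj₂ refl)) (inj₂ (inj₂ refl)) = ⊥-elim (<-irrefl refl vw)

    aligned : ∀ {u v w x y z} (i : In u x y z) (j : In v x y z) (k : In w x y z) →
      rank i < rank j → rank j < rank k → u ≡ x × v ≡ y × w ≡ z
    aligned (inj₁ p) (inj₂ (inj₁ q)) (inj₂ (inj₂ r)) _ _ = p , q , r
    aligned _ (inj₁ _) _ () _
    aligned _ _ (inj₁ _) _ ()
    aligned (inj₁ _) (inj₂ (inj₁ _)) (inj₂ (inj₁ _)) _ (s≤s ())
    aligned _ (inj₂ (inj₂ _)) (inj₂ (inj₁ _)) _ (s≤s ())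
    aligned _ (inj₂ (inj₂ _)) (inj₂ (inj₂ _)) _ (s≤s (s≤s ()))
    aligned (inj₂ (inj₁ _)) (inj₂ (inj₁ _)) _ (s≤s ()) _
    aligned (inj₂ (inj₂ _)) (inj₂ (inj₁ _)) _ (s≤s ()) _

  -- Both words increase, so the positions of the letters of `t` within `t'` increase strictly and
  -- must be 0, 1, 2.
  same-triangle : ∀ {s t t'} (h : IsTriangle s t) (h' : IsTriangle s t') → (∀ {w} → w ∈ t → w ∈ t') → t ≡ t'
  same-triangle (x , y , z , refl , xy , yz , _) (x' , y' , z' , refl , xy' , yz' , _) sub
    with aligned _ _ _ (rank-mono xy' yz' xy (toIn (sub (here refl))) (toIn (sub (there (here refl)))))
                       (rank-mono xy' yz' yz (toIn (sub (there (here refl)))) (toIn (sub (there (there (here refl))))))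
    where
    toIn : ∀ {w} → w ∈ x' ∷ y' ∷ z' ∷ [] → In w x' y' z'
    toIn (here e) = inj₁ e
    toIn (there (here e)) = inj₂ (inj₁ e)
    toIn (there (there (here e))) = inj₂ (inj₂ e)
  ... | refl , refl , refl = refl

  private
    _∈!_ : Fin n → List (Fin n) → Bool
    z ∈! t = ⌊ _∈?_ _≟ᶠ_ z t ⌋

    ∈⇒In : ∀ {w x y z} → w ∈ x ∷ y ∷ z ∷ [] → In w x y z
    ∈⇒In (here e) = inj₁ e
    ∈⇒In (there (here e)) = inj₂ (inj₁ e)
    ∈⇒In (there (there (here e))) = inj₂ (inj₂ e)

    In⇒∈ : ∀ {w x y z} → In w x y z → w ∈ x ∷ y ∷ z ∷ []
    In⇒∈ (inj₁ e) = here e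
    In⇒∈ (inj₂ (inj₁ e)) = there (here e)
    In⇒∈ (inj₂ (inj₂ e)) = there (there (here e))

    complete : ∀ {s t u v} → IsTriangle s t → u ∈ t → v ∈ t → u ≢ v →
      ∃[ w ] Tri u v w × (∀ {z} → z ∈ t → In z u v w) × (∀ {z} → In z u v w → z ∈ t)
    complete (x , y , z , refl , _ , _ , tr , _) i j ne with third-vertex ne (∈⇒In i) (∈⇒In j) tr
    ... | w , tr' , to , from = w , tr' , to ∘ ∈⇒In , In⇒∈ ∘ from

    in-class : ∀ {s t w} → IsTriangle s t → w ∈ t → L w ≡ L s
    in-class (x , y , z , refl , _ , _ , (xy , xz , _) , l) (here refl) = l
    in-class (x , y , z , refl , _ , _ , (xy , xz , _) , l) (there (here refl)) = trans (sym (lab xy)) l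
    in-class (x , y , z , refl , _ , _ , (xy , xz , _) , l) (there (there (here refl))) = trans (sym (lab xz)) l

    distinct-pairs : ∀ {A : Set} {Q : A → Set} {R : A → A → Set} {xs} → Unique xs → All Q xs →
      (∀ {t t'} → Q t → Q t' → t ≢ t' → R t t') → AllPairs R xs
    distinct-pairs [] [] f = []
    distinct-pairs (ne ∷ u) (q ∷ qs) f = All.zipWith (λ { (ne , q') → f q q' ne }) (ne , qs) ∷ distinct-pairs u qs f

  -- Every triangle passes through the centre and, by `blade-unique`, owns its two other vertices.
  windmill-bound : ∀ {s xs} → HasButterfly s → Unique xs → All (IsTriangle s) xs → length xs * 2 ≤ order s
  windmill-bound {s} {xs} (u , lu , _ , _ , _ , _ , bl) uq all =
    cnt-family {p = inClass s} {xs = allFin n} 2 share₁ (distinct-pairs uq all apart) (All.map sees all)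
    where
    open Windmill bl cross-free
    share₁ : List (Fin n) → Fin n → Bool
    share₁ t z = (z ∈! t) ∧ not (z == u)
    centre∈ : ∀ {t} → IsTriangle s t → u ∈ t
    centre∈ (x , y , z , refl , _ , _ , tr , l) = In⇒∈ (centre (trans l (sym lu)) tr)
    apart : ∀ {t t'} → IsTriangle s t → IsTriangle s t' → t ≢ t' → ∀ z → T (share₁ t z) → T (share₁ t' z) → ⊥
    apart {t} {t'} h h' ne z k k' with ∧⁻ {z ∈! t} k | ∧⁻ {z ∈! t'} k'
    ... | i , z≢u | i' , _ with complete h (centre∈ h) (toWitness i) (λ { refl → not⁻ z≢u (==⁺ refl) })
                              | complete h' (centre∈ h') (toWitness i') (λ { refl → not⁻ z≢u (==⁺ refl) })
    ... | w , tr , to , _ | w' , tr' , _ , from with blade-unique tr tr'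
    ... | refl = ne (same-triangle h h' (from ∘ to))
    sees : ∀ {t} → IsTriangle s t → 2 ≤ V# (share₁ t) × (∀ z → T (share₁ t z) → T (inClass s z))
    sees {t} h@(x , y , z , refl , _ , _ , tr , l) with orient (centre (trans l (sym lu)) tr) tr
    ... | p , q , (up , uq , pq) , inc = V#-unique {p = share₁ t} {xs = p ∷ q ∷ []} ((~≢ pq ∷ []) ∷ [] ∷ [])
          ( ∧⁺ (fromWitness (In⇒∈ (inc (inj₂ (inj₁ refl))))) (not⁺ (~≢ up ∘ sym ∘ ==⁻))
          ∷ ∧⁺ (fromWitness (In⇒∈ (inc (inj₂ (inj₂ refl))))) (not⁺ (~≢ uq ∘ sym ∘ ==⁻)) ∷ [])
        , λ w k → ==⁺ (in-class h (toWitness (proj₁ (∧⁻ {w ∈! t} k))))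

  book-bound : ∀ {s u v xs} → u ≢ v → AllThrough s u v → Unique xs → All (IsTriangle s) xs → length xs * 1 ≤ Blocked.pages c b L u v
  book-bound {s} {u} {v} {xs} u≢v through uq all =
    cnt-family {p = λ z → ⌊ common? u v z ⌋} {xs = allFin n} 1 page (distinct-pairs uq all apart) (All.map sees all)
    where
    page : List (Fin n) → Fin n → Bool
    page t z = (z ∈! t) ∧ (not (z == u) ∧ not (z == v))
    page⁻ : ∀ {t z} → T (page t z) → z ∈ t × z ≢ u × z ≢ v
    page⁻ {t} {z} k = let i , k' = ∧⁻ {z ∈! t} k ; p , q = ∧⁻ {not (z == u)} k' in
      toWitness i , (λ { refl → not⁻ p (==⁺ refl) }) , (λ { refl → not⁻ q (==⁺ refl) })
    spine∈ : ∀ {t} → IsTriangle s t → u ∈ t × v ∈ t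
    spine∈ (x , y , z , refl , _ , _ , tr , l) = In⇒∈ (proj₁ (through l tr)) , In⇒∈ (proj₂ (through l tr))
    is-third : ∀ {z w} → z ≢ u → z ≢ v → In z u v w → z ≡ w
    is-third zu _ (inj₁ e) = ⊥-elim (zu e)
    is-third _ zv (inj₂ (inj₁ e)) = ⊥-elim (zv e)
    is-third _ _ (inj₂ (inj₂ e)) = e
    apart : ∀ {t t'} → IsTriangle s t → IsTriangle s t' → t ≢ t' → ∀ z → T (page t z) → T (page t' z) → ⊥
    apart {t} {t'} h h' ne z k k' with page⁻ {t} {z} k | page⁻ {t'} {z} k'
    ... | i , zu , zv | i' , _ with complete h (proj₁ (spine∈ h)) (proj₂ (spine∈ h)) u≢v
                                 | complete h' (proj₁ (spine∈ h')) (proj₂ (spine∈ h')) u≢v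
    ... | w , _ , to , _ | w' , _ , to' , from' with is-third zu zv (to i) | is-third zu zv (to' i')
    ... | refl | refl = ne (same-triangle h h' (from' ∘ to))
    sees : ∀ {t} → IsTriangle s t → 1 ≤ V# (page t) × (∀ z → T (page t z) → T ⌊ common? u v z ⌋)
    sees {t} h with complete h (proj₁ (spine∈ h)) (proj₂ (spine∈ h)) u≢v
    ... | w , (_ , uw , vw) , to , from = V#-unique {p = page t} {xs = w ∷ []} ([] ∷ [])
          (∧⁺ {w ∈! t} (fromWitness (from (inj₂ (inj₂ refl)))) (∧⁺ (not⁺ (~≢ uw ∘ sym ∘ ==⁻)) (not⁺ (~≢ vw ∘ sym ∘ ==⁻))) ∷ [])
        , λ z k → let i , zu , zv = page⁻ {t} {z} k in
            fromWitness (subst (λ z → Common u v z) (sym (is-third zu zv (to i))) (uw , vw))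

  -- A triangle missing `p` contains both `u` and `v`, so `u v` has two pages: `p` and the third
  -- vertex of that triangle.
  outside : ∀ {s p u v x y z} → ¬ HasButterfly s → Tri p u v → Tri x y z → L p ≡ L s → L x ≡ L s → ¬ In p x y z →
    ∃[ u ] ∃[ v ] L u ≡ L s × Spine u v
  outside {s} {p} {u} {v} {x} {y} {z} nb tp@(pu , pv , uv) t lp lx np with third-vertex (~≢ uv)
      (decidable-stable (In? u x y z) λ nu → share nb tp t lp lx np nu)
      (decidable-stable (In? v x y z) λ nv → share nb (pv , pu , sy uv) t lp lx np nv) t
  ... | q , (_ , uq , vq) , _ , from = u , v , trans (sym (lab pu)) lp , uv , p , q ,
        (λ { refl → np (from (inj₂ (inj₂ refl))) }) , (sy pu , sy pv) , (uq , vq)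

  find-spine : ∀ {s t t'} → ¬ HasButterfly s → IsTriangle s t → IsTriangle s t' → t ≢ t' → ∃[ u ] ∃[ v ] L u ≡ L s × Spine u v
  find-spine {s} {t} {t'} nb h@(x , y , z , refl , _ , _ , tr , l) h'@(x' , y' , z' , refl , _ , _ , tr' , l') ne
    with In? x x' y' z' | In? y x' y' z' | In? z x' y' z'
  ... | yes ix | yes iy | yes iz = ⊥-elim (ne (same-triangle h h' λ
          { (here refl) → In⇒∈ ix ; (there (here refl)) → In⇒∈ iy ; (there (there (here refl))) → In⇒∈ iz }))
  ... | no nx | _ | _ = outside nb tr tr' l l' nx
  ... | _ | no ny | _ = outside nb (rot tr) tr' (trans (sym (lab (proj₁ tr))) l) l' ny
  ... | _ | _ | no nz = outside nb (rot (rot tr)) tr' (trans (sym (lab (proj₁ (proj₂ tr)))) l) l' nz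

  -- Two different triangles produce a butterfly or a spine. With a spine and no butterfly, all
  -- triangles contain the spine, so their number is at most the number of pages and the budget
  -- applies.
  class-bound : ∀ {s} (xs : List (List (Fin n))) → Unique xs → All (IsTriangle s) xs → length xs * 2 ≤ order s
  class-bound [] _ _ = z≤n
  class-bound {s} (t ∷ []) _ ((x , y , z , refl , xy , _ , (e , _) , l) ∷ []) =
    V#-unique {p = inClass s} {xs = x ∷ y ∷ []} ((~≢ e ∷ []) ∷ [] ∷ []) (==⁺ l ∷ ==⁺ (trans (sym (lab e)) l) ∷ [])
  class-bound {s} xs@(t ∷ t' ∷ _) uq@((ne ∷ _) ∷ _) all@(h ∷ h' ∷ _) with hasButterfly? s
  ... | yes bf = windmill-bound bf uq all
  ... | no nb with find-spine nb h h' ne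
  ...   | u , v , lu , sp with Blocked.Good.budget good sp
  ...     | inj₁ (w , lw , k) = ⊥-elim (nb (w , trans lw lu , k))
  ...     | inj₂ bd = ≤-trans (≤-reflexive (trans (*-comm (length xs) 2) (cong (2 *_) (sym (*-identityʳ (length xs))))))
              (≤-trans (*-monoʳ-≤ 2 (book-bound (~≢ (proj₁ sp)) (Blocked.through-spine c b L P classes free good nb lu sp) uq all))
              (≤-trans (m≤m+n _ _) (≤-trans bd (≤-reflexive (order-cong lu)))))

  label-is : Fin n → List (Fin n) → Bool
  label-is r [] = false
  label-is r (x ∷ _) = L x == r

  private
    within : List (Fin n) → Fin n → Bool
    within [] l = false
    within (r ∷ rs) l = (l == r) ∨ within rs l

    within-word : List (Fin n) → List (Fin n) → Bool
    within-word rs t = tri-word c t ∧ head-in t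
      where
      head-in : List (Fin n) → Bool
      head-in [] = false
      head-in (x ∷ _) = within rs (L x)

    within⁻ : ∀ {l} rs → T (within rs l) → l ∈ rs
    within⁻ {l} (r ∷ rs) t = [ here ∘ ==⁻ , there ∘ within⁻ rs ]′ (∨⁻ {l == r} t)

    within⁺ : ∀ {l rs} → l ∈ rs → T (within rs l)
    within⁺ (here e) = ∨⁺ˡ _ (==⁺ e)
    within⁺ {l} {r ∷ rs} (there i) = ∨⁺ʳ (l == r) (within⁺ i)

  module _ {ws : List (List (Fin n))} (uq : Unique ws) where
    label-bound : ∀ r → 2 * cnt (λ t → tri-word c t ∧ label-is r t) ws ≤ V# (λ z → L z == r)
    label-bound r with any? (λ z → L z ≟ᶠ r)
    ... | no none = ≤-trans (≤-reflexive (cong (2 *_) (cnt-≡0 (λ t k → empty t (proj₂ (∧⁻ {tri-word c t} k))) ws))) z≤n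
      where
      empty : ∀ t → ¬ T (label-is r t)
      empty (x ∷ _) k = none (x , ==⁻ k)
    ... | yes (s , refl) = ≤-trans (≤-reflexive (trans (*-comm 2 (cnt p ws)) (cong (_* 2) (sym (cnt-bfilter p ws)))))
            (class-bound (bfilter p ws) (bfilter-unique p uq) (bfilter-all p (λ t k → is t k) ws))
      where
      p : List (Fin n) → Bool
      p t = tri-word c t ∧ label-is (L s) t
      is : ∀ t → T (p t) → IsTriangle s t
      is t@(x ∷ y ∷ z ∷ []) k with ∧⁻ {tri-word c t} k
      ... | k₁ , l with ∧⁻ {toℕ x <ᵇ toℕ y} k₁
      ... | xy , k₂ with ∧⁻ {toℕ y <ᵇ toℕ z} k₂
      ... | yz , k₃ with ∧⁻ {c x y} k₃
      ... | e , k₄ with ∧⁻ {c y z} k₄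
      ... | f , g = x , y , z , refl , <ᵇ⇒< _ _ xy , <ᵇ⇒< _ _ yz , (e , g , f) , ==⁻ l

    -- Triangles are sorted by the label of their first vertex. Classes are disjoint sets of
    -- vertices, so the bounds add up.
    labels-bound : ∀ {rs} → Unique rs → 2 * cnt (within-word rs) ws ≤ V# (within rs ∘ L)
    labels-bound {[]} _ = ≤-trans (≤-reflexive (cong (2 *_) (cnt-≡0 (λ { t@(_ ∷ _) k → proj₂ (∧⁻ {tri-word c t} k) ; [] () }) ws))) z≤n
    labels-bound {r ∷ rs} (a ∷ u) = ≤-trans
      (*-monoʳ-≤ 2 (cnt-∪ {p = λ t → tri-word c t ∧ label-is r t} {q = within-word rs} split ws))
      (≤-trans (≤-reflexive (*-distribˡ-+ 2 (cnt (λ t → tri-word c t ∧ label-is r t) ws) (cnt (within-word rs) ws)))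
      (≤-trans (+-mono-≤ (label-bound r) (labels-bound u))
        (cnt-⊎ (λ z t t' → All.lookup a (within⁻ rs t') (sym (==⁻ t))) (λ z → ∨⁺ˡ _) (λ z → ∨⁺ʳ (L z == r)) (allFin n))))
      where
      split : ∀ t → T (within-word (r ∷ rs) t) → T (tri-word c t ∧ label-is r t) ⊎ T (within-word rs t)
      split t@(x ∷ _) k = let k₁ , k₂ = ∧⁻ {tri-word c t} k in
        Sum.map (∧⁺ {tri-word c t} k₁) (∧⁺ {tri-word c t} k₁) (∨⁻ {L x == r} k₂)

    word-bound : 2 * cnt (tri-word c) ws ≤ n
    word-bound = ≤-trans (*-monoʳ-≤ 2 (cnt-mono all ws)) (≤-trans (labels-bound (allFin⁺ n))
      (≤-trans (cnt-mono (λ _ _ → _) (allFin n)) (≤-reflexive (trans (cnt-true (allFin n)) (length-tabulate (λ i → i))))))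
      where
      all : ∀ t → T (tri-word c t) → T (within-word (allFin n) t)
      all t@(x ∷ _) k = ∧⁺ {tri-word c t} k (within⁺ (∈-allFin (L x)))

-- Positions of the game

or⁻ : (p : A → Bool) (xs : List A) → T (foldr (λ x r → p x ∨ r) false xs) → Any (T ∘ p) xs
or⁻ p (x ∷ xs) t = [ here , there ∘ or⁻ p xs ]′ (∨⁻ {p x} t)

or⁺ : (p : A → Bool) {xs : List A} → Any (T ∘ p) xs → T (foldr (λ x r → p x ∨ r) false xs)
or⁺ p (here t) = ∨⁺ˡ _ t
or⁺ p {x ∷ _} (there i) = ∨⁺ʳ (p x) (or⁺ p i)

bfilter-∈⁺ : (p : A → Bool) {x : A} {xs : List A} → x ∈ xs → T (p x) → x ∈ bfilter p xs
bfilter-∈⁺ p {x} (here refl) t with p x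
... | true = here refl
bfilter-∈⁺ p {xs = y ∷ _} (there i) t with p y
... | true = there (bfilter-∈⁺ p i t)
... | false = bfilter-∈⁺ p i t

bfilter-∈⁻ : (p : A → Bool) {x : A} (xs : List A) → x ∈ bfilter p xs → x ∈ xs × T (p x)
bfilter-∈⁻ p (y ∷ xs) i with p y in eq
bfilter-∈⁻ p (y ∷ xs) (here refl) | true = here refl , subst T (sym eq) tt
bfilter-∈⁻ p (y ∷ xs) (there i) | true = let j , t = bfilter-∈⁻ p xs i in there j , t
bfilter-∈⁻ p (y ∷ xs) i | false = let j , t = bfilter-∈⁻ p xs i in there j , t

sameE⁻ : {e f : Edge n} → T (sameE e f) → e ≡ f
sameE⁻ {e = a , b} {f = c , d} t = let p , q = ∧⁻ {a == c} t in cong₂ _,_ (==⁻ p) (==⁻ q)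

sameE⁺ : (e : Edge n) → T (sameE e e)
sameE⁺ (a , b) = ∧⁺ {a == a} (==⁺ refl) (==⁺ refl)

memE⁻ : {e : Edge n} (G : Graph n) → T (memE e G) → e ∈ G
memE⁻ {e = e} G t = Any.map (sameE⁻ {e = e}) (or⁻ (sameE e) G t)

memE⁺ : {e : Edge n} {G : Graph n} → e ∈ G → T (memE e G)
memE⁺ {e = e} i = or⁺ (sameE e) (Any.map (λ { refl → sameE⁺ e }) i)

adj⁻ : (u v : Fin n) (G : Graph n) → T (adj G u v) → (u , v) ∈ G ⊎ (v , u) ∈ G
adj⁻ u v G t = Sum.map (memE⁻ G) (memE⁻ G) (∨⁻ {memE (u , v) G} t)

adj⁺ : (u v : Fin n) {G : Graph n} → (u , v) ∈ G ⊎ (v , u) ∈ G → T (adj G u v)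
adj⁺ u v {G} = [ ∨⁺ˡ (memE (v , u) G) ∘ memE⁺ , ∨⁺ʳ (memE (u , v) G) ∘ memE⁺ ]′

adj-sym : (u v : Fin n) (G : Graph n) → T (adj G u v) → T (adj G v u)
adj-sym u v G t = adj⁺ v u (Sum.swap (adj⁻ u v G t))

adj-adds : (x y : Fin n) (G : Graph n) → Adds (adj G) x y (adj ((x , y) ∷ G))
adj-adds {n} x y G = record
  { old = λ {u} {v} t → adj⁺ u v {(x , y) ∷ G} (Sum.map there there (adj⁻ u v G t))
  ; new = adj⁺ x y {(x , y) ∷ G} (inj₁ (here refl)) ; only = only }
  where
  only : ∀ {u v} → T (adj ((x , y) ∷ G) u v) → T (adj G u v) ⊎ (u ≡ x × v ≡ y) ⊎ (u ≡ y × v ≡ x)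
  only {u} {v} t with adj⁻ u v ((x , y) ∷ G) t
  ... | inj₁ (here refl) = inj₂ (inj₁ (refl , refl))
  ... | inj₁ (there i) = inj₁ (adj⁺ u v (inj₁ i))
  ... | inj₂ (here refl) = inj₂ (inj₂ (refl , refl))
  ... | inj₂ (there i) = inj₁ (adj⁺ u v (inj₂ i))

Sorted : Graph n → Set
Sorted G = ∀ {u v} → (u , v) ∈ G → toℕ u < toℕ v

sorted-simple : {G : Graph n} → Sorted G → Simple (adj G)
sorted-simple {G = G} s = record
  { irr = λ {u} t → [ (λ i → <-irrefl refl (s i)) , (λ i → <-irrefl refl (s i)) ]′ (adj⁻ u u G t)
  ; sy = λ {u} {v} → adj-sym u v G }

allEdges⁺ : {u v : Fin n} → toℕ u < toℕ v → (u , v) ∈ allEdges n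
allEdges⁺ {u = u} {v} h = bfilter-∈⁺ _ (∈-cartesianProduct⁺ (∈-allFin u) (∈-allFin v)) (<⇒<ᵇ h)

allEdges⁻ : {u v : Fin n} → (u , v) ∈ allEdges n → toℕ u < toℕ v
allEdges⁻ {n} {u} {v} i = <ᵇ⇒< (toℕ u) (toℕ v) (proj₂ (bfilter-∈⁻ _ (cartesianProduct (allFin n) (allFin n)) i))

unclaimed⁻ : {u v : Fin n} {C B : Graph n} → (u , v) ∈ unclaimed C B →
  toℕ u < toℕ v × ¬ (u , v) ∈ C × ¬ (u , v) ∈ B
unclaimed⁻ {n} {u} {v} {C} {B} i with bfilter-∈⁻ _ (allEdges n) i
... | j , t = allEdges⁻ j , (λ k → not⁻ t (∨⁺ˡ (memE (u , v) B) (memE⁺ k))) , (λ k → not⁻ t (∨⁺ʳ (memE (u , v) C) (memE⁺ k)))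

unclaimed⁺ : {u v : Fin n} {C B : Graph n} → toℕ u < toℕ v → ¬ (u , v) ∈ C → ¬ (u , v) ∈ B → (u , v) ∈ unclaimed C B
unclaimed⁺ {u = u} {v} {C} {B} h nc nb = bfilter-∈⁺ _ (allEdges⁺ h)
  (not⁺ λ t → [ nc ∘ memE⁻ C , nb ∘ memE⁻ B ]′ (∨⁻ {memE (u , v) C} t))

sorted-∷ : {e : Edge n} {C G : Graph n} (B : Graph n) → Sorted G → e ∈ unclaimed C B → Sorted (e ∷ G)
sorted-∷ {C = C} B s i (here refl) = proj₁ (unclaimed⁻ {C = C} {B} i)
sorted-∷ B s i (there j) = s j

not-adj : (u v : Fin n) {G : Graph n} → Sorted G → toℕ u < toℕ v → ¬ (u , v) ∈ G → ¬ T (adj G u v)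
not-adj u v {G} s h ni t = [ ni , (λ i → <-asym h (s i)) ]′ (adj⁻ u v G t)

edge-of : (u v : Fin n) → u ≢ v → ∃[ e ] (e ≡ (u , v) ⊎ e ≡ (v , u)) × toℕ (proj₁ e) < toℕ (proj₂ e)
edge-of u v ne with <-cmp (toℕ u) (toℕ v)
... | tri< h _ _ = (u , v) , inj₁ refl , h
... | tri≈ _ e _ = ⊥-elim (ne (toℕ-injective e))
... | tri> _ _ h = (v , u) , inj₂ refl , h

words-∈ : (w : List (Fin n)) → w ∈ words (length w)
words-∈ [] = here refl
words-∈ {n} (x ∷ w) = ∈-concatMap⁺ (λ v → map (v ∷_) (words (length w)))
  (Any.map (λ { refl → ∈-map⁺ (x ∷_) (words-∈ w) }) (∈-allFin x))

words-length : (k : ℕ) {w : List (Fin n)} → w ∈ words k → length w ≡ k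
words-length zero (here refl) = refl
words-length {n} (suc k) i with find (∈-concatMap⁻ (λ v → map (v ∷_) (words k)) {xs = allFin n} i)
... | v , _ , j with ∈-map⁻ (v ∷_) j
... | w , l , refl = cong suc (words-length k l)

words-unique : (n k : ℕ) → Unique (words {n} k)
words-unique n zero = [] ∷ []
words-unique n (suc k) = concat⁺
  (Allₚ.map⁺ (All.universal (λ v → Uniqueₚ.map⁺ (proj₂ ∘ ∷-injective) (words-unique n k)) (allFin n)))
  (AllPairsₚ.map⁺ (AllPairs.map (λ { ne (i , j) → disjoint ne i j }) (allFin⁺ n)))
  where
  disjoint : ∀ {u v : Fin n} {w} → u ≢ v → w ∈ map (u ∷_) (words k) → w ∈ map (v ∷_) (words k) → ⊥
  disjoint {u} {v} ne i j with ∈-map⁻ (u ∷_) i | ∈-map⁻ (v ∷_) j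
  ... | _ , _ , refl | _ , _ , e = ne (proj₁ (∷-injective e))

notIn⁺ : {v : Fin n} {ws : List (Fin n)} → All (v ≢_) ws → T (notIn v ws)
notIn⁺ [] = tt
notIn⁺ {v = v} {w ∷ _} (ne ∷ a) = ∧⁺ (not⁺ {v == w} (ne ∘ ==⁻)) (notIn⁺ a)

notIn⁻ : {v : Fin n} (ws : List (Fin n)) → T (notIn v ws) → All (v ≢_) ws
notIn⁻ [] _ = []
notIn⁻ {v = v} (w ∷ ws) t = let p , q = ∧⁻ {not (v == w)} t in (λ e → not⁻ p (==⁺ e)) ∷ notIn⁻ ws q

P6-free : (G : Graph n) → Simple (adj G) → ¬ T (containsP6 G) → P6Free (adj G)
P6-free {n} G simple free {p} {q} {r} {s} {t} {u} pq qr rs st tu pr ps pt pu qs qt qu rt ru su =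
  free (or⁺ (λ w → distinct w ∧ isWalk G w) {words 6} (Any.map (λ { refl → path }) (words-∈ (p ∷ q ∷ r ∷ s ∷ t ∷ u ∷ []))))
  where
  open Simple simple
  dist : T (distinct (p ∷ q ∷ r ∷ s ∷ t ∷ u ∷ []))
  dist = ∧⁺ (notIn⁺ (~≢ pq ∷ pr ∷ ps ∷ pt ∷ pu ∷ [])) (∧⁺ (notIn⁺ (~≢ qr ∷ qs ∷ qt ∷ qu ∷ []))
    (∧⁺ (notIn⁺ (~≢ rs ∷ rt ∷ ru ∷ [])) (∧⁺ (notIn⁺ (~≢ st ∷ su ∷ [])) (∧⁺ (notIn⁺ (~≢ tu ∷ [])) tt))))
  path : T (distinct (p ∷ q ∷ r ∷ s ∷ t ∷ u ∷ []) ∧ isWalk G (p ∷ q ∷ r ∷ s ∷ t ∷ u ∷ []))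
  path = ∧⁺ dist (∧⁺ {adj G p q} pq (∧⁺ {adj G q r} qr (∧⁺ {adj G r s} rs (∧⁺ {adj G s t} st (∧⁺ {adj G t u} tu tt)))))

triangles≡ : (G : Graph n) → triangles G ≡ cnt (tri-word (adj G)) (words 3)
triangles≡ {n} G = by-words (λ
  { [] → refl ; (_ ∷ []) → refl ; (_ ∷ _ ∷ []) → refl ; (_ ∷ _ ∷ _ ∷ []) → refl ; (_ ∷ _ ∷ _ ∷ _ ∷ _) → refl }) (words {n} 3)
  where
  by-words : {p q : List (Fin n) → Bool} → (∀ w → p w ≡ q w) → (ws : List (List (Fin n))) → length (bfilter p ws) ≡ cnt q ws
  by-words {p} f ws = trans (cnt-bfilter p ws) (cnt-≗ f ws)

-- The upper bound

record Legal (C B : Graph n) : Set where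
  field
    sortedᶜ : Sorted C
    sortedᵇ : Sorted B
    separate : ∀ {e} → e ∈ C → e ∈ B → ⊥

  simpleᶜ : Simple (adj C)
  simpleᶜ = sorted-simple sortedᶜ

  position : Position (adj C) (adj B)
  position = record { simple = sorted-simple sortedᶜ ; simpleᵇ = sorted-simple sortedᵇ
    ; disj = λ {u} {v} t t' → clash u v (adj⁻ u v C t) (adj⁻ u v B t') }
    where
    clash : ∀ u v → (u , v) ∈ C ⊎ (v , u) ∈ C → (u , v) ∈ B ⊎ (v , u) ∈ B → ⊥
    clash u v (inj₁ i) (inj₁ j) = separate i j
    clash u v (inj₁ i) (inj₂ j) = <-asym (sortedᶜ i) (sortedᵇ j)
    clash u v (inj₂ i) (inj₁ j) = <-asym (sortedᶜ i) (sortedᵇ j)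
    clash u v (inj₂ i) (inj₂ j) = separate i j

legal-C : {C B : Graph n} {e : Edge n} → Legal C B → e ∈ unclaimed C B → Legal (e ∷ C) B
legal-C {C = C} {B} l i = record { sortedᶜ = sorted-∷ {C = C} B sortedᶜ i ; sortedᵇ = sortedᵇ
  ; separate = λ { (here refl) k → proj₂ (proj₂ (unclaimed⁻ {C = C} {B} i)) k ; (there j) k → separate j k } }
  where open Legal l

legal-B : {C B : Graph n} {e : Edge n} → Legal C B → e ∈ unclaimed C B → Legal C (e ∷ B)
legal-B {C = C} {B} l i = record { sortedᶜ = sortedᶜ ; sortedᵇ = sorted-∷ {C = C} B sortedᵇ i
  ; separate = λ { k (here refl) → proj₁ (proj₂ (unclaimed⁻ {C = C} {B} i)) k ; k (there j) → separate k j } }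
  where open Legal l

legalC⁻ : {e : Edge n} (C B : Graph n) → e ∈ legalC C B → e ∈ unclaimed C B × ¬ T (containsP6 (e ∷ C))
legalC⁻ {e = e} C B i = let j , t = bfilter-∈⁻ _ (unclaimed C B) i in j , not⁻ t

record State (C B : Graph n) : Set where
  field
    legal : Legal C B
    path-free : P6Free (adj C)
    invariant : Invariant (adj C) (adj B)

state-bound : {C B : Graph n} → State C B → 2 * triangles C ≤ n
state-bound {n} {C} s = subst (λ t → 2 * t ≤ n) (sym (triangles≡ C))
  (Bound.word-bound (Legal.position legal) path-free invariant (words-unique n 3))
  where open State s

-- Blocker is to move. For `reply` the invariant is only known after the prescribed edge; `anything`
-- has it both before and after.
data Defence (C B : Graph n) : Set where
  anything : State C B → (∀ {e} → e ∈ unclaimed C B → State C (e ∷ B)) → Defence C B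
  reply : ∀ {e} → e ∈ unclaimed C B → State C (e ∷ B) → Defence C B

defend : {C B : Graph n} {e : Edge n} → State C B → e ∈ legalC C B → Defence (e ∷ C) B
defend {n} {C} {B} {x , y} s i with legalC⁻ C B i
... | j , free with unclaimed⁻ {C = C} {B} j
... | x<y , x∉C , x∉B = go (Respond.respond (Legal.position legal) invariant (λ { refl → <-irrefl refl x<y })
      (not-adj x y (Legal.sortedᶜ legal) x<y x∉C) (not-adj x y (Legal.sortedᵇ legal) x<y x∉B) (adj-adds x y C)
      (Legal.position legal') free')
  where
  open State s
  C' : Graph n
  C' = (x , y) ∷ C
  legal' : Legal C' B
  legal' = legal-C legal j
  free' : P6Free (adj C')
  free' = P6-free C' (sorted-simple (Legal.sortedᶜ legal')) free
  oriented : ∀ {e f g} → e ≡ (f , g) ⊎ e ≡ (g , f) → Simple (adj (e ∷ B)) → Adds (adj B) f g (adj (e ∷ B))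
  oriented (inj₁ refl) _ = adj-adds _ _ B
  oriented (inj₂ refl) sm = adds-swap sm (adj-adds _ _ B)
  go : Answer (adj C') (adj B) → Defence C' B
  go (inj₁ I) = anything (record { legal = legal' ; path-free = free' ; invariant = I }) λ { {u , v} k → record
    { legal = legal-B legal' k ; path-free = free'
    ; invariant = invariant-mono (record { position = Legal.position (legal-B legal' k) ; keep = λ {p} {q} → Adds.old (adj-adds u v B) {p} {q} }) I } }
  go (inj₂ (f , g , f≢g , ¬c , ¬b , I)) with edge-of f g f≢g
  ... | e , or , lt = reply k (record { legal = legal-B legal' k ; path-free = free'
          ; invariant = I (oriented or (sorted-simple (Legal.sortedᵇ (legal-B legal' k)))) (Legal.position (legal-B legal' k)) })
    where
    joins : ∀ {e} {G : Graph n} → e ≡ (f , g) ⊎ e ≡ (g , f) → e ∈ G → T (adj G f g)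
    joins (inj₁ refl) i = adj⁺ f g (inj₁ i)
    joins (inj₂ refl) i = adj⁺ f g (inj₂ i)
    k : e ∈ unclaimed C' B
    k = unclaimed⁺ {C = C'} {B} lt (¬c ∘ joins {e} {C'} or) (¬b ∘ joins {e} {B} or)

maxL-bound : {A : Set} {k : ℕ} (f : A → ℕ) (xs : List A) → (∀ {x} → x ∈ xs → 2 * f x ≤ k) → 2 * maxL (map f xs) ≤ k
maxL-bound f [] h = z≤n
maxL-bound {k = k} f (x ∷ xs) h = ≤-trans (≤-reflexive (*-distribˡ-⊔ 2 (f x) (maxL (map f xs))))
  (⊔-lub (h (here refl)) (maxL-bound f xs (h ∘ there)))

minL-bound : {A : Set} (f : A → ℕ) {x : A} (y : A) (ys : List A) → x ∈ y ∷ ys → minL (f y) (map f ys) ≤ f x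
minL-bound f y [] (here refl) = ≤-refl
minL-bound f y (z ∷ ys) (here refl) = ≤-trans (m⊓n≤n (f z) _) (minL-bound f y ys (here refl))
minL-bound f y (z ∷ ys) (there (here refl)) = m⊓n≤m (f z) _
minL-bound f y (z ∷ ys) (there (there i)) = ≤-trans (m⊓n≤n (f z) _) (minL-bound f y ys (there i))

value-C : (f : ℕ) (C B : Graph n) → (value (suc f) true C B ≡ triangles C × legalC C B ≡ []) ⊎
  (∃[ e ] e ∈ legalC C B) × value (suc f) true C B ≡ maxL (map (λ e → value f false (e ∷ C) B) (legalC C B))
value-C f C B with legalC C B
... | [] = inj₁ (refl , refl)
... | e ∷ _ = inj₂ ((e , here refl) , refl)

value-B : (f : ℕ) (C B : Graph n) →
  (value (suc f) false C B ≡ triangles C × (legalC C B ≡ [] ⊎ unclaimed C B ≡ [])) ⊎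
  ∃[ e ] ∃[ es ] unclaimed C B ≡ e ∷ es ×
    value (suc f) false C B ≡ minL (value f true C (e ∷ B)) (map (λ e' → value f true C (e' ∷ B)) es)
value-B f C B with legalC C B
... | [] = inj₁ (refl , inj₁ refl)
... | _ ∷ _ with unclaimed C B
...   | [] = inj₁ (refl , inj₂ refl)
...   | e ∷ es = inj₂ (e , es , refl , refl)

mutual
  -- The bound holds in every state of play, so it also holds wherever the fuel ends.
  upperᶜ : (f : ℕ) {C B : Graph n} → State C B → 2 * value f true C B ≤ n
  upperᶜ zero s = state-bound s
  upperᶜ (suc f) {C} {B} s with value-C f C B
  ... | inj₁ (e , _) rewrite e = state-bound s
  ... | inj₂ (_ , e) rewrite e = maxL-bound (λ e' → value f false (e' ∷ C) B) (legalC C B) (λ i → upperᵇ f (defend s i))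

  -- If the game ends before the prescribed reply, the state after that reply still bounds the
  -- score, which depends on `C` alone.
  upperᵇ : (f : ℕ) {C B : Graph n} → Defence C B → 2 * value f false C B ≤ n
  upperᵇ zero (anything s _) = state-bound s
  upperᵇ zero (reply _ s) = state-bound s
  upperᵇ (suc f) {C} {B} (anything s r) with value-B f C B
  ... | inj₁ (e , _) rewrite e = state-bound s
  ... | inj₂ (e₀ , es , u , e) rewrite e = ≤-trans (*-monoʳ-≤ 2 (minL-bound (λ e' → value f true C (e' ∷ B)) e₀ es (here refl)))
        (upperᶜ f (r (subst (e₀ ∈_) (sym u) (here refl))))
  upperᵇ (suc f) {C} {B} (reply i s) with value-B f C B
  ... | inj₁ (e , _) rewrite e = state-bound s
  ... | inj₂ (e₀ , es , u , e) rewrite e = ≤-trans (*-monoʳ-≤ 2 (minL-bound (λ e' → value f true C (e' ∷ B)) e₀ es (subst (_ ∈_) u i)))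
        (upperᶜ f s)

start : {n : ℕ} → State {n} [] []
start {n} = record
  { legal = record { sortedᶜ = λ () ; sortedᵇ = λ () ; separate = λ () }
  ; path-free = λ ()
  ; invariant = record
    { L = λ z → z
    ; classes = record { lab = λ () ; cut = λ S su sw e → ⊥-elim (sw (subst (T ∘ S) e su)) }
    ; good = record { dirty = λ () ; budget = λ () ; blocked = λ () ; open-pair = λ { _ _ _ _ () _ } }
    ; sparse = λ s _ → ≤-trans (≤-reflexive (cong (2 *_) (cnt-≡0 (λ _ ()) (pairs (allFin n))))) z≤n } }

upper : (n : ℕ) → 2 * g n ≤ n
upper n = upperᶜ (length (allEdges n)) start

-- Playing for a number of triangles

tri-word⁻ : {c : Adj n} (w : List (Fin n)) → T (tri-word c w) →
  ∃[ x ] ∃[ y ] ∃[ z ] w ≡ x ∷ y ∷ z ∷ [] × toℕ x < toℕ y × toℕ y < toℕ z × T (c x y) × T (c y z) × T (c x z)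
tri-word⁻ {c = c} (x ∷ y ∷ z ∷ []) t with ∧⁻ {toℕ x <ᵇ toℕ y} t
... | xy , t₁ with ∧⁻ {toℕ y <ᵇ toℕ z} t₁
... | yz , t₂ with ∧⁻ {c x y} t₂
... | e , t₃ with ∧⁻ {c y z} t₃
... | f , g = x , y , z , refl , <ᵇ⇒< _ _ xy , <ᵇ⇒< _ _ yz , e , f , g

tri-word⁺ : {c : Adj n} {x y z : Fin n} → toℕ x < toℕ y → toℕ y < toℕ z → T (c x y) → T (c y z) → T (c x z) →
  T (tri-word c (x ∷ y ∷ z ∷ []))
tri-word⁺ {c = c} {x} {y} {z} xy yz e f g =
  ∧⁺ {toℕ x <ᵇ toℕ y} (<⇒<ᵇ xy) (∧⁺ {toℕ y <ᵇ toℕ z} (<⇒<ᵇ yz) (∧⁺ {c x y} e (∧⁺ {c y z} f g)))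

tri-word-mono : {c c' : Adj n} → (∀ {u v} → T (c u v) → T (c' u v)) → ∀ w → T (tri-word c w) → T (tri-word c' w)
tri-word-mono {c = c} {c'} f w t with tri-word⁻ {c = c} w t
... | x , y , z , refl , xy , yz , e , h , k = tri-word⁺ {c = c'} xy yz (f e) (f h) (f k)

triangles-mono : (e : Edge n) (C : Graph n) → triangles C ≤ triangles (e ∷ C)
triangles-mono {n} (x , y) C = subst₂ _≤_ (sym (triangles≡ C)) (sym (triangles≡ ((x , y) ∷ C)))
  (cnt-mono (tri-word-mono {c = adj C} {adj ((x , y) ∷ C)} (λ {u} {v} → Adds.old (adj-adds x y C) {u} {v})) (words {n} 3))

-- The three vertices are sorted into an increasing word. It is counted for `c'` but not for `c`,
-- which lacks the edge `v w`.
extra-triangle : {c c' : Adj n} → Simple c' → (∀ {u v} → T (c u v) → T (c' u v)) →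
  (u v w : Fin n) → Shape.Tri c' (λ i → i) u v w → Simple c → ¬ T (c v w) →
  suc (cnt (tri-word c) (words {n} 3)) ≤ cnt (tri-word c') (words {n} 3)
extra-triangle {n} {c} {c'} S mono u v w (uv , uw , vw) S₀ new = ≤-trans
    (+-monoˡ-≤ _ (found sorted))
    (cnt-⊎ {p = λ t → tri-word c' t ∧ not (tri-word c t)} {q = tri-word c} (λ t k k' → not⁻ (proj₂ (∧⁻ {tri-word c' t} k)) k')
      (λ t k → proj₁ (∧⁻ {tri-word c' t} k)) (tri-word-mono {c = c} {c'} mono) (words {n} 3))
  where
  open Simple S
  open Shape c (λ i → i)
  sy₀ = λ {u v} → Simple.sy S₀ {u} {v}
  Sorted₃ : Set
  Sorted₃ = ∃[ x ] ∃[ y ] ∃[ z ] toℕ x < toℕ y × toℕ y < toℕ z × T (c' x y) × T (c' y z) × T (c' x z) ×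
    (Tri x y z → T (c v w))
  cmp : ∀ (i j : Fin n) → i ≢ j → toℕ i < toℕ j ⊎ toℕ j < toℕ i
  cmp i j ne with <-cmp (toℕ i) (toℕ j)
  ... | tri< h _ _ = inj₁ h
  ... | tri≈ _ e _ = ⊥-elim (ne (toℕ-injective e))
  ... | tri> _ _ h = inj₂ h
  sorted : Sorted₃
  sorted with cmp u v (~≢ uv) | cmp v w (~≢ vw) | cmp u w (~≢ uw)
  ... | inj₁ a | inj₁ b | _ = u , v , w , a , b , uv , vw , uw , λ (_ , _ , h) → h
  ... | inj₁ a | inj₂ b | inj₁ d = u , w , v , d , b , uw , sy vw , uv , λ (_ , _ , h) → sy₀ h
  ... | inj₁ a | inj₂ b | inj₂ d = w , u , v , d , a , sy uw , uv , sy vw , λ (_ , h , _) → sy₀ h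
  ... | inj₂ a | inj₁ b | inj₁ d = v , u , w , a , d , sy uv , uw , vw , λ (_ , h , _) → h
  ... | inj₂ a | inj₁ b | inj₂ d = v , w , u , b , d , vw , sy uw , sy uv , λ (h , _) → h
  ... | inj₂ a | inj₂ b | _ = w , v , u , b , a , sy vw , sy uv , sy uw , λ (h , _) → sy₀ h
  found : Sorted₃ → 1 ≤ cnt (λ t → tri-word c' t ∧ not (tri-word c t)) (words {n} 3)
  found (x , y , z , xy , yz , e , f , g , h) = cnt-≥1 (words-∈ (x ∷ y ∷ z ∷ []))
    (∧⁺ (tri-word⁺ {c = c'} {x} {y} {z} xy yz e f g) (not⁺ λ t → go (tri-word⁻ {c = c} (x ∷ y ∷ z ∷ []) t)))
    where
    go : ¬ (∃[ x' ] ∃[ y' ] ∃[ z' ] x ∷ y ∷ z ∷ [] ≡ x' ∷ y' ∷ z' ∷ [] × toℕ x' < toℕ y' × toℕ y' < toℕ z' × T (c x' y') × T (c y' z') × T (c x' z'))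
    go (_ , _ , _ , refl , _ , _ , e , f , g) = new (h (e , g , f))

maxL-≥ : {A : Set} (f : A → ℕ) {x : A} {xs : List A} → x ∈ xs → f x ≤ maxL (map f xs)
maxL-≥ f (here refl) = m≤m⊔n _ _
maxL-≥ f {xs = y ∷ ys} (there i) = ≤-trans (maxL-≥ f i) (m≤n⊔m (f y) (maxL (map f ys)))

minL-≥ : {A : Set} {k : ℕ} (f : A → ℕ) (x : A) (xs : List A) → (∀ {y} → y ∈ x ∷ xs → k ≤ f y) → k ≤ minL (f x) (map f xs)
minL-≥ f x [] h = h (here refl)
minL-≥ f x (y ∷ ys) h = ⊓-glb (h (there (here refl)))
  (minL-≥ f x ys λ { (here e) → h (here e) ; (there i) → h (there (there i)) })

value≥triangles : (f : ℕ) (turn : Bool) (C B : Graph n) → triangles C ≤ value f turn C B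
value≥triangles zero turn C B = ≤-refl
value≥triangles (suc f) true C B with value-C f C B
... | inj₁ (e , _) = ≤-reflexive (sym e)
... | inj₂ ((e₀ , i) , e) = ≤-trans (triangles-mono e₀ C) (≤-trans (value≥triangles f false (e₀ ∷ C) B)
      (≤-trans (maxL-≥ (λ e → value f false (e ∷ C) B) i) (≤-reflexive (sym e))))
value≥triangles (suc f) false C B with value-B f C B
... | inj₁ (e , _) = ≤-reflexive (sym e)
... | inj₂ (e₀ , es , _ , e) = ≤-trans (minL-≥ (λ e' → value f true C (e' ∷ B)) e₀ es (λ _ → value≥triangles f true C _)) (≤-reflexive (sym e))

-- For the lower bound the fuel matters: Constructor must be able to finish her plan, so it is at
-- least the number of unclaimed edges.
record Wins {n : ℕ} (t : ℕ) (C B : Graph n) : Set where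
  constructor wins
  field
    reach : ∀ f → length (unclaimed C B) ≤ f → t ≤ value f true C B

open Wins

wins-now : {t : ℕ} {C B : Graph n} → t ≤ triangles C → Wins t C B
wins-now {C = C} {B} h = wins λ f _ → ≤-trans h (value≥triangles f true C B)

fewer : (m m' : Edge n → Bool) {e : Edge n} → e ∈ allEdges n → ¬ T (m e) → T (m' e) → (∀ f → T (m f) → T (m' f)) →
  suc (length (bfilter (λ f → not (m' f)) (allEdges n))) ≤ length (bfilter (λ f → not (m f)) (allEdges n))
fewer {n} m m' {e} i ne e' sub = subst₂ _≤_ (cong suc (sym (cnt-bfilter _ (allEdges n)))) (sym (cnt-bfilter _ (allEdges n)))
  (≤-trans (+-monoˡ-≤ _ (cnt-≥1 {p = λ f → sameE f e} i (sameE⁺ e)))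
    (cnt-⊎ {p = λ f → sameE f e} {q = λ f → not (m' f)} {r = λ f → not (m f)}
      (λ f s t → not⁻ t (subst (T ∘ m') (sym (sameE⁻ {e = f} {e} s)) e'))
      (λ f s → not⁺ λ t → ne (subst (T ∘ m) (sameE⁻ {e = f} {e} s) t))
      (λ f t → not⁺ λ s → not⁻ t (sub f s)) (allEdges n)))

fewer-C : {e : Edge n} (C B : Graph n) → e ∈ unclaimed C B → suc (length (unclaimed (e ∷ C) B)) ≤ length (unclaimed C B)
fewer-C {n} {e} C B i with bfilter-∈⁻ _ (allEdges n) i
... | j , t = fewer (λ f → memE f C ∨ memE f B) (λ f → memE f (e ∷ C) ∨ memE f B) j (not⁻ t)
  (∨⁺ˡ (memE e B) (∨⁺ˡ (memE e C) (sameE⁺ e)))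
  (λ f t → [ (λ h → ∨⁺ˡ (memE f B) (∨⁺ʳ (sameE f e) h)) , ∨⁺ʳ (memE f (e ∷ C)) ]′ (∨⁻ {memE f C} t))

fewer-B : {e : Edge n} (C B : Graph n) → e ∈ unclaimed C B → suc (length (unclaimed C (e ∷ B))) ≤ length (unclaimed C B)
fewer-B {n} {e} C B i with bfilter-∈⁻ _ (allEdges n) i
... | j , t = fewer (λ f → memE f C ∨ memE f B) (λ f → memE f C ∨ memE f (e ∷ B)) j (not⁻ t)
  (∨⁺ʳ (memE e C) (∨⁺ˡ (memE e B) (sameE⁺ e)))
  (λ f t → [ ∨⁺ˡ (memE f (e ∷ B)) , (λ h → ∨⁺ʳ (memE f C) (∨⁺ʳ (sameE f e) h)) ]′ (∨⁻ {memE f C} t))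

-- `pass` is not a move of the game. It stands for play ending on Blocker's turn, where the score is
-- read off before he has claimed anything.
data Reply {n : ℕ} (C B : Graph n) : Graph n → Set where
  pass : Reply C B B
  claim : {e : Edge n} → e ∈ unclaimed C B → Reply C B (e ∷ B)

wins-move : {t : ℕ} {C B : Graph n} {e : Edge n} → e ∈ legalC C B →
  (∀ {B'} → Reply (e ∷ C) B B' → Wins t (e ∷ C) B') → Wins t C B
wins-move {n} {t} {C} {B} {e} i w = wins reached
  where
  reached : ∀ f → length (unclaimed C B) ≤ f → t ≤ value f true C B
  reached zero h with legalC⁻ C B i
  ... | j , _ = ⊥-elim (<⇒≱ (s≤s z≤n) (≤-trans (fewer-C C B j) h))
  reached (suc f) h with value-C f C B
  ... | inj₁ (_ , eq) with subst (e ∈_) eq i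
  ...   | ()
  reached (suc f) h | inj₂ (_ , eq) = ≤-trans (after f fuel)
      (≤-trans (maxL-≥ (λ e → value f false (e ∷ C) B) i) (≤-reflexive (sym eq)))
    where
      fuel : length (unclaimed (e ∷ C) B) ≤ f
      fuel = ≤-pred (≤-trans (fewer-C C B (proj₁ (legalC⁻ C B i))) h)
      C' = e ∷ C
      -- One unit of fuel beyond the unclaimed edges makes `value` inspect `legalC`, which turns the
      -- promise after `pass` into a statement about `triangles`.
      at-end : legalC C' B ≡ [] → t ≤ triangles C'
      at-end eq with reach (w pass) (suc (length (unclaimed C' B))) (n≤1+n _) | value-C (length (unclaimed C' B)) C' B
      ... | le | inj₁ (e , _) = ≤-trans le (≤-reflexive e)
      ... | le | inj₂ ((_ , j) , _) with subst (_ ∈_) eq j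
      ...   | ()
      no-legal : unclaimed C' B ≡ [] → legalC C' B ≡ []
      no-legal eq rewrite eq = refl
      after : ∀ f → length (unclaimed C' B) ≤ f → t ≤ value f false C' B
      after zero h = reach (w pass) zero h
      after (suc f) h with value-B f C' B
      ... | inj₁ (e , inj₁ eq) = ≤-trans (at-end eq) (≤-reflexive (sym e))
      ... | inj₁ (e , inj₂ eq) = ≤-trans (at-end (no-legal eq)) (≤-reflexive (sym e))
      ... | inj₂ (e₀ , es , eq , e) = ≤-trans (minL-≥ (λ e' → value f true C' (e' ∷ B)) e₀ es
            (λ {e'} j → let k = subst (e' ∈_) (sym eq) j in reach (w (claim k)) f (≤-pred (≤-trans (fewer-B C' B k) h)))) (≤-reflexive (sym e))

-- Constructor's strategy

End : Fin n → Fin n → Fin n → Set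
End z x y = z ≡ x ⊎ z ≡ y

private
  apart : {z p q p' q' : Fin n} → p ≢ p' → p ≢ q' → q ≢ p' → q ≢ q' → End z p q → End z p' q' → ⊥
  apart h _ _ _ (inj₁ refl) (inj₁ e) = h e
  apart _ h _ _ (inj₁ refl) (inj₂ e) = h e
  apart _ _ h _ (inj₂ refl) (inj₁ e) = h e
  apart _ _ _ h (inj₂ refl) (inj₂ e) = h e

  pigeonhole : {ρ σ a b d e f g : Fin n} → a ≢ d → a ≢ e → a ≢ f → a ≢ g → b ≢ d → b ≢ e → b ≢ f → b ≢ g →
    d ≢ f → d ≢ g → e ≢ f → e ≢ g → End ρ a b ⊎ End σ a b → End ρ d e ⊎ End σ d e → End ρ f g ⊎ End σ f g → ⊥
  pigeonhole ad ae af ag bd be bf bg df dg ef eg = go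
    where
    go : End _ _ _ ⊎ End _ _ _ → End _ _ _ ⊎ End _ _ _ → End _ _ _ ⊎ End _ _ _ → ⊥
    go (inj₁ x) (inj₁ y) _ = apart ad ae bd be x y
    go (inj₁ x) (inj₂ y) (inj₁ z) = apart af ag bf bg x z
    go (inj₁ x) (inj₂ y) (inj₂ z) = apart df dg ef eg y z
    go (inj₂ x) (inj₁ y) (inj₁ z) = apart df dg ef eg y z
    go (inj₂ x) (inj₁ y) (inj₂ z) = apart af ag bf bg x z
    go (inj₂ x) (inj₂ y) _ = apart ad ae bd be x y

  relabel : {s : Fin n → Fin n} {ρ σ x y : Fin n} → ρ ≡ σ → End σ x y ⊎ End (s σ) x y → End ρ x y ⊎ End (s ρ) x y
  relabel refl h = h

-- The component of x is labelled by its first hub r x, and every edge contains r x or the second hub s (r x).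
record Board {n : ℕ} (C B : Graph n) (F : Fin n → Bool) (r s : Fin n → Fin n) : Set where
  field
    legal : Legal C B
    covered : ∀ {x y} → (x , y) ∈ C → r x ≡ r y × (End (r x) x y ⊎ End (s (r x)) x y) × ¬ T (F (r x))
    isolated : ∀ {z y} → T (F z) → ¬ (z , y) ∈ C × ¬ (y , z) ∈ C

  covered-adj : ∀ x y → T (adj C x y) → r x ≡ r y × (End (r x) x y ⊎ End (s (r x)) x y)
  covered-adj x y t with adj⁻ x y C t
  ... | inj₁ i = let e , h , _ = covered i in e , h
  ... | inj₂ i = let e , h , _ = covered i in sym e , subst (λ ρ → End ρ x y ⊎ End (s ρ) x y) e (Sum.map Sum.swap Sum.swap h)

  no-fresh : ∀ x y → T (adj C x y) → ¬ T (F x) × ¬ T (F y)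
  no-fresh x y t with adj⁻ x y C t
  ... | inj₁ i = (λ f → proj₁ (isolated f) i) , (λ f → proj₂ (isolated f) i)
  ... | inj₂ i = (λ f → proj₂ (isolated f) i) , (λ f → proj₁ (isolated f) i)

  -- A path on six vertices has three disjoint edges, and two hubs cannot meet them all.
  no-P6 : ¬ T (containsP6 C)
  no-P6 t with find (or⁻ (λ w → distinct w ∧ isWalk C w) (words 6) t)
  ... | w , i , t' = go w (words-length 6 i) t'
    where
    go : ∀ w → length w ≡ 6 → ¬ T (distinct w ∧ isWalk C w)
    go (a ∷ b ∷ d ∷ e ∷ f ∷ g ∷ []) refl t with ∧⁻ {distinct (a ∷ b ∷ d ∷ e ∷ f ∷ g ∷ [])} t
    ... | δ , ω with ∧⁻ {notIn a (b ∷ d ∷ e ∷ f ∷ g ∷ [])} δ | ∧⁻ {adj C a b} ω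
    ... | a∉ , δ₁ | ab , ω₁ with ∧⁻ {notIn b (d ∷ e ∷ f ∷ g ∷ [])} δ₁ | ∧⁻ {adj C b d} ω₁
    ... | b∉ , δ₂ | bd , ω₂ with ∧⁻ {notIn d (e ∷ f ∷ g ∷ [])} δ₂ | ∧⁻ {adj C d e} ω₂
    ... | d∉ , δ₃ | de , ω₃ with ∧⁻ {notIn e (f ∷ g ∷ [])} δ₃ | ∧⁻ {adj C e f} ω₃
    ... | e∉ , _ | ef , ω₄ with ∧⁻ {adj C f g} ω₄
    ... | fg , _ with notIn⁻ (b ∷ d ∷ e ∷ f ∷ g ∷ []) a∉ | notIn⁻ (d ∷ e ∷ f ∷ g ∷ []) b∉ | notIn⁻ (e ∷ f ∷ g ∷ []) d∉ | notIn⁻ (f ∷ g ∷ []) e∉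
    ... | _ ∷ a≢d ∷ a≢e ∷ a≢f ∷ a≢g ∷ [] | b≢d ∷ b≢e ∷ b≢f ∷ b≢g ∷ [] | _ ∷ d≢f ∷ d≢g ∷ [] | e≢f ∷ e≢g ∷ []
      with covered-adj a b ab | proj₁ (covered-adj b d bd) | covered-adj d e de | proj₁ (covered-adj e f ef) | covered-adj f g fg
    ... | rab , h₁ | rbd | rde , h₂ | ref | _ , h₃ =
      pigeonhole a≢d a≢e a≢f a≢g b≢d b≢e b≢f b≢g d≢f d≢g e≢f e≢g
        h₁ (relabel {s = s} (trans rab rbd) h₂) (relabel {s = s} (trans (trans rab rbd) (trans rde ref)) h₃)

open Board

upd : (Fin n → Fin n) → Fin n → Fin n → Fin n → Fin n
upd f a b z with z ≟ᶠ a
... | yes _ = b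
... | no _ = f z

upd-at : (f : Fin n → Fin n) (a b : Fin n) → upd f a b a ≡ b
upd-at f a b with a ≟ᶠ a
... | yes _ = refl
... | no ne = ⊥-elim (ne refl)

upd-off : (f : Fin n → Fin n) {a b z : Fin n} → z ≢ a → upd f a b z ≡ f z
upd-off f {a} {b} {z} ne with z ≟ᶠ a
... | yes e = ⊥-elim (ne e)
... | no _ = refl

_∖_ : (Fin n → Bool) → Fin n → Fin n → Bool
(F ∖ a) z = F z ∧ not (z == a)

∖-size : (F : Fin n → Bool) (a : Fin n) → V# F ≤ suc (V# (F ∖ a))
∖-size {n} F a = ≤-trans (cnt-∪ {p = _== a} {q = F ∖ a} split (allFin n)) (+-monoˡ-≤ (V# (F ∖ a)) (V#-point≤1 a))
  where
  split : ∀ z → T (F z) → T (z == a) ⊎ T ((F ∖ a) z)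
  split z t with T? (z == a)
  ... | yes e = inj₁ e
  ... | no ne = inj₂ (∧⁺ t (not⁺ ne))

∖-off : {F : Fin n → Bool} {a z : Fin n} → T ((F ∖ a) z) → T (F z) × z ≢ a
∖-off {F = F} {a} {z} t = let p , q = ∧⁻ {F z} t in p , λ e → not⁻ q (==⁺ e)

∖-on : {F : Fin n → Bool} {a z : Fin n} → T (F z) → z ≢ a → T ((F ∖ a) z)
∖-on t ne = ∧⁺ t (not⁺ (ne ∘ ==⁻))

module _ {C B : Graph n} {F : Fin n → Bool} {r s : Fin n → Fin n} (b : Board C B F r s) where
  -- A fresh vertex lies on no edge, so moving it to the component of `u` leaves the hubs of all
  -- edges unchanged.
  adopt : (u a : Fin n) → T (F a) → Board C B (F ∖ a) (upd r a u) s
  adopt u a fa = record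
    { legal = legal b
    ; covered = λ {x} {y} i → let e , h , f = covered b i
                                  ex = upd-off r {b = u} λ { refl → proj₁ (isolated b fa) i }
                                  ey = upd-off r {b = u} λ { refl → proj₂ (isolated b fa) i }
        in trans ex (trans e (sym ey)) , subst (λ ρ → End ρ x y ⊎ End (s ρ) x y) (sym ex) h
         , λ t → f (subst (T ∘ F) ex (proj₁ (∖-off {F = F} t)))
    ; isolated = λ t → isolated b (proj₁ (∖-off {F = F} t)) }

  -- While all edges of the component contain `u`, its second hub is arbitrary. It can thus be
  -- chosen late, when Blocker's replies to the star are known.
  second-hub : (u v : Fin n) → (∀ {x y} → (x , y) ∈ C → r x ≡ u → End u x y) → Board C B F r (upd s u v)
  second-hub u v all = record { legal = legal b ; isolated = isolated b ; covered = cov }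
    where
    cov : ∀ {x y} → (x , y) ∈ C → r x ≡ r y × (End (r x) x y ⊎ End (upd s u v (r x)) x y) × ¬ T (F (r x))
    cov {x} {y} i = let e , h , f = covered b i in e , go h (r x ≟ᶠ u) , f
      where
      go : End (r x) x y ⊎ End (s (r x)) x y → Dec (r x ≡ u) → End (r x) x y ⊎ End (upd s u v (r x)) x y
      go h (yes eu) = inj₁ (subst (λ ρ → End ρ x y) (sym eu) (all i eu))
      go h (no ne) = Sum.map₂ (subst (λ σ → End σ x y) (sym (upd-off s ne))) h

  board-reply : {B' : Graph n} → Reply C B B' → Board C B' F r s
  board-reply pass = b
  board-reply (claim i) = record { legal = legal-B (legal b) i ; covered = covered b ; isolated = isolated b }

  module Claim {x y : Fin n} (x≢y : x ≢ y) (¬c : ¬ T (adj C x y)) (¬b : ¬ T (adj B x y))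
      (same : r x ≡ r y) (hub : End (r x) x y ⊎ End (s (r x)) x y) (nr : ¬ T (F (r x))) (nx : ¬ T (F x)) (ny : ¬ T (F y)) where
    private
      oriented = edge-of x y x≢y
    edge : Edge n
    edge = proj₁ oriented

    is-xy : edge ≡ (x , y) ⊎ edge ≡ (y , x)
    is-xy = proj₁ (proj₂ oriented)

    private
      joins : ∀ {e} {G : Graph n} → e ≡ (x , y) ⊎ e ≡ (y , x) → e ∈ G → T (adj G x y)
      joins (inj₁ refl) i = adj⁺ x y (inj₁ i)
      joins (inj₂ refl) i = adj⁺ x y (inj₂ i)

    free : edge ∈ unclaimed C B
    free = unclaimed⁺ {C = C} {B} (proj₂ (proj₂ oriented)) (¬c ∘ joins is-xy) (¬b ∘ joins is-xy)

    simple : Simple (adj (edge ∷ C))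
    simple = sorted-simple (Legal.sortedᶜ (legal-C (legal b) free))

    adds : Adds (adj C) x y (adj (edge ∷ C))
    adds = go is-xy simple
      where
      go : ∀ {e} → e ≡ (x , y) ⊎ e ≡ (y , x) → Simple (adj (e ∷ C)) → Adds (adj C) x y (adj (e ∷ C))
      go (inj₁ refl) _ = adj-adds x y C
      go (inj₂ refl) sm = adds-swap sm (adj-adds y x C)

    kept : ∀ p q → T (adj C p q) → T (adj (edge ∷ C) p q)
    kept p q = Adds.old adds {p} {q}

    board : Board (edge ∷ C) B F r s
    board = record { legal = legal-C (legal b) free ; covered = cov is-xy ; isolated = λ f → iso is-xy f }
      where
      cov : ∀ {e} → e ≡ (x , y) ⊎ e ≡ (y , x) → ∀ {p q} → (p , q) ∈ e ∷ C →
        r p ≡ r q × (End (r p) p q ⊎ End (s (r p)) p q) × ¬ T (F (r p))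
      cov _ (there i) = covered b i
      cov (inj₁ refl) (here refl) = same , hub , nr
      cov (inj₂ refl) (here refl) = sym same , subst (λ ρ → End ρ y x ⊎ End (s ρ) y x) same (Sum.map Sum.swap Sum.swap hub) ,
        subst (λ ρ → ¬ T (F ρ)) same nr
      iso : ∀ {e} → e ≡ (x , y) ⊎ e ≡ (y , x) → ∀ {z w} → T (F z) → ¬ (z , w) ∈ e ∷ C × ¬ (w , z) ∈ e ∷ C
      iso h {z} {w} f = left h , right h
        where
        left : ∀ {e} → e ≡ (x , y) ⊎ e ≡ (y , x) → ¬ (z , w) ∈ e ∷ C
        left (inj₁ refl) (here refl) = nx f
        left (inj₂ refl) (here refl) = ny f
        left _ (there i) = proj₁ (isolated b f) i
        right : ∀ {e} → e ≡ (x , y) ⊎ e ≡ (y , x) → ¬ (w , z) ∈ e ∷ C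
        right (inj₁ refl) (here refl) = ny f
        right (inj₂ refl) (here refl) = nx f
        right _ (there i) = proj₂ (isolated b f) i

    playable : edge ∈ legalC C B
    playable = bfilter-∈⁺ _ free (not⁺ (no-P6 board))

-- A new edge of Blocker meets `v` in at most one pair. Every turn therefore costs two candidates,
-- the one used and the one blocked, whence the factor 2 in both phases.
still-open : {C B B' : Graph n} → Reply C B B' → (v : Fin n) {A : List (Fin n)} → Unique A → All (λ z → ¬ T (adj B v z)) A →
  length A ≤ suc (length (bfilter (λ z → not (adj B' v z)) A))
still-open {n} {C} {B} {B'} rep v {A} uq al = ≤-trans (≤-reflexive (sym (cnt-true A)))
  (≤-trans (cnt-∪∈ {p = hit} {q = λ z → not (adj B' v z)} A split)
  (+-mono-≤ (cnt-≤1 (λ {p} {q} → once rep p q) uq) (≤-reflexive (sym (cnt-bfilter _ A)))))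
  where
  hit : Fin n → Bool
  hit z = adj B' v z ∧ not (adj B v z)
  split : ∀ {z} → z ∈ A → T true → T (hit z) ⊎ T (not (adj B' v z))
  split {z} i _ with T? (adj B' v z)
  ... | yes t = inj₁ (∧⁺ t (not⁺ (All.lookup al i)))
  ... | no t = inj₂ (not⁺ t)
  once : ∀ {B'} → Reply C B B' → ∀ p q → T (adj B' v p ∧ not (adj B v p)) → T (adj B' v q ∧ not (adj B v q)) → p ≡ q
  once pass p q t _ = let h , k = ∧⁻ {adj B v p} t in ⊥-elim (not⁻ k h)
  once (claim {x , y} _) p q t t' = go (Adds.only (adj-adds x y B) {v} {p} (proj₁ (∧⁻ {adj ((x , y) ∷ B) v p} t)))
                                       (Adds.only (adj-adds x y B) {v} {q} (proj₁ (∧⁻ {adj ((x , y) ∷ B) v q} t')))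
    where
    go : T (adj B v p) ⊎ (v ≡ x × p ≡ y) ⊎ (v ≡ y × p ≡ x) → T (adj B v q) ⊎ (v ≡ x × q ≡ y) ⊎ (v ≡ y × q ≡ x) → p ≡ q
    go (inj₁ h) _ = ⊥-elim (not⁻ (proj₂ (∧⁻ {adj ((x , y) ∷ B) v p} t)) h)
    go _ (inj₁ h) = ⊥-elim (not⁻ (proj₂ (∧⁻ {adj ((x , y) ∷ B) v q} t')) h)
    go (inj₂ (inj₁ (refl , refl))) (inj₂ (inj₁ (_ , refl))) = refl
    go (inj₂ (inj₁ (refl , refl))) (inj₂ (inj₂ (refl , refl))) = refl
    go (inj₂ (inj₂ (refl , refl))) (inj₂ (inj₁ (refl , refl))) = refl
    go (inj₂ (inj₂ (refl , refl))) (inj₂ (inj₂ (_ , refl))) = refl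

open Board

-- From a star to a book

reply-length : {C B B' : Graph n} → Reply C B B' → length B' ≤ suc (length B)
reply-length pass = n≤1+n _
reply-length (claim _) = ≤-refl

record Book {n : ℕ} (t : ℕ) (C B : Graph n) (F : Fin n → Bool) (r s : Fin n → Fin n) (u v : Fin n) (A : List (Fin n)) : Set where
  field
    board : Board C B F r s
    score : t ≤ triangles C
    used : ¬ T (F u)
    root : r v ≡ u
    second : s u ≡ v
    spine : T (adj C u v)
    unique : Unique A
    pages : All (λ z → T (adj C u z) × r z ≡ u × z ≢ v × ¬ T (adj C v z)) A
    open-pages : All (λ z → ¬ T (adj B v z)) A

private
  tail₂ : ∀ {q a} → 2 * suc q ≤ suc a → ∀ {a'} → a ≤ suc a' → 2 * q ≤ a'
  tail₂ {q} {a} h {a'} k = ≤-pred (≤-pred (≤-trans (≤-reflexive (sym (*-suc 2 q))) (≤-trans h (s≤s k))))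

module _ {t : ℕ} {C B : Graph n} {F : Fin n → Bool} {r s : Fin n → Fin n} {u v z : Fin n} {A : List (Fin n)}
    (b : Book t C B F r s u v (z ∷ A)) where
  open Book b

  private
    uz = proj₁ (All.head pages)
    rz = proj₁ (proj₂ (All.head pages))
    z≢v = proj₁ (proj₂ (proj₂ (All.head pages)))
    ¬vz = proj₂ (proj₂ (proj₂ (All.head pages)))
    module M = Claim board {v} {z} (z≢v ∘ sym) ¬vz (All.head open-pages) (trans root (sym rz))
      (inj₂ (inj₁ (trans (cong s root) second))) (λ f → used (subst (T ∘ F) root f))
      (proj₂ (no-fresh board u v spine)) (proj₂ (no-fresh board u z uz))

  page-move : M.edge ∈ legalC C B
  page-move = M.playable

  page-gain : suc t ≤ triangles (M.edge ∷ C)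
  page-gain = ≤-trans (s≤s score) (subst₂ _≤_ (cong suc (sym (triangles≡ C))) (sym (triangles≡ (M.edge ∷ C)))
    (extra-triangle {c = adj C} {adj (M.edge ∷ C)} M.simple (λ {p} {q} → M.kept p q) u v z
      (M.kept u v spine , M.kept u z uz , Adds.new M.adds) (Legal.simpleᶜ (legal board)) ¬vz))

  page-step : ∀ {B'} → Reply (M.edge ∷ C) B B' →
    Book (suc t) (M.edge ∷ C) B' F r s u v (bfilter (λ z → not (adj B' v z)) A)
  page-step {B'} rep = record
    { board = board-reply M.board rep ; score = page-gain ; used = used ; root = root ; second = second
    ; spine = M.kept u v spine
    ; unique = bfilter-unique _ (AllPairs.tail unique)
    ; pages = bfilter-⊆ _ (All.zipWith (λ { {z'} (z≢z' , uz' , rz' , z'≢v , ¬vz') →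
        M.kept u z' uz' , rz' , z'≢v , λ t → [ ¬vz' , [ (λ h → z≢z' (sym (proj₂ h))) , (λ h → z≢v (sym (proj₁ h))) ]′ ]′ (Adds.only M.adds {v} {z'} t) })
        (AllPairs.head unique , All.tail pages))
    ; open-pages = bfilter-all _ (λ z t → not⁻ t) A }

-- Written with a continuation, because the rest of the game has to be won after every sequence of
-- replies.
book-phase : ∀ q {t w} {C B : Graph n} {F r s u v A} → Book t C B F r s u v A → 2 * q ≤ length A →
  (∀ {C' B'} → Board C' B' F r s → t + q ≤ triangles C' → length B' ≤ length B + q → Wins w C' B') → Wins w C B
book-phase zero {t} b _ k = k (Book.board b) (≤-trans (≤-reflexive (+-identityʳ t)) (Book.score b)) (≤-reflexive (sym (+-identityʳ _)))
book-phase (suc q) {A = []} b h k = ⊥-elim (<⇒≱ (s≤s z≤n) h)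
book-phase (suc q) {t} {B = B} {A = z ∷ A} b h k = wins-move (page-move b) λ {B'} rep →
  book-phase q (page-step b rep)
    (tail₂ {q} h (still-open rep _ (AllPairs.tail (Book.unique b)) (All.tail (Book.open-pages b))))
    λ {C″} {B″} bd sc le → k bd (≤-trans (≤-reflexive (+-suc t q)) sc)
      (≤-trans le (≤-trans (+-monoˡ-≤ q (reply-length rep)) (≤-reflexive (sym (+-suc (length B) q)))))

-- `recent` separates Blocker's edges since the round began from `B₀`. As `S` spans no edge of `B₀`,
-- only recent edges can block pairs of leaves, and there is at most one of them per leaf.
record Star {n : ℕ} (t : ℕ) (B₀ : Graph n) (S : List (Fin n)) (u : Fin n)
    (C B : Graph n) (F : Fin n → Bool) (r s : Fin n → Fin n) (A W : List (Fin n)) : Set where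
  field
    board : Board C B F r s
    score : t ≤ triangles C
    used : ¬ T (F u)
    root : r u ≡ u
    centre : ∀ {x y} → (x , y) ∈ C → r x ≡ u → End u x y
    recent : Graph n
    split : B ≡ recent ++ B₀
    short : length recent ≤ length W
    unique : Unique A
    free : All (λ a → T (F a) × a ∈ S) A
    unblocked : All (λ a → ¬ T (adj B u a)) A
    unique-leaves : Unique W
    leaves : All (λ w → T (adj C u w) × r w ≡ u × w ∈ S) W

module _ {t : ℕ} {B₀ : Graph n} {S : List (Fin n)} {u : Fin n} {C B : Graph n} {F : Fin n → Bool} {r s : Fin n → Fin n}
    {a : Fin n} {A W : List (Fin n)} (st : Star t B₀ S u C B F r s (a ∷ A) W) where
  open Star st

  private
    fa = proj₁ (All.head free)
    a≢u : a ≢ u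
    a≢u refl = used fa
    r' = upd r a u
    F' = F ∖ a
    ru : r' u ≡ u
    ru = trans (upd-off r (a≢u ∘ sym)) root
    nF : ∀ {z} → ¬ T (F z) → ¬ T (F' z)
    nF h t = h (proj₁ (∖-off {F = F} t))
    ¬ua : ¬ T (adj C u a)
    ¬ua t = proj₂ (no-fresh board u a t) fa
    module M = Claim (adopt board u a fa) {u} {a} (a≢u ∘ sym) ¬ua (All.head unblocked)
      (trans ru (sym (upd-at r a u))) (inj₁ (inj₁ ru)) (λ f → nF used (subst (T ∘ F') ru f)) (nF used)
      (λ f → proj₂ (∖-off {F = F} f) refl)

  leaf-move : M.edge ∈ legalC C B
  leaf-move = M.playable

  leaf-step : ∀ {B'} → Reply (M.edge ∷ C) B B' →
    Star t B₀ S u (M.edge ∷ C) B' F' r' s (bfilter (λ z → not (adj B' u z)) A) (a ∷ W)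
  leaf-step {B'} rep = record
    { board = board-reply M.board rep ; score = ≤-trans score (triangles-mono M.edge C)
    ; used = nF used ; root = ru ; centre = centre' M.is-xy
    ; recent = proj₁ (moved rep) ; split = proj₁ (proj₂ (moved rep)) ; short = proj₂ (proj₂ (moved rep))
    ; unique = bfilter-unique _ (AllPairs.tail unique)
    ; free = bfilter-⊆ _ (All.zipWith (λ { (ne , f , i) → ∖-on {F = F} f (ne ∘ sym) , i }) (AllPairs.head unique , All.tail free))
    ; unblocked = bfilter-all _ (λ z t → not⁻ t) A
    ; unique-leaves = All.map (λ {w} h → a≢leaf w (proj₁ h)) leaves ∷ unique-leaves
    ; leaves = (Adds.new M.adds , upd-at r a u , proj₂ (All.head free)) ∷
        All.map (λ { {w} (uw , rw , i) → M.kept u w uw , trans (upd-off r (a≢leaf w uw ∘ sym)) rw , i }) leaves }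
    where
    a≢leaf : ∀ w → T (adj C u w) → a ≢ w
    a≢leaf _ uw refl = ¬ua uw
    centre' : ∀ {e} → e ≡ (u , a) ⊎ e ≡ (a , u) → ∀ {x y} → (x , y) ∈ e ∷ C → r' x ≡ u → End u x y
    centre' (inj₁ refl) (here refl) _ = inj₁ refl
    centre' (inj₂ refl) (here refl) _ = inj₂ refl
    centre' _ (there i) e = centre i (trans (sym (upd-off r λ { refl → proj₁ (isolated board fa) i })) e)
    moved : ∀ {B'} → Reply (M.edge ∷ C) B B' → ∃[ D ] B' ≡ D ++ B₀ × length D ≤ suc (length W)
    moved pass = recent , split , m≤n⇒m≤1+n short
    moved (claim {e} _) = e ∷ recent , cong (e ∷_) split , s≤s short

star-phase : ∀ j {t w} {B₀ : Graph n} {S u C B F r s A W} → Star t B₀ S u C B F r s A W → 2 * j ≤ length A →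
  (∀ {C' B' F' r' A' W'} → Star t B₀ S u C' B' F' r' s A' W' → length W' ≡ j + length W → V# F ≤ j + V# F' → Wins w C' B') →
  Wins w C B
star-phase zero st _ k = k st refl ≤-refl
star-phase (suc j) {A = []} st h k = ⊥-elim (<⇒≱ (s≤s z≤n) h)
star-phase (suc j) {F = F} {A = a ∷ A} {W} st h k = wins-move (leaf-move st) λ {B'} rep →
  star-phase j (leaf-step st rep)
    (tail₂ {j} h (still-open rep _ (AllPairs.tail (Star.unique st)) (All.tail (Star.unblocked st))))
    λ st' len fr → k st' (trans len (+-suc j (length W))) (≤-trans (∖-size F a) (s≤s fr))

open Board

-- Low degrees and independent sets

row : {v : Fin n} {q : Fin n → Bool} {xs : List (Fin n)} (ys : List (Fin n)) → v ∈ xs →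
  cnt q ys ≤ cnt (λ ab → (proj₁ ab == v) ∧ q (proj₂ ab)) (cartesianProduct xs ys)
row {v = v} {q} {x ∷ xs} ys i = ≤-trans (go i) (≤-reflexive (sym
  (trans (cnt-++ p (map (x ,_) ys) (cartesianProduct xs ys)) (cong (_+ cnt p (cartesianProduct xs ys)) (cnt-map p (x ,_) ys)))))
  where
  p = λ ab → (proj₁ ab == v) ∧ q (proj₂ ab)
  go : v ∈ x ∷ xs → cnt q ys ≤ cnt (λ b → p (x , b)) ys + cnt p (cartesianProduct xs ys)
  go (here refl) = ≤-trans (cnt-mono (λ b t → ∧⁺ {v == v} (==⁺ refl) t) ys) (m≤m+n _ _)
  go (there j) = ≤-trans (row ys j) (m≤n+m _ _)

all-pairs : (n : ℕ) → List (Fin n × Fin n)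
all-pairs n = cartesianProduct (allFin n) (allFin n)

handshake : (D : Graph n) → cnt (λ ab → adj D (proj₁ ab) (proj₂ ab)) (all-pairs n) ≤ 2 * length D
handshake {n} [] = ≤-reflexive (cnt-≡0 (λ _ ()) (all-pairs n))
handshake {n} ((x , y) ∷ D) = ≤-trans
  (cnt-∪ {p = λ ab → sameE ab (x , y) ∨ sameE ab (y , x)} {q = λ ab → adj D (proj₁ ab) (proj₂ ab)} split (all-pairs n))
  (≤-trans (+-mono-≤ (≤-trans (cnt-∪ (λ ab → ∨⁻ {sameE ab (x , y)}) (all-pairs n)) (+-mono-≤ (point (x , y)) (point (y , x)))) (handshake D))
    (≤-reflexive (sym (*-suc 2 (length D)))))
  where
  point : ∀ e → cnt (λ ab → sameE ab e) (all-pairs n) ≤ 1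
  point e = cnt-≤1 (λ {a} {b} s t → trans (sameE⁻ {e = a} {e} s) (sym (sameE⁻ {e = b} {e} t))) (cartesianProduct⁺ (allFin⁺ n) (allFin⁺ n))
  split : ∀ ab → T (adj ((x , y) ∷ D) (proj₁ ab) (proj₂ ab)) → T (sameE ab (x , y) ∨ sameE ab (y , x)) ⊎ T (adj D (proj₁ ab) (proj₂ ab))
  split (a , b) t with Adds.only (adj-adds x y D) {a} {b} t
  ... | inj₁ h = inj₂ h
  ... | inj₂ (inj₁ (refl , refl)) = inj₁ (∨⁺ˡ _ (sameE⁺ (a , b)))
  ... | inj₂ (inj₂ (refl , refl)) = inj₁ (∨⁺ʳ (sameE (a , b) (x , y)) (sameE⁺ (a , b)))

-- Otherwise the rows of the adjacency matrix at the vertices of `F` alone would have more entries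
-- than twice the number of edges.
low-degree : (F : Fin n → Bool) (D : Graph n) (d : ℕ) → 2 * length D < suc d * V# F → ∃[ v ] T (F v) × V# (adj D v) ≤ d
low-degree {n} F D d h with any? (λ v → T? (F v) ×-dec (V# (adj D v) ≤? d))
... | yes r = r
... | no none = ⊥-elim (<⇒≱ h (≤-trans (≤-reflexive (trans (*-comm (suc d) (V# F)) (cong (_* suc d) (sym (cnt-bfilter F (allFin n))))))
    (≤-trans (cnt-family {p = λ ab → adj D (proj₁ ab) (proj₂ ab)} {xs = all-pairs n} (suc d)
        (λ v ab → (proj₁ ab == v) ∧ adj D v (proj₂ ab)) (AllPairs.map disjoint (bfilter-unique F (allFin⁺ n)))
        (bfilter-all F (λ v f → ≤-trans (≰⇒> (λ le → none (v , f , le))) (row {q = adj D v} (allFin n) (∈-allFin v)) ,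
           λ { (a , b) t → let e , k = ∧⁻ {a == v} t in subst (λ a → T (adj D a b)) (sym (==⁻ e)) k }) (allFin n)))
      (handshake D))))
  where
  disjoint : ∀ {u v : Fin n} → u ≢ v → ∀ ab → T ((proj₁ ab == u) ∧ adj D u (proj₂ ab)) → T ((proj₁ ab == v) ∧ adj D v (proj₂ ab)) → ⊥
  disjoint {u} {v} ne (a , b) s t = ne (trans (sym (==⁻ (proj₁ (∧⁻ {a == u} s)))) (==⁻ (proj₁ (∧⁻ {a == v} t))))

-- Greedy choice: a vertex with at most `d` neighbours is taken and deleted together with them, at a
-- cost of `suc d` vertices. At least `A₀` vertices are present at every choice, which is what the
-- averaging requires.
independent : {B : Graph n} → Simple (adj B) → (d A₀ : ℕ) → 2 * length B < suc d * A₀ →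
  ∀ k (F : Fin n → Bool) → A₀ + k * suc d ≤ V# F →
  ∃[ S ] length S ≡ k × Unique S × All (T ∘ F) S × (∀ {x y} → x ∈ S → y ∈ S → ¬ T (adj B x y))
independent sm d A₀ h zero F le = [] , refl , [] , [] , λ ()
independent {n} {B} sm d A₀ h (suc k) F le
  with low-degree F B d (<-≤-trans h (*-monoʳ-≤ (suc d) (≤-trans (m≤m+n A₀ _) le)))
... | v , fv , deg with independent {B = B} sm d A₀ h k F' (+-cancelˡ-≤ (suc d) _ _ (≤-trans (≤-reflexive (shift (suc d) A₀ (k * suc d))) (≤-trans le lost)))
  where
  F' : Fin n → Bool
  F' z = (F ∖ v) z ∧ not (adj B v z)
  split : ∀ z → T ((F ∖ v) z) → T (adj B v z) ⊎ T (F' z)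
  split z t with T? (adj B v z)
  ... | yes e = inj₁ e
  ... | no ne = inj₂ (∧⁺ t (not⁺ ne))
  lost : V# F ≤ suc d + V# F'
  lost = ≤-trans (∖-size F v) (s≤s (≤-trans (cnt-∪ {p = adj B v} {q = F'} split (allFin n)) (+-monoˡ-≤ (V# F') deg)))
  shift : ∀ a b c → a + (b + c) ≡ b + (a + c)
  shift = solve-∀
... | S , len , uq , fs , ind = v ∷ S , cong suc len , All.map (λ {z} f e → proj₂ (off {z} f) (sym e)) fs ∷ uq ,
      fv ∷ All.map (λ {z} f → proj₁ (off {z} f)) fs , ind'
  where
  off : ∀ {z} → T ((F ∖ v) z ∧ not (adj B v z)) → T (F z) × z ≢ v
  off {z} f = ∖-off {F = F} (proj₁ (∧⁻ {(F ∖ v) z} f))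
  away : ∀ {z} → z ∈ S → ¬ T (adj B v z)
  away {z} i = not⁻ (proj₂ (∧⁻ {(F ∖ v) z} (All.lookup fs i)))
  ind' : ∀ {x y} → x ∈ v ∷ S → y ∈ v ∷ S → ¬ T (adj B x y)
  ind' (here refl) (here refl) t = Simple.irr sm {v} t
  ind' (here refl) (there j) t = away j t
  ind' {x} (there i) (here refl) t = away i (adj-sym x v B t)
  ind' {x} {y} (there i) (there j) t = ind {x} {y} i j t

module Round (q d A₀ β : ℕ) (big : 2 * β < suc d * A₀) where
  -- The number of leaves: the future second hub, at most two leaves blocked from it, and `2 * q`
  -- candidates for `q` pages.
  m : ℕ
  m = 3 + 2 * q

  -- The independent set consists of the centre and `2 * m` candidates for `m` leaves. A round uses
  -- `suc m` fresh vertices and lasts `m + q` moves.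
  round : ∀ {t w} {C B : Graph n} {F r s} → Board C B F r s → t ≤ triangles C → length B ≤ β →
    A₀ + suc (2 * m) * suc d ≤ V# F →
    (∀ {C' B' F' r' s'} → Board C' B' F' r' s' → t + q ≤ triangles C' → length B' ≤ length B + (m + q) →
      V# F ≤ suc m + V# F' → Wins w C' B') → Wins w C B
  round {n} {t} {w} {C} {B} {F} {r} {s} bd sc lb room k =
    play (independent {B = B} (sorted-simple (Legal.sortedᵇ (legal bd))) d A₀ (≤-<-trans (*-monoʳ-≤ 2 lb) big) (suc (2 * m)) F room)
    where
    play : ∃[ S ] length S ≡ suc (2 * m) × Unique S × All (T ∘ F) S × (∀ {x y} → x ∈ S → y ∈ S → ¬ T (adj B x y)) → Wins w C B
    play (u ∷ A , len , (u∉ ∷ uq) , (fu ∷ fs) , ind) = star-phase m st (≤-reflexive (sym (suc-injective len))) finish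
     where
     S = u ∷ A
     st : Star t B S u C B (F ∖ u) (upd r u u) s A []
     st = record
       { board = adopt bd u u fu ; score = sc ; used = λ f → proj₂ (∖-off {F = F} f) refl ; root = upd-at r u u
       ; centre = λ {x} i e → ⊥-elim (proj₂ (proj₂ (covered bd i))
           (subst (T ∘ F) (sym (trans (sym (upd-off r {b = u} λ { refl → proj₁ (isolated bd fu) i })) e)) fu))
       ; recent = [] ; split = refl ; short = z≤n ; unique = uq
       ; free = All.tabulate (λ {z} i → ∖-on {F = F} (All.lookup fs i) (λ e → All.lookup u∉ i (sym e)) , there i)
       ; unblocked = All.tabulate (λ i → ind (here refl) (there i)) ; unique-leaves = [] ; leaves = [] }
     finish : ∀ {C' B' F' r' A' W} → Star t B S u C' B' F' r' s A' W → length W ≡ m + 0 → V# (F ∖ u) ≤ m + V# F' → Wins w C' B'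
     finish {C'} {B'} {F'} {r'} {A'} {W} st' lw fr = go (low-degree member (Star.recent st') 2 few)
       where
       open Star st'
       member : Fin n → Bool
       member z = ⌊ _∈?_ _≟ᶠ_ z W ⌋
       lw' : length W ≡ m
       lw' = trans lw (+-identityʳ m)
       -- At most `m` recent edges against `m` leaves: the average degree is at most 2, so some leaf
       -- has degree at most 2.
       few : 2 * length recent < 3 * V# member
       few = ≤-trans (s≤s (*-monoʳ-≤ 2 short)) (≤-trans (subst (λ l → suc (2 * l) ≤ 3 * l) (sym lw') (≤-trans (m≤m+n _ (2 + 2 * q)) (≤-reflexive (count q))))
         (*-monoʳ-≤ 3 (V#-unique unique-leaves (All.tabulate fromWitness))))
         where
         count : ∀ q → suc (2 * (3 + 2 * q)) + (2 + 2 * q) ≡ 3 * (3 + 2 * q)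
         count = solve-∀
       go : ∃[ v ] T (member v) × V# (adj recent v) ≤ 2 → Wins w C' B'
       go (v , v∈ , deg) = book-phase q bk enough λ {C″} {B″} bd″ sc″ lb″ → k bd″ sc″
         (≤-trans lb″ (≤-trans (+-monoˡ-≤ q len') (≤-reflexive (+-assoc (length B) m q))))
         (≤-trans (∖-size F u) (s≤s fr))
         where
         v-leaf = All.lookup leaves (toWitness v∈)
         page : Fin n → Bool
         page z = not ((z == v) ∨ adj recent v z)
         simple = Legal.simpleᶜ (legal board)
         leaf≢u : ∀ {z} → T (adj C' u z) → z ≢ u
         leaf≢u t refl = Simple.irr simple {u} t
         no-leaf-edge : ∀ {z} → T (adj C' u z) → r' z ≡ u → ¬ T (adj C' v z)
         no-leaf-edge {z} uz rz t with adj⁻ v z C' t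
         ... | inj₁ i = [ leaf≢u (proj₁ v-leaf) ∘ sym , leaf≢u uz ∘ sym ]′ (centre i (proj₁ (proj₂ v-leaf)))
         ... | inj₂ i = [ leaf≢u uz ∘ sym , leaf≢u (proj₁ v-leaf) ∘ sym ]′ (centre i rz)
         bk : Book t C' B' F' r' (upd s u v) u v (bfilter page W)
         bk = record
           { board = second-hub board u v centre ; score = score ; used = used
           ; root = proj₁ (proj₂ v-leaf) ; second = upd-at s u v ; spine = proj₁ v-leaf
           ; unique = bfilter-unique page unique-leaves
           ; pages = All.zipWith (λ { {z} ((uz , rz , _) , pz) → uz , rz , (λ e → not⁻ pz (∨⁺ˡ _ (==⁺ e))) , no-leaf-edge uz rz })
               (bfilter-⊆ page leaves , bfilter-all page (λ _ p → p) W)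
           ; open-pages = All.zipWith (λ { {z} ((_ , _ , z∈) , pz) t → unclaimed-page z z∈ pz t })
               (bfilter-⊆ page leaves , bfilter-all page (λ _ p → p) W) }
           where
           unclaimed-page : ∀ z → z ∈ S → T (page z) → ¬ T (adj B' v z)
           unclaimed-page z z∈ pz t with adj⁻ v z (recent ++ B) (subst (λ G → T (adj G v z)) split t)
           ... | inj₁ i = [ (λ j → not⁻ pz (∨⁺ʳ (z == v) (adj⁺ v z {recent} (inj₁ j)))) , (λ j → ind (proj₂ (proj₂ v-leaf)) z∈ (adj⁺ v z (inj₁ j))) ]′ (∈-++⁻ recent i)
           ... | inj₂ i = [ (λ j → not⁻ pz (∨⁺ʳ (z == v) (adj⁺ v z {recent} (inj₂ j)))) , (λ j → ind (proj₂ (proj₂ v-leaf)) z∈ (adj⁺ v z (inj₂ j))) ]′ (∈-++⁻ recent i)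
         enough : 2 * q ≤ length (bfilter page W)
         enough = +-cancelˡ-≤ 3 _ _ (≤-trans (≤-reflexive (sym lw')) (≤-trans (≤-reflexive (sym (cnt-true W)))
           (≤-trans (cnt-∪ {p = λ z → (z == v) ∨ adj recent v z} {q = page} either W)
           (≤-trans (+-monoˡ-≤ _ (≤-trans (cnt-∪ (λ z → ∨⁻ {z == v}) W) (+-mono-≤ (cnt-≤1 (λ a b → trans (==⁻ a) (sym (==⁻ b))) unique-leaves)
               (≤-trans at-most deg))))
             (≤-reflexive (cong (3 +_) (sym (cnt-bfilter page W))))))))
           where
           either : ∀ z → T true → T ((z == v) ∨ adj recent v z) ⊎ T (page z)
           either z _ with T? ((z == v) ∨ adj recent v z)
           ... | yes t = inj₁ t
           ... | no t = inj₂ (not⁺ t)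
           at-most : cnt (adj recent v) W ≤ V# (adj recent v)
           at-most = ≤-trans (≤-reflexive (sym (cnt-bfilter (adj recent v) W)))
             (V#-unique (bfilter-unique (adj recent v) unique-leaves) (bfilter-all (adj recent v) (λ _ p → p) W))
         len' : length B' ≤ length B + m
         len' = ≤-trans (≤-reflexive (trans (cong length split) (length-++ recent)))
           (≤-trans (+-monoˡ-≤ (length B) (≤-trans short (≤-reflexive lw'))) (≤-reflexive (+-comm m (length B))))

  rounds : ∀ R {t} {C B : Graph n} {F r s} → Board C B F r s → t ≤ triangles C → length B + R * (m + q) ≤ β →
    (A₀ + suc (2 * m) * suc d) + R * suc m ≤ V# F → Wins (t + R * q) C B
  rounds zero {t} bd sc _ _ = wins-now (≤-trans (≤-reflexive (+-identityʳ t)) sc)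
  rounds (suc R) {t} {C} {B} {F} bd sc lb room = subst (λ w → Wins w C B) (+-assoc t q (R * q))
    (round bd sc (≤-trans (m≤m+n _ _) lb) (≤-trans (m≤m+n _ _) room) λ {C'} {B'} {F'} bd' sc' lb' fr →
      rounds R bd' sc'
        (≤-trans (+-monoˡ-≤ (R * (m + q)) lb') (≤-trans (≤-reflexive (+-assoc (length B) (m + q) (R * (m + q)))) lb))
        (+-cancelˡ-≤ (suc m) _ _ (≤-trans (≤-reflexive (shift (suc m) (A₀ + suc (2 * m) * suc d) (R * suc m))) (≤-trans room fr))))
    where
    shift : ∀ a b c → a + (b + c) ≡ b + (a + c)
    shift = solve-∀

-- Choice of the parameters

empty-board : Board {n} [] [] (λ _ → true) (λ z → z) (λ z → z)
empty-board = record { legal = record { sortedᶜ = λ () ; sortedᵇ = λ () ; separate = λ () } ; covered = λ () ; isolated = λ _ → (λ ()) , (λ ()) }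

lower : ∀ q R d A₀ n → 2 * (R * (3 + 2 * q + q)) < suc d * A₀ →
  (A₀ + suc (2 * (3 + 2 * q)) * suc d) + R * suc (3 + 2 * q) ≤ n → R * q ≤ g n
lower q R d A₀ n big room = Wins.reach (rounds R {0} {[]} {[]} empty-board z≤n ≤-refl
    (≤-trans room (≤-reflexive (sym (trans (cnt-true (allFin n)) (length-tabulate (λ i → i)))))))
    (length (allEdges n))
    (≤-trans (≤-reflexive (cnt-bfilter _ (allEdges n))) (≤-trans (cnt-mono (λ _ _ → _) (allEdges n)) (≤-reflexive (cnt-true (allEdges n)))))
  where open Round q d A₀ (R * (3 + 2 * q + q)) big

-- Divided by `suc k * n`, this places `2 * g n / n` between `1 - ε` and `1 + ε` for
-- `ε = 1 / suc k`.
theorem1p2 : (k : ℕ) → ∃[ N ] ((n : ℕ) → N ≤ n →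
    (k * n ≤ 2 * (suc k * g n)) × (2 * (suc k * g n) ≤ suc (suc k) * n))
theorem1p2 k = N , λ n N≤n → from-below n N≤n , from-above n
  where
  -- Per unit of `x` there are `K` rounds of `4 + 2 * q` vertices and one vertex kept aside for
  -- `A₀ = x`, which makes `per`. The value of `d` turns twice the number of moves into `d * x`,
  -- below `suc d * x`. `room` is the supply for the choice of an independent set, and `q = 2 * K`
  -- keeps the loss of four vertices per round small.
  K q d room per N : ℕ
  K = suc k
  q = 2 * K
  d = 2 * (K * (3 + 2 * q + q))
  room = suc (2 * (3 + 2 * q)) * suc d
  per = suc (K * suc (3 + 2 * q))
  N = room + (room + per) * per

  from-above : ∀ n → 2 * (K * g n) ≤ suc K * n
  from-above n = ≤-trans (≤-reflexive (e K (g n))) (≤-trans (*-monoʳ-≤ K (upper n)) (m≤n+m (K * n) n))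
    where
    e : ∀ a b → 2 * (a * b) ≡ a * (2 * b)
    e = solve-∀

  from-below : ∀ n → N ≤ n → k * n ≤ 2 * (K * g n)
  from-below n N≤n = ≤-trans many (*-monoʳ-≤ 2 (*-monoʳ-≤ K (lower q (K * x) d x n big fits)))
    where
    n' x : ℕ
    n' = n ∸ room
    x = n' / per

    -- The purpose of `N`: the fixed `room` and the remainder of the division together are absorbed
    -- by a single further `x`.
    x-large : room + per ≤ x
    x-large = ≤-trans (≤-reflexive (sym (m*n/n≡m (room + per) per)))
      (/-monoˡ-≤ per (≤-trans (≤-reflexive (sym (m+n∸m≡n room _))) (∸-monoˡ-≤ room N≤n)))

    split : n ≡ room + (n' % per + x * per)
    split = trans (sym (m+[n∸m]≡n (≤-trans (m≤m+n room _) N≤n))) (cong (room +_) (m≡m%n+[m/n]*n n' per))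

    big : 2 * (K * x * (3 + 2 * q + q)) < suc d * x
    big = ≤-trans (≤-reflexive (e K x (3 + 2 * q + q))) (+-monoˡ-≤ (d * x) (≤-trans (s≤s z≤n) (≤-trans (m≤n+m per room) x-large)))
      where
      e : ∀ a b c → suc (2 * (a * b * c)) ≡ 1 + 2 * (a * c) * b
      e = solve-∀

    fits : (x + room) + K * x * suc (3 + 2 * q) ≤ n
    fits = ≤-trans (≤-reflexive (e x room K (suc (3 + 2 * q)))) (≤-trans (+-monoʳ-≤ room (m≤n+m (x * per) (n' % per))) (≤-reflexive (sym split)))
      where
      e : ∀ x c a b → (x + c) + a * x * b ≡ c + x * suc (a * b)
      e = solve-∀

    many : k * n ≤ 2 * (K * (K * x * q))
    many = ≤-trans (*-monoʳ-≤ k n≤) (≤-trans (m≤m+n _ (x * (2 * K + 2))) (≤-reflexive (e k x)))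
      where
      n≤ : n ≤ x + x * per
      n≤ = ≤-trans (≤-reflexive (trans split (sym (+-assoc room (n' % per) (x * per)))))
        (+-monoˡ-≤ (x * per) (≤-trans (+-monoʳ-≤ room (<⇒≤ (m%n<n n' per))) x-large))
      e : ∀ k x → k * (x + x * suc (suc k * suc (3 + 2 * (2 * suc k)))) + x * (2 * suc k + 2) ≡ 2 * (suc k * (suc k * x * (2 * suc k)))
      e = solve-∀
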